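{- Let $k\ge 0$. For all $(m,n)\in U_k$: (1) if $n=f_{2k+3}-1$, then $H_{m,n}=(-1)^{k+1}(-1)^{\frac{f_{2k+5}}{2}-\Phi_{k+1}(m+n)}\cdot\frac{f_{2k+1}}{2}$; (2) if $n=f_{2k}$, then $H_{m,n}=(-1)^{k+1}(-1)^{\frac{f_{2k+2}-1}{2}}\cdot\frac{f_{2k+1}}{2}$; (3) if $f_{2k}<n<f_{2k+3}-1$, then: if $m+n=\alpha_i-f_{2k+2}+1$ or $m+n=\alpha_i$ for some $i\ge 1$, we have \[H_{m,n}=-(-1)^{(f_{2k+3}-n)k}(-1)^{\frac{(f_{2k+3}-1-n)(f_{2k+3}-2-n)}{2}}\cdot\frac{f_{2k+1}}{2};\] otherwise $H_{m,n}=0$.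
   Context: Let $\tau$ be the substitution on $\{0,1\}$ with $\tau(1)=101$, $\tau(0)=1$ (extended to words by concatenation), and let $\mathbf{s}=(s_j)_{j\ge 0}=\lim_{j\to\infty}\tau^j(1)$ be its fixed point beginning with $1$. For $m\ge 0$, $n\ge 1$, $H_{m,n}=\det(s_{m+i+j})_{0\le i,j\le n-1}$. Define $f_{2j}=|\tau^j(1)|$, $f_{2j+1}=|\tau^j(10)|$ ($|w|$ = length of $w$); equivalently $f_0=1$, $f_1=2$, $f_{2j+2}=f_{2j}+f_{2j+1}$, $f_{2j+3}=f_{2j}+f_{2j+2}$, giving $(1,2,3,4,7,10,17,24,41,\dots)$; the $f_{2j+1}$ are even and the $f_{2j}$ odd. Every integer $n\ge0$ has a unique representation $n=\sum_{i\ge0}a_i(n)f_i$ with $a_i(n)\in\{0,1\}$, finitely many nonzero, $a_ia_{i+1}=0$ for all $i$, and $a_ia_{i+2}=0$ for all even $i$. For $k\ge0$ put $\Phi_k(n)=\sum_{i=0}^{2k+2}a_i(n)f_i$. Let $\mathbb{N}=\{0,1,2,\dots\}$. For $k\ge 0$ let $E'_{k}=\{x\in\mathbb{N}:\Phi_k(x)=f_{2k+3}/2\}$, $F_k=\{y\in\mathbb{N}:\Phi_k(y)=f_{2k+1}/2\}$, $F'_k=\{y\in\mathbb{N}:\Phi_{k+1}(y)=f_{2k+1}/2\}$, $F''_k=F_k\setminus F'_k$. For fixed $k$, let $(\alpha_i)_{i\ge1}$, $(\beta'_i)_{i\ge1}$, $(\gamma_i)_{i\ge1}$ be the increasing enumerations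 of $E'_{k+1}$, $F''_k$, $E'_k$ respectively, and $\beta_i=\beta'_i+f_{2k}$. For $i\ge1$ define $U_{k,i}=\{(m,n)\in\mathbb{N}^2: f_{2k}\le n<f_{2k+3},\ \alpha_i-f_{2k+2}<n+m\le\alpha_i\}$, $V_{k,i}=\{(m,n)\in\mathbb{N}^2: f_{2k}\le n<f_{2k+2},\ \beta_i<n+m\le\beta_i+f_{2k+1}\}$, $T_{k,i}=\{(m,n)\in\mathbb{N}^2: f_{2k+1}\le n<f_{2k+2},\ \gamma_i-f_{2k}<n+m\le\gamma_i\}$, and $U_k=\bigcup_{i\ge1}U_{k,i}$, $V_k=\bigcup_{i\ge1}V_{k,i}$, $T_k=\bigcup_{i\ge1}T_{k,i}$. -}

module Defs where

open import Data.Bool using (Bool; true; false; if_then_else_)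
open import Data.Nat using (ℕ; zero; suc; _+_; _*_; _∸_; _/_; _%_; _<_; _≤_)
open import Data.List using (List; []; _∷_; length; map; upTo)
open import Data.Nat.ListAction using (sum)
open import Data.Fin using (Fin; toℕ; punchIn)
import Data.Fin as Fin
open import Data.Integer using (ℤ; +_; -_; ∣_∣) renaming (_+_ to _+ℤ_; _*_ to _*ℤ_; _-_ to _-ℤ_)
open import Data.Product using (Σ; _×_; _,_)
open import Relation.Binary.PropositionalEquality using (_≡_)

τ : List Bool → List Bool
τ [] = []
τ (true ∷ w) = true ∷ false ∷ true ∷ τ w
τ (false ∷ w) = true ∷ τ w

τ^ : ℕ → List Bool → List Bool
τ^ zero w = w
τ^ (suc j) w = τ (τ^ j w)

letter : List Bool → ℕ → Bool
letter [] _ = false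
letter (b ∷ w) zero = b
letter (b ∷ w) (suc j) = letter w j

-- Fixed point s = lim τ^j(1).  Since τ^j(1) is a prefix of τ^(j+1)(1) and
-- |τ^(j+1)(1)| > j, the j-th letter of s is the j-th letter of τ^(j+1)(1).
s : ℕ → ℕ
s j = if letter (τ^ (suc j) (true ∷ [])) j then 1 else 0

fAux : ℕ → ℕ → ℕ
fAux j zero = length (τ^ j (true ∷ []))
fAux j (suc _) = length (τ^ j (true ∷ false ∷ []))

f : ℕ → ℕ
f n = fAux (n / 2) (n % 2)

det : (n : ℕ) → (Fin n → Fin n → ℤ) → ℤ
det zero M = + 1
det (suc n) M = go (suc n) (λ j → j)
  where
  sgn : ℕ → ℤ
  sgn k = if letter (true ∷ false ∷ []) (k % 2) then + 1 else - (+ 1)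
  term : Fin (suc n) → ℤ
  term j = sgn (toℕ j) *ℤ (M Fin.zero j *ℤ det n (λ a b → M (Fin.suc a) (punchIn j b)))
  go : (k : ℕ) → (Fin k → Fin (suc n)) → ℤ
  go zero _ = + 0
  go (suc k) idx = term (idx Fin.zero) +ℤ go k (λ i → idx (Fin.suc i))

H : ℕ → ℕ → ℤ
H m n = det n (λ i j → + s (m + toℕ i + toℕ j))

negOnePow : ℤ → ℤ
negOnePow z = if letter (true ∷ false ∷ []) (∣ z ∣ % 2) then + 1 else - (+ 1)

-- Digit sequences (a_0, a_1, ...) as finite lists (trailing entries 0).
digit : List Bool → ℕ → ℕ
digit a i = if letter a i then 1 else 0

Admissible : List Bool → Set
Admissible a = ((i : ℕ) → letter a i ≡ true → letter a (suc i) ≡ false)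
             × ((j : ℕ) → letter a (2 * j) ≡ true → letter a (2 + 2 * j) ≡ false)

value : List Bool → ℕ
value a = sum (map (λ i → digit a i * f i) (upTo (length a)))

truncVal : ℕ → List Bool → ℕ
truncVal k a = sum (map (λ i → digit a i * f i) (upTo (2 * k + 3)))

-- a is the (unique) admissible representation of n
IsRep : List Bool → ℕ → Set
IsRep a n = Admissible a × value a ≡ n

PhiIs : ℕ → ℕ → ℕ → Set
PhiIs k x v = Σ (List Bool) (λ a → IsRep a x × truncVal k a ≡ v)

E' : ℕ → ℕ → Set
E' k x = PhiIs k x (f (2 * k + 3) / 2)

InU : ℕ → ℕ → ℕ → Set
InU k m n = f (2 * k) ≤ n × n < f (2 * k + 3)
          × Σ ℕ (λ α → E' (suc k) α × (α < n + m + f (2 * k + 2)) × (n + m ≤ α))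

{-# OPTIONS --safe #-}
-- The numbers of E' (k+1) are the points at distance f(2k+5)/2 from the left end of the blocks τ^(k+2)(1) of s.  In
-- the centre of such a block lies a maximal run of period q = f(2k); just outside of it, at either end, s(j+q) - s(j)
-- is ±1.  Subtracting from each column of the Hankel matrix the column q places to its left therefore produces a zero
-- column if (m , n) is inside the tile, and on the boundary of the tile it leaves two anti-triangular blocks with ±1
-- on the diagonal next to the q × q Hankel matrix of a q-periodic sequence.  That sequence changes in two adjacent
-- places only if it is shifted by t = |τ^k(0)|, which is prime to q.  So subtracting column j+t from column j (mod q)
-- for all j ≠ 0 makes this matrix bidiagonal up to one column, and its determinant is, up to sign, the number of 1s
-- in a period, f(2k+1)/2.
module Submission where

open import Defs
open import Data.Bool using (Bool; true; false; if_then_else_; not; _∧_)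
open import Data.Bool.Properties using (not-involutive)
open import Data.Empty using (⊥)
open import Data.Fin as Fin using (Fin; toℕ; punchIn)
open import Data.Integer as ℤ using (ℤ; -_; 0ℤ; 1ℤ; -1ℤ) renaming (_+_ to _+ℤ_; _*_ to _*ℤ_; _-_ to _-ℤ_; _^_ to _^ℤ_)
import Data.Integer.Properties as ℤP
open import Data.Integer.Tactic.RingSolver using (solve-∀)
open import Data.List using (List; []; _∷_; _++_; length; map; upTo; applyUpTo)
open import Data.List.Properties using (++-assoc; ++-identityʳ; length-++; map-upTo)
open import Data.Nat using (ℕ; zero; suc; _+_; _*_; _∸_; _/_; _%_; _<_; _≤_; z≤n; s≤s; z<s; s<s; s≤s⁻¹; _<?_; _≤?_; _≟_)
open import Data.Nat.Coprimality using (Coprime; coprime-+; coprime-Bézout; 1-coprimeTo) renaming (sym to coprime-sym)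
open import Data.Nat.DivMod
open import Data.Nat.GCD using (module Bézout)
open import Data.Nat.ListAction using (sum)
open import Data.Nat.Properties
open import Data.Nat.Tactic.RingSolver renaming (solve-∀ to solveℕ-∀)
open import Data.Product using (Σ; _×_; _,_; ∃; proj₁; proj₂)
open import Data.Sum using (_⊎_; inj₁; inj₂)
open import Function using (_∘_; case_of_)
open import Relation.Binary using (tri<; tri≈; tri>)
open import Relation.Binary.PropositionalEquality
open import Relation.Nullary using (¬_; yes; no; does; contradiction)
open import Relation.Nullary.Decidable using (dec-true; dec-false)

-- Determinants of matrices indexed by ℕ

-- Both comparisons of letters rest on one fact: τ^k(10) and τ^k(01) differ only in their two middle
-- letters. Because of it, τ^(k+2)(1) can be cut in two ways that show the same word `core k` at
-- places q apart, flanked by the middle pair in opposite orders; this yields all differences s(j+q)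
-- - s(j) that occur. The same fact for τ^(k-1) gives the two places at which the periodic sequence
-- changes under the shift by t. The zero differences fill f(2k+3) - 2 places. This bounds the tile:
-- for n = f(2k+3) - 1 the window can meet the mismatches at both ends of the run, on a slanted side
-- it meets one of them, and for n = q there are no difference columns at all. The numeration enters
-- because admissible digits spell a prefix of s, two digits for each application of τ; hence Φ is
-- an offset from the start of a block. The digit with the highest index in Φ has a special role: it
-- stands for a whole block τ^K(1), so a number in a block τ^K(0) is measured from the block τ^K(1)
-- before it. All signs come down to two parities: q is odd, and f(2k+1)/2 has the parity of k+1.

sgn : ℕ → ℤ
sgn zero = 1ℤ
sgn (suc n) = - sgn n

skip : ℕ → ℕ → ℕ
skip zero c = suc c
skip (suc j) zero = zero
skip (suc j) (suc c) = suc (skip j c)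

∑ : ℕ → (ℕ → ℤ) → ℤ
∑ zero g = 0ℤ
∑ (suc n) g = g 0 +ℤ ∑ n (g ∘ suc)

-- Indices are unbounded and `D n` reads only the n × n corner, so minors and blocks are formed by
-- reindexing, without casts between `Fin` types.
Mat : Set
Mat = ℕ → ℕ → ℤ

minor : ℕ → Mat → Mat
minor j M i c = M (suc i) (skip j c)

D : ℕ → Mat → ℤ
D zero M = 1ℤ
D (suc n) M = ∑ (suc n) (λ j → sgn j *ℤ (M 0 j *ℤ D n (minor j M)))

sign-of-% : ∀ k → (if letter (true ∷ false ∷ []) (k % 2) then ℤ.+ 1 else - (ℤ.+ 1)) ≡ sgn k
sign-of-% zero = refl
sign-of-% (suc zero) = refl
sign-of-% (suc (suc k)) = trans (sign-of-% k) (sym (ℤP.neg-involutive (sgn k)))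

toℕ-punchIn : ∀ {n} (j : Fin (suc n)) (b : Fin n) → toℕ (punchIn j b) ≡ skip (toℕ j) (toℕ b)
toℕ-punchIn Fin.zero b = refl
toℕ-punchIn (Fin.suc j) Fin.zero = refl
toℕ-punchIn (Fin.suc j) (Fin.suc b) = cong suc (toℕ-punchIn j b)

summand : (n : ℕ) → (Fin (suc n) → Fin (suc n) → ℤ) → Fin (suc n) → ℤ
summand n M j = (if letter (true ∷ false ∷ []) (toℕ j % 2) then ℤ.+ 1 else - (ℤ.+ 1))
  *ℤ (M Fin.zero j *ℤ det n (λ a b → M (Fin.suc a) (punchIn j b)))

-- The partial expansion is local to the definition of det.  Its name is recovered by leaving it to unification: in
-- det (suc (suc n)) two steps of the expansion separate the number n of remaining terms from the size suc n, which
-- can therefore be generalised independently.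
mutual
  partialDet : (n : ℕ) → (Fin (suc n) → Fin (suc n) → ℤ) → (k : ℕ) → (Fin k → Fin (suc n)) → ℤ
  partialDet n M k idx = _

  partialDet-is-go : (n : ℕ) (M : Fin (suc (suc n)) → Fin (suc (suc n)) → ℤ) →
    det (suc (suc n)) M ≡ summand (suc n) M Fin.zero +ℤ
      (summand (suc n) M (Fin.suc Fin.zero) +ℤ partialDet (suc n) M n (λ i → Fin.suc (Fin.suc i)))
  partialDet-is-go n M with summand (suc n) M Fin.zero | summand (suc n) M (Fin.suc Fin.zero)
  ... | x | y with suc n | M | (λ (i : Fin n) → Fin.suc (Fin.suc i))
  ... | N | M′ | idx = refl

partialDet-∑ : ∀ n M (T : ℕ → ℤ) → (∀ j → summand n M j ≡ T (toℕ j)) →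
  ∀ k idx (h : ℕ → ℕ) → (∀ i → toℕ (idx i) ≡ h (toℕ i)) → partialDet n M k idx ≡ ∑ k (T ∘ h)
partialDet-∑ n M T e zero idx h eh = refl
partialDet-∑ n M T e (suc k) idx h eh = cong₂ _+ℤ_
  (trans (e (idx Fin.zero)) (cong T (eh Fin.zero)))
  (partialDet-∑ n M T e k (idx ∘ Fin.suc) (h ∘ suc) (eh ∘ Fin.suc))

det≡D : ∀ n (A : Fin n → Fin n → ℤ) (M : Mat) → (∀ i j → A i j ≡ M (toℕ i) (toℕ j)) → det n A ≡ D n M
det≡D zero A M e = refl
det≡D (suc n) A M e = partialDet-∑ n A T eq (suc n) (λ j → j) (λ j → j) (λ _ → refl)
  where
  T : ℕ → ℤ
  T j = sgn j *ℤ (M 0 j *ℤ D n (minor j M))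
  eq : ∀ j → summand n A j ≡ T (toℕ j)
  eq j = cong₂ _*ℤ_ (sign-of-% (toℕ j)) (cong₂ _*ℤ_ (e Fin.zero j)
    (det≡D n _ (minor (toℕ j) M) (λ a b → trans (e _ _) (cong (M (suc (toℕ a))) (toℕ-punchIn j b)))))

m<n⇒n≡m+1+o : ∀ {m n} → m < n → ∃ λ o → n ≡ m + suc o
m<n⇒n≡m+1+o {m} m<n with o , refl ← m≤n⇒∃[o]m+o≡n m<n = o , sym (+-suc m o)

∑-cong : ∀ n {g h} → (∀ i → i < n → g i ≡ h i) → ∑ n g ≡ ∑ n h
∑-cong zero e = refl
∑-cong (suc n) e = cong₂ _+ℤ_ (e 0 z<s) (∑-cong n (λ i i<n → e (suc i) (s<s i<n)))

∑-0 : ∀ n {g} → (∀ i → i < n → g i ≡ 0ℤ) → ∑ n g ≡ 0ℤ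
∑-0 zero e = refl
∑-0 (suc n) e = cong₂ _+ℤ_ (e 0 z<s) (∑-0 n (λ i i<n → e (suc i) (s<s i<n)))

∑-linear : ∀ n x y {f g h} → (∀ i → i < n → h i ≡ x *ℤ f i +ℤ y *ℤ g i) → ∑ n h ≡ x *ℤ ∑ n f +ℤ y *ℤ ∑ n g
∑-linear zero x y e = sym (cong₂ _+ℤ_ (ℤP.*-zeroʳ x) (ℤP.*-zeroʳ y))
∑-linear (suc n) x y {f} {g} {h} e = trans (cong₂ _+ℤ_ (e 0 z<s) (∑-linear n x y (λ i i<n → e (suc i) (s<s i<n))))
  (lem x y (f 0) (g 0) _ _)
  where
  lem : ∀ x y a b s t → (x *ℤ a +ℤ y *ℤ b) +ℤ (x *ℤ s +ℤ y *ℤ t) ≡ x *ℤ (a +ℤ s) +ℤ y *ℤ (b +ℤ t)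
  lem = solve-∀

∑-single : ∀ n {g} c → c < n → (∀ i → i < n → i ≢ c → g i ≡ 0ℤ) → ∑ n g ≡ g c
∑-single (suc n) {g} zero c<n e = trans (cong (g 0 +ℤ_) (∑-0 n (λ i i<n → e (suc i) (s<s i<n) λ ()))) (ℤP.+-identityʳ _)
∑-single (suc n) {g} (suc c) c<n e = trans (cong₂ _+ℤ_ (e 0 z<s λ ())
  (∑-single n c (s≤s⁻¹ c<n) (λ i i<n i≢c → e (suc i) (s<s i<n) (i≢c ∘ suc-injective)))) (ℤP.+-identityˡ _)

∑-adjacent : ∀ n {g} c → suc c < n → (∀ i → i < n → i ≢ c → i ≢ suc c → g i ≡ 0ℤ) → g c +ℤ g (suc c) ≡ 0ℤ → ∑ n g ≡ 0ℤ
∑-adjacent (suc zero) zero (s≤s ())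
∑-adjacent (suc (suc n)) {g} zero c<n e p = begin
  g 0 +ℤ (g 1 +ℤ ∑ n (g ∘ suc ∘ suc)) ≡⟨ cong (λ z → g 0 +ℤ (g 1 +ℤ z)) (∑-0 n (λ i i<n → e (suc (suc i)) (s<s (s<s i<n)) (λ ()) (λ ()))) ⟩
  g 0 +ℤ (g 1 +ℤ 0ℤ)                  ≡⟨ cong (g 0 +ℤ_) (ℤP.+-identityʳ (g 1)) ⟩
  g 0 +ℤ g 1                          ≡⟨ p ⟩
  0ℤ ∎
  where open ≡-Reasoning
∑-adjacent (suc n) (suc c) c<n e p = cong₂ _+ℤ_ (e 0 z<s (λ ()) (λ ()))
  (∑-adjacent n c (s≤s⁻¹ c<n) (λ i i<n i≢c i≢sc → e (suc i) (s<s i<n) (i≢c ∘ suc-injective) (i≢sc ∘ suc-injective)) p)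

skip-< : ∀ {j c} → c < j → skip j c ≡ c
skip-< {suc j} {zero} c<j = refl
skip-< {suc j} {suc c} c<j = cong suc (skip-< (s≤s⁻¹ c<j))

skip-≥ : ∀ {j c} → j ≤ c → skip j c ≡ suc c
skip-≥ {zero} j≤c = refl
skip-≥ {suc j} {suc c} j≤c = cong suc (skip-≥ (s≤s⁻¹ j≤c))

skip-bound : ∀ j c → skip j c ≤ suc c
skip-bound zero c = ≤-refl
skip-bound (suc j) zero = z≤n
skip-bound (suc j) (suc c) = s≤s (skip-bound j c)

skip-≢ : ∀ j c → skip j c ≢ j
skip-≢ (suc j) (suc c) e = skip-≢ j c (suc-injective e)

skip-injective : ∀ j {c d} → skip j c ≡ skip j d → c ≡ d
skip-injective zero e = suc-injective e
skip-injective (suc j) {zero} {zero} e = refl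
skip-injective (suc j) {suc c} {suc d} e = cong suc (skip-injective j (suc-injective e))

unskip : ∀ {n} j a → j ≤ n → a ≤ n → a ≢ j → ∃ λ b → b < n × skip j b ≡ a
unskip zero zero _ _ a≢j = contradiction refl a≢j
unskip zero (suc a) _ a≤n _ = a , a≤n , refl
unskip {suc n} (suc j) zero _ _ _ = zero , z<s , refl
unskip {suc n} (suc j) (suc a) (s≤s j≤n) (s≤s a≤n) a≢j with unskip j a j≤n a≤n (a≢j ∘ cong suc)
... | b , b<n , e = suc b , s<s b<n , cong suc e

skip<suc : ∀ {n} j c → c < n → skip j c < suc n
skip<suc j c c<n = s≤s (≤-trans (skip-bound j c) c<n)

D-cong : ∀ n {M N} → (∀ i j → i < n → j < n → M i j ≡ N i j) → D n M ≡ D n N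
D-cong zero e = refl
D-cong (suc n) e = ∑-cong (suc n) (λ j j<n → cong (sgn j *ℤ_) (cong₂ _*ℤ_ (e 0 j z<s j<n)
  (D-cong n (λ i c i<n c<n → e _ _ (s<s i<n) (skip<suc j c c<n)))))

Off : ℕ → ℕ → Mat → Mat → Set
Off n a M N = ∀ i c → i < n → c < n → c ≢ a → M i c ≡ N i c

-- In the term that deletes column a the minors coincide and the entry is linear. In every other
-- term column a survives in the minor, at the place b with `skip j b ≡ a`, and induction applies.
D-linear : ∀ n a x y {L M N} → a < n → Off n a N L → Off n a N M →
  (∀ i → i < n → N i a ≡ x *ℤ L i a +ℤ y *ℤ M i a) → D n N ≡ x *ℤ D n L +ℤ y *ℤ D n M
D-linear (suc n) a x y {L} {M} {N} a<n oL oM e = ∑-linear (suc n) x y term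
  where
  lem₁ : ∀ s x y p q d → s *ℤ ((x *ℤ p +ℤ y *ℤ q) *ℤ d) ≡ x *ℤ (s *ℤ (p *ℤ d)) +ℤ y *ℤ (s *ℤ (q *ℤ d))
  lem₁ = solve-∀
  lem₂ : ∀ s x y p d e → s *ℤ (p *ℤ (x *ℤ d +ℤ y *ℤ e)) ≡ x *ℤ (s *ℤ (p *ℤ d)) +ℤ y *ℤ (s *ℤ (p *ℤ e))
  lem₂ = solve-∀
  term : ∀ j → j < suc n → sgn j *ℤ (N 0 j *ℤ D n (minor j N)) ≡
    x *ℤ (sgn j *ℤ (L 0 j *ℤ D n (minor j L))) +ℤ y *ℤ (sgn j *ℤ (M 0 j *ℤ D n (minor j M)))
  term j j<n with a ≟ j
  ... | yes refl rewrite e 0 z<s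
    | sym (D-cong n {minor a N} {minor a L} (λ i c i<n c<n → oL _ _ (s<s i<n) (skip<suc a c c<n) (skip-≢ a c)))
    | sym (D-cong n {minor a N} {minor a M} (λ i c i<n c<n → oM _ _ (s<s i<n) (skip<suc a c c<n) (skip-≢ a c)))
    = lem₁ (sgn a) x y (L 0 a) (M 0 a) _
  ... | no a≢j with unskip j a (s≤s⁻¹ j<n) (s≤s⁻¹ a<n) a≢j
  ... | b , b<n , refl rewrite sym (oL 0 j z<s j<n (a≢j ∘ sym)) | sym (oM 0 j z<s j<n (a≢j ∘ sym))
    | D-linear n b x y {minor j L} {minor j M} {minor j N} b<n
       (λ i c i<n c<n c≢b → oL _ _ (s<s i<n) (skip<suc j c c<n) (c≢b ∘ skip-injective j))
       (λ i c i<n c<n c≢b → oM _ _ (s<s i<n) (skip<suc j c c<n) (c≢b ∘ skip-injective j))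
       (λ i i<n → e (suc i) (s<s i<n))
    = lem₂ (sgn j) x y (N 0 j) _ _

D-zero-column : ∀ n a {M} → a < n → (∀ i → i < n → M i a ≡ 0ℤ) → D n M ≡ 0ℤ
D-zero-column n a {M} a<n e = trans (D-linear n a 0ℤ 0ℤ {M} {M} a<n (λ _ _ _ _ _ → refl) (λ _ _ _ _ _ → refl) e) refl

-- Deleting any other column leaves the equal columns adjacent in the minor. Deleting either of the
-- two gives the same minor, with opposite signs.
D-adjacent-equal : ∀ n a {M} → suc a < n → (∀ i → i < n → M i a ≡ M i (suc a)) → D n M ≡ 0ℤ
D-adjacent-equal (suc n) a {M} a<n e = ∑-adjacent (suc n) a a<n other cancel
  where
  term-0 : ∀ j {d} → d ≡ 0ℤ → sgn j *ℤ (M 0 j *ℤ d) ≡ 0ℤ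
  term-0 j refl = trans (cong (sgn j *ℤ_) (ℤP.*-zeroʳ (M 0 j))) (ℤP.*-zeroʳ (sgn j))
  other : ∀ j → j < suc n → j ≢ a → j ≢ suc a → sgn j *ℤ (M 0 j *ℤ D n (minor j M)) ≡ 0ℤ
  other j j<n j≢a j≢sa with <-cmp j a
  ... | tri≈ _ j≡a _ = contradiction j≡a j≢a
  ... | tri< j<a _ _ = case m<n⇒n≡m+1+o (≤-<-trans z≤n j<a) of λ { (b , refl) → term-0 j (D-adjacent-equal n b (s≤s⁻¹ a<n) (λ i i<n →
      trans (cong (M (suc i)) (skip-≥ (s≤s⁻¹ j<a))) (trans (e (suc i) (s<s i<n)) (cong (M (suc i)) (sym (skip-≥ (<⇒≤ j<a))))))) }
  ... | tri> _ _ a<j = term-0 j (D-adjacent-equal n a (<-≤-trans sa<j (s≤s⁻¹ j<n)) (λ i i<n →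
      trans (cong (M (suc i)) (skip-< a<j)) (trans (e (suc i) (s<s i<n)) (cong (M (suc i)) (sym (skip-< sa<j))))))
    where
    sa<j : suc a < j
    sa<j = ≤∧≢⇒< a<j (j≢sa ∘ sym)
  lem : ∀ s p d → s *ℤ (p *ℤ d) +ℤ - s *ℤ (p *ℤ d) ≡ 0ℤ
  lem = solve-∀
  same : ∀ i c → i < n → c < n → minor a M i c ≡ minor (suc a) M i c
  same i c i<n c<n with <-cmp c a
  ... | tri< c<a _ _ = cong (M (suc i)) (trans (skip-< c<a) (sym (skip-< (m≤n⇒m≤1+n c<a))))
  ... | tri> _ _ a<c = cong (M (suc i)) (trans (skip-≥ (<⇒≤ a<c)) (sym (skip-≥ a<c)))
  ... | tri≈ _ refl _ = trans (cong (M (suc i)) (skip-≥ ≤-refl)) (trans (sym (e (suc i) (s<s i<n))) (cong (M (suc i)) (sym (skip-< ≤-refl))))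
  cancel : sgn a *ℤ (M 0 a *ℤ D n (minor a M)) +ℤ - sgn a *ℤ (M 0 (suc a) *ℤ D n (minor (suc a) M)) ≡ 0ℤ
  cancel rewrite sym (e 0 z<s) | sym (D-cong n same) = lem (sgn a) (M 0 a) (D n (minor a M))

setCol : ℕ → (ℕ → ℤ) → Mat → Mat
setCol a v M i c = if does (c ≟ a) then v i else M i c

setCol-same : ∀ a v M i → setCol a v M i a ≡ v i
setCol-same a v M i rewrite dec-true (a ≟ a) refl = refl

setCol-other : ∀ {a c} v M i → c ≢ a → setCol a v M i c ≡ M i c
setCol-other {a} {c} v M i c≢a rewrite dec-false (c ≟ a) c≢a = refl

-- Polarisation: with the sum of the two columns in both places the determinant vanishes, and its
-- bilinear expansion consists of `D n M`, `D n N` and two terms with equal columns.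
D-swap : ∀ n a {M N} → suc a < n → (∀ i → i < n → N i a ≡ M i (suc a)) → (∀ i → i < n → N i (suc a) ≡ M i a) →
  (∀ i c → i < n → c < n → c ≢ a → c ≢ suc a → N i c ≡ M i c) → D n N ≡ - D n M
D-swap n a {M} {N} a<n e₁ e₂ e = begin
  D n N                            ≡⟨ lem₁ (D n M) (D n N) ⟩
  - D n M +ℤ (D n M +ℤ D n N)       ≡⟨ cong (- D n M +ℤ_) (trans (sym expand) P₊₊) ⟩
  - D n M +ℤ 0ℤ                     ≡⟨ ℤP.+-identityʳ _ ⟩
  - D n M ∎
  where
  open ≡-Reasoning
  lem₁ : ∀ x y → y ≡ - x +ℤ (x +ℤ y)
  lem₁ = solve-∀
  Q : (ℕ → ℤ) → Mat
  Q v = setCol (suc a) v M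
  P : (ℕ → ℤ) → (ℕ → ℤ) → Mat
  P u v = setCol a u (Q v)
  a≢sa : a ≢ suc a
  a≢sa ()
  at-a : ∀ u v i → P u v i a ≡ u i
  at-a u v i = setCol-same a u (Q v) i
  at-sa : ∀ u v i → P u v i (suc a) ≡ v i
  at-sa u v i = trans (setCol-other u (Q v) i (a≢sa ∘ sym)) (setCol-same (suc a) v M i)
  at-c : ∀ u v i {c} → c ≢ a → c ≢ suc a → P u v i c ≡ M i c
  at-c u v i c≢a c≢sa = trans (setCol-other u (Q v) i c≢a) (setCol-other v M i c≢sa)
  off-a : ∀ u u′ v → Off n a (P u v) (P u′ v)
  off-a u u′ v i c _ _ c≢a = trans (setCol-other u (Q v) i c≢a) (sym (setCol-other u′ (Q v) i c≢a))
  off-sa : ∀ u v v′ → Off n (suc a) (P u v) (P u v′)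
  off-sa u v v′ i c _ _ c≢sa with c ≟ a
  ... | yes refl = trans (at-a u v i) (sym (at-a u v′ i))
  ... | no c≢a = trans (at-c u v i c≢a c≢sa) (sym (at-c u v′ i c≢a c≢sa))
  ca cb : ℕ → ℤ
  ca i = M i a
  cb i = M i (suc a)
  cs : ℕ → ℤ
  cs i = 1ℤ *ℤ ca i +ℤ 1ℤ *ℤ cb i
  equal : ∀ u → D n (P u u) ≡ 0ℤ
  equal u = D-adjacent-equal n a a<n (λ i _ → trans (at-a u u i) (sym (at-sa u u i)))
  lin-a : ∀ v → D n (P cs v) ≡ 1ℤ *ℤ D n (P ca v) +ℤ 1ℤ *ℤ D n (P cb v)
  lin-a v = D-linear n a 1ℤ 1ℤ (<⇒≤ a<n) (off-a cs ca v) (off-a cs cb v)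
    (λ i _ → trans (at-a cs v i) (sym (cong₂ _+ℤ_ (cong (1ℤ *ℤ_) (at-a ca v i)) (cong (1ℤ *ℤ_) (at-a cb v i)))))
  lin-sa : ∀ u → D n (P u cs) ≡ 1ℤ *ℤ D n (P u ca) +ℤ 1ℤ *ℤ D n (P u cb)
  lin-sa u = D-linear n (suc a) 1ℤ 1ℤ a<n (off-sa u cs ca) (off-sa u cs cb)
    (λ i _ → trans (at-sa u cs i) (sym (cong₂ _+ℤ_ (cong (1ℤ *ℤ_) (at-sa u ca i)) (cong (1ℤ *ℤ_) (at-sa u cb i)))))
  P₊₊ : D n (P cs cs) ≡ 0ℤ
  P₊₊ = equal cs
  M≡ : D n (P ca cb) ≡ D n M
  M≡ = D-cong n go
    where
    go : ∀ i c → i < n → c < n → P ca cb i c ≡ M i c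
    go i c _ _ with c ≟ a | c ≟ suc a
    ... | yes refl | _ = at-a ca cb i
    ... | no _ | yes refl = at-sa ca cb i
    ... | no c≢a | no c≢sa = at-c ca cb i c≢a c≢sa
  N≡ : D n (P cb ca) ≡ D n N
  N≡ = D-cong n go
    where
    go : ∀ i c → i < n → c < n → P cb ca i c ≡ N i c
    go i c i<n c<n with c ≟ a | c ≟ suc a
    ... | yes refl | _ = trans (at-a cb ca i) (sym (e₁ i i<n))
    ... | no _ | yes refl = trans (at-sa cb ca i) (sym (e₂ i i<n))
    ... | no c≢a | no c≢sa = trans (at-c cb ca i c≢a c≢sa) (sym (e i c i<n c<n c≢a c≢sa))
  lem₂ : ∀ x y → 1ℤ *ℤ (1ℤ *ℤ 0ℤ +ℤ 1ℤ *ℤ x) +ℤ 1ℤ *ℤ (1ℤ *ℤ y +ℤ 1ℤ *ℤ 0ℤ) ≡ x +ℤ y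
  lem₂ = solve-∀
  expand : D n (P cs cs) ≡ D n M +ℤ D n N
  expand rewrite lin-a cs | lin-sa ca | lin-sa cb | equal ca | equal cb | M≡ | N≡ = lem₂ (D n M) (D n N)

transposition : ℕ → ℕ → ℕ
transposition e c = if does (c ≟ e) then suc e else if does (c ≟ suc e) then e else c

transposition-fst : ∀ e → transposition e e ≡ suc e
transposition-fst e rewrite dec-true (e ≟ e) refl = refl

transposition-snd : ∀ e → transposition e (suc e) ≡ e
transposition-snd e rewrite dec-false (suc e ≟ e) (λ ()) | dec-true (suc e ≟ suc e) refl = refl

transposition-other : ∀ {e c} → c ≢ e → c ≢ suc e → transposition e c ≡ c
transposition-other {e} {c} p q rewrite dec-false (c ≟ e) p | dec-false (c ≟ suc e) q = refl

D-swap-columns : ∀ n a M → suc a < n → D n (λ i c → M i (transposition a c)) ≡ - D n M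
D-swap-columns n a M a<n = D-swap n a a<n (λ i _ → cong (M i) (transposition-fst a)) (λ i _ → cong (M i) (transposition-snd a))
  (λ i c _ _ p q → cong (M i) (transposition-other p q))

-- Induction on the distance: a transposition of neighbours brings the right copy one place closer
-- and only changes the sign.
D-equal : ∀ n a d {M} → a + suc d < n → (∀ i → i < n → M i a ≡ M i (a + suc d)) → D n M ≡ 0ℤ
D-equal n a zero {M} lt e rewrite +-comm a 1 = D-adjacent-equal n a lt e
D-equal n a (suc d) {M} lt e rewrite +-suc a (suc d) = begin
  D n M        ≡⟨ sym (ℤP.neg-involutive _) ⟩
  - (- D n M)  ≡⟨ cong -_ (sym (D-swap-columns n b M lt)) ⟩
  - D n N      ≡⟨ cong -_ (D-equal n a d {N} (<-trans (n<1+n _) lt)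
                   (λ i i<n → trans (cong (M i) (transposition-other a≢b a≢sb)) (trans (e i i<n) (cong (M i) (sym (transposition-fst b)))))) ⟩
  - 0ℤ         ≡⟨⟩
  0ℤ ∎
  where
  open ≡-Reasoning
  b = a + suc d
  N : Mat
  N i c = M i (transposition b c)
  a≢b : a ≢ b
  a≢b = <⇒≢ (m<m+n a z<s)
  a≢sb : a ≢ suc b
  a≢sb = <⇒≢ (<-trans (m<m+n a z<s) (n<1+n b))

D-equal-columns : ∀ n a b {M} → a < n → b < n → a ≢ b → (∀ i → i < n → M i a ≡ M i b) → D n M ≡ 0ℤ
D-equal-columns n a b {M} a<n b<n a≢b e with <-cmp a b
... | tri≈ _ a≡b _ = contradiction a≡b a≢b
... | tri< a<b _ _ = case m<n⇒n≡m+1+o a<b of λ { (d , refl) → D-equal n a d b<n e }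
... | tri> _ _ b<a = case m<n⇒n≡m+1+o b<a of λ { (d , refl) → D-equal n b d a<n (λ i i<n → sym (e i i<n)) }

D-column-op : ∀ n a b x {M N} → a < n → b < n → a ≢ b → Off n a N M →
  (∀ i → i < n → N i a ≡ M i a +ℤ x *ℤ M i b) → D n N ≡ D n M
D-column-op n a b x {M} {N} a<n b<n a≢b off e = begin
  D n N                             ≡⟨ D-linear n a 1ℤ x a<n off offL lin ⟩
  1ℤ *ℤ D n M +ℤ x *ℤ D n L         ≡⟨ cong (λ z → 1ℤ *ℤ D n M +ℤ x *ℤ z) (D-equal-columns n a b a<n b<n a≢b
                                        (λ i _ → trans (setCol-same a colb M i) (sym (setCol-other colb M i (a≢b ∘ sym))))) ⟩
  1ℤ *ℤ D n M +ℤ x *ℤ 0ℤ            ≡⟨ lem (D n M) x ⟩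
  D n M ∎
  where
  open ≡-Reasoning
  colb : ℕ → ℤ
  colb i = M i b
  L : Mat
  L = setCol a colb M
  lem : ∀ d x → 1ℤ *ℤ d +ℤ x *ℤ 0ℤ ≡ d
  lem = solve-∀
  offL : Off n a N L
  offL i c i<n c<n c≢a = trans (off i c i<n c<n c≢a) (sym (setCol-other colb M i c≢a))
  lin : ∀ i → i < n → N i a ≡ 1ℤ *ℤ M i a +ℤ x *ℤ L i a
  lin i i<n = trans (e i i<n) (cong₂ (λ p q → p +ℤ x *ℤ q) (sym (ℤP.*-identityˡ (M i a))) (sym (setCol-same a colb M i)))

D-unit-row : ∀ n c {M} → c ≤ n → (∀ j → j ≤ n → j ≢ c → M 0 j ≡ 0ℤ) →
  D (suc n) M ≡ sgn c *ℤ (M 0 c *ℤ D n (minor c M))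
D-unit-row n c {M} c≤n e = ∑-single (suc n) c (s≤s c≤n) λ j j<n j≢c →
  trans (cong (λ z → sgn j *ℤ (z *ℤ D n (minor j M))) (e j (s≤s⁻¹ j<n) j≢c)) (ℤP.*-zeroʳ (sgn j))

-- The expansion along row 0 suffices: a term that deletes another column contains a minor in which
-- column c has become zero.
D-unit-column : ∀ n c {M} → c ≤ n → (∀ i → i < n → M (suc i) c ≡ 0ℤ) →
  D (suc n) M ≡ sgn c *ℤ (M 0 c *ℤ D n (minor c M))
D-unit-column n c {M} c≤n e = ∑-single (suc n) c (s≤s c≤n) term
  where
  term : ∀ j → j < suc n → j ≢ c → sgn j *ℤ (M 0 j *ℤ D n (minor j M)) ≡ 0ℤ
  term j j<n j≢c with unskip j c (s≤s⁻¹ j<n) c≤n (j≢c ∘ sym)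
  ... | b , b<n , refl = trans (cong (λ z → sgn j *ℤ (M 0 j *ℤ z)) (D-zero-column n b b<n e))
     (trans (cong (sgn j *ℤ_) (ℤP.*-zeroʳ (M 0 j))) (ℤP.*-zeroʳ (sgn j)))

cut : ℕ → Mat → Mat → Mat
cut l A B i j = if does (j <? l) then A i j else B i j

cut-< : ∀ {l j} A B i → j < l → cut l A B i j ≡ A i j
cut-< {l} {j} A B i j<l rewrite dec-true (j <? l) j<l = refl

cut-≥ : ∀ {l j} A B i → l ≤ j → cut l A B i j ≡ B i j
cut-≥ {l} {j} A B i l≤j rewrite dec-false (j <? l) (≤⇒≯ l≤j) = refl

-- Columns are replaced from right to left. The source `b l` lies left of l and is therefore still a
-- column of `A` when column l is treated.
D-sweep : ∀ x q r {A B} (b : ℕ → ℕ) → (∀ l → q ≤ l → l < q + r → b l < l × (∀ i → i < q + r → B i l ≡ A i l +ℤ x *ℤ A i (b l))) →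
  D (q + r) A ≡ D (q + r) (cut q A B)
D-sweep x q r {A} {B} b e = subst (λ l → D n A ≡ D n (cut l A B)) (+-identityʳ q) (go r 0 refl)
  where
  n = q + r
  go : ∀ d o → o + d ≡ r → D n A ≡ D n (cut (q + o) A B)
  go zero o eq = D-cong n (λ i j i<n j<n → sym (cut-< A B i (subst (λ z → j < q + z) (trans (sym eq) (+-identityʳ o)) j<n)))
  go (suc d) o eq with e (q + o) (m≤m+n q o) lt
    where
    lt : q + o < q + r
    lt = +-monoʳ-< q (subst (o <_) eq (m<m+n o z<s))
  ... | b<l , e′ = trans (go d (suc o) (trans (sym (+-suc o d)) eq)) (sym (D-column-op n l (b l) x lt (<-trans b<l lt) (<⇒≢ b<l ∘ sym) off at))
    where
    l = q + o
    lt : q + o < q + r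
    lt = +-monoʳ-< q (subst (o <_) eq (m<m+n o z<s))
    l≤sl : q + suc o ≡ suc l
    l≤sl = +-suc q o
    off : Off n l (cut l A B) (cut (q + suc o) A B)
    off i c i<n c<n c≢l with <-cmp c l
    ... | tri≈ _ c≡l _ = contradiction c≡l c≢l
    ... | tri< c<l _ _ = trans (cut-< A B i c<l) (sym (cut-< A B i (subst (c <_) (sym l≤sl) (m≤n⇒m≤1+n c<l))))
    ... | tri> _ _ l<c = trans (cut-≥ A B i (<⇒≤ l<c)) (sym (cut-≥ A B i (subst (_≤ c) (sym l≤sl) l<c)))
    at : ∀ i → i < n → cut l A B i l ≡ cut (q + suc o) A B i l +ℤ x *ℤ cut (q + suc o) A B i (b l)
    at i i<n = trans (cut-≥ A B i ≤-refl) (trans (e′ i i<n) (sym (cong₂ (λ p s → p +ℤ x *ℤ s)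
      (cut-< A B i (≤-reflexive (sym l≤sl))) (cut-< A B i (<-trans b<l (≤-reflexive (sym l≤sl)))))))

-- Row 0 is deleted with column q+u-1, the next row with column q+u-2, and so on; the pivots lie on
-- an antidiagonal that ends in column q.
strip : ℕ → ℕ → Mat → Mat
strip q zero M = M
strip q (suc u) M = strip q u (minor (q + u) M)

strip-left : ∀ q u M i {j} → j < q → strip q u M i j ≡ M (u + i) j
strip-left q zero M i j<q = refl
strip-left q (suc u) M i j<q = trans (strip-left q u _ i j<q) (cong (M (suc (u + i))) (skip-< (<-≤-trans j<q (m≤m+n q u))))

strip-right : ∀ q u M i j → strip q u M i (q + j) ≡ M (u + i) (q + (u + j))
strip-right q zero M i j = refl
strip-right q (suc u) M i j = trans (strip-right q u _ i j) (cong (M (suc (u + i)))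
  (trans (skip-≥ (+-monoʳ-≤ q (m≤m+n u j))) (sym (+-suc q (u + j)))))

stripSign : ℕ → ℕ → ℤ
stripSign q zero = 1ℤ
stripSign q (suc u) = sgn (q + u) *ℤ stripSign q u

D-strip : ∀ q u v e {M} → (∀ i j → i < q + (u + v) → j < u → suc (i + j) ≡ u → M i (q + j) ≡ e) →
  (∀ i j → i < q + (u + v) → j < u → u ≤ i + j → M i (q + j) ≡ 0ℤ) →
  D (q + (u + v)) M ≡ stripSign q u *ℤ (e ^ℤ u *ℤ D (q + v) (strip q u M))
D-strip q zero v e h₁ h₀ = lem _
  where
  lem : ∀ x → x ≡ 1ℤ *ℤ (1ℤ *ℤ x)
  lem = solve-∀
D-strip q (suc u) v e {M} h₁ h₀ rewrite +-suc q (u + v) = begin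
  D (suc (q + (u + v))) M
    ≡⟨ D-unit-column (q + (u + v)) (q + u) {M} (+-monoʳ-≤ q (m≤m+n u v)) (λ i i<n → h₀ (suc i) u (s<s i<n) ≤-refl (s≤s (m≤n+m u i))) ⟩
  sgn (q + u) *ℤ (M 0 (q + u) *ℤ D (q + (u + v)) (minor (q + u) M))
    ≡⟨ cong₂ (λ x y → sgn (q + u) *ℤ (x *ℤ y)) (h₁ 0 u z<s ≤-refl refl)
         (D-strip q u v e
           (λ i j i<n j<u eq → trans (cong (M (suc i)) (skip-< (+-monoʳ-< q j<u))) (h₁ (suc i) j (s<s i<n) (m≤n⇒m≤1+n j<u) (cong suc eq)))
           (λ i j i<n j<u le → trans (cong (M (suc i)) (skip-< (+-monoʳ-< q j<u))) (h₀ (suc i) j (s<s i<n) (m≤n⇒m≤1+n j<u) (s≤s le)))) ⟩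
  sgn (q + u) *ℤ (e *ℤ (stripSign q u *ℤ (e ^ℤ u *ℤ _)))
    ≡⟨ lem (sgn (q + u)) e (stripSign q u) (e ^ℤ u) _ ⟩
  sgn (q + u) *ℤ stripSign q u *ℤ (e *ℤ e ^ℤ u *ℤ _) ∎
  where
  open ≡-Reasoning
  lem : ∀ a e b f d → a *ℤ (e *ℤ (b *ℤ (f *ℤ d))) ≡ a *ℤ b *ℤ (e *ℤ f *ℤ d)
  lem = solve-∀

-- In row 0 the columns from q on contribute nothing. Deleting a column before q leaves the lower
-- right block intact, so its determinant factors out of the expansion.
D-block : ∀ q r {M} → (∀ i j → i < q → j < r → M i (q + j) ≡ 0ℤ) →
  D (q + r) M ≡ D q M *ℤ D r (λ i j → M (q + i) (q + j))
D-block zero r e = sym (ℤP.*-identityˡ _)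
D-block (suc q) r {M} e = trans (∑-+ (suc q) r T tail) (trans (∑-cong (suc q) head) (trans (∑-linear (suc q) x 0ℤ
   {g = λ _ → 0ℤ} (λ i _ → trans (ℤP.*-comm (U i) x) (sym (ℤP.+-identityʳ (x *ℤ U i))))) (lem x (∑ (suc q) U) (∑ (suc q) (λ _ → 0ℤ)))))
  where
  x = D r (λ i j → M (suc q + i) (suc q + j))
  T U : ℕ → ℤ
  T j = sgn j *ℤ (M 0 j *ℤ D (q + r) (minor j M))
  U j = sgn j *ℤ (M 0 j *ℤ D q (minor j M))
  lem : ∀ x s z → x *ℤ s +ℤ 0ℤ *ℤ z ≡ s *ℤ x
  lem = solve-∀
  ∑-+ : ∀ a b (g : ℕ → ℤ) → (∀ j → j < b → g (a + j) ≡ 0ℤ) → ∑ (a + b) g ≡ ∑ a g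
  ∑-+ zero b g z = ∑-0 b z
  ∑-+ (suc a) b g z = cong (g 0 +ℤ_) (∑-+ a b (g ∘ suc) z)
  tail : ∀ j → j < r → T (suc q + j) ≡ 0ℤ
  tail j j<r = trans (cong (λ z → sgn (suc q + j) *ℤ (z *ℤ D (q + r) (minor (suc q + j) M))) (e 0 j z<s j<r)) (ℤP.*-zeroʳ (sgn (suc q + j)))
  head : ∀ j → j < suc q → T j ≡ U j *ℤ x
  head j (s≤s j≤q) = trans (cong (λ z → sgn j *ℤ (M 0 j *ℤ z)) (trans
      (D-block q r {minor j M} (λ i c i<q c<r → trans (cong (M (suc i)) (jump c)) (e (suc i) c (s<s i<q) c<r)))
      (cong (D q (minor j M) *ℤ_) (D-cong r (λ i c _ _ → cong (M (suc (q + i))) (jump c))))))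
    (assoc (sgn j) (M 0 j) (D q (minor j M)) x)
    where
    jump : ∀ c → skip j (q + c) ≡ suc q + c
    jump c = skip-≥ (≤-trans j≤q (m≤m+n q c))
    assoc : ∀ a b c d → a *ℤ (b *ℤ (c *ℤ d)) ≡ a *ℤ (b *ℤ c) *ℤ d
    assoc = solve-∀

-- The sign of the reversal of n places, (-1)^(n(n-1)/2).
triSign : ℕ → ℤ
triSign zero = 1ℤ
triSign (suc n) = sgn n *ℤ triSign n

D-antitriangular : ∀ r e {M} → (∀ i j → i < r → j < r → suc (i + j) ≡ r → M i j ≡ e) →
  (∀ i j → i < r → j < r → suc (i + j) < r → M i j ≡ 0ℤ) → D r M ≡ triSign r *ℤ e ^ℤ r
D-antitriangular zero e h₁ h₀ = refl
D-antitriangular (suc r) e {M} h₁ h₀ = begin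
  D (suc r) M                                ≡⟨ D-unit-row r r {M} ≤-refl (λ j j≤r j≢r → h₀ 0 j z<s (s≤s j≤r) (s≤s (≤∧≢⇒< j≤r j≢r))) ⟩
  sgn r *ℤ (M 0 r *ℤ D r (minor r M))        ≡⟨ cong₂ (λ x y → sgn r *ℤ (x *ℤ y)) (h₁ 0 r z<s ≤-refl refl)
       (D-antitriangular r e
         (λ i j i<r j<r eq → trans (cong (M (suc i)) (skip-< j<r)) (h₁ (suc i) j (s<s i<r) (m≤n⇒m≤1+n j<r) (cong suc eq)))
         (λ i j i<r j<r lt → trans (cong (M (suc i)) (skip-< j<r)) (h₀ (suc i) j (s<s i<r) (m≤n⇒m≤1+n j<r) (s<s lt)))) ⟩
  sgn r *ℤ (e *ℤ (triSign r *ℤ e ^ℤ r))      ≡⟨ lem (sgn r) e (triSign r) (e ^ℤ r) ⟩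
  sgn r *ℤ triSign r *ℤ (e *ℤ e ^ℤ r) ∎
  where
  open ≡-Reasoning
  lem : ∀ a e b f → a *ℤ (e *ℤ (b *ℤ f)) ≡ a *ℤ b *ℤ (e *ℤ f)
  lem = solve-∀

-- Hankel matrices

hankel : (ℕ → ℤ) → ℕ → Mat
hankel S m i j = S (m + i + j)

δ : ℕ → (ℕ → ℤ) → ℕ → ℤ
δ q S j = S (j + q) -ℤ S j

differences : ℕ → (ℕ → ℤ) → ℕ → Mat
differences q S m i j = δ q S (m + i + (j ∸ q))

differenced : ℕ → (ℕ → ℤ) → ℕ → Mat
differenced q S m = cut q (hankel S m) (differences q S m)

D-differenced : ∀ q r S m → 1 ≤ q → D (q + r) (hankel S m) ≡ D (q + r) (differenced q S m)
D-differenced q r S m 1≤q = D-sweep -1ℤ q r (_∸ q) step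
  where
  lem : ∀ x y → x -ℤ y ≡ x +ℤ -1ℤ *ℤ y
  lem = solve-∀
  step : ∀ l → q ≤ l → l < q + r → l ∸ q < l × (∀ i → i < q + r → δ q S (m + i + (l ∸ q)) ≡ hankel S m i l +ℤ -1ℤ *ℤ hankel S m i (l ∸ q))
  step l q≤l _ = ∸-monoʳ-< 1≤q q≤l , λ i _ → trans
    (cong (λ z → S z -ℤ S (m + i + (l ∸ q))) (trans (+-assoc (m + i) (l ∸ q) q) (cong (_+_ (m + i)) (m∸n+n≡m q≤l))))
    (lem (S (m + i + l)) (S (m + i + (l ∸ q))))

differenced-right : ∀ q S m i j → differenced q S m i (q + j) ≡ δ q S (m + (i + j))
differenced-right q S m i j = trans (cut-≥ (hankel S m) (differences q S m) i (m≤m+n q j))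
  (cong (δ q S) (trans (cong (_+_ (m + i)) (m+n∸m≡n q j)) (+-assoc m i j)))

-- After the differencing, column q+j lists the differences from index m+j on.
hankel-vanishes : ∀ q r S m j → 1 ≤ q → j < r → (∀ i → i < q + r → δ q S (m + j + i) ≡ 0ℤ) → D (q + r) (hankel S m) ≡ 0ℤ
hankel-vanishes q r S m j 1≤q j<r z = trans (D-differenced q r S m 1≤q)
  (D-zero-column (q + r) (q + j) (+-monoʳ-< q j<r) (λ i i<n → trans (differenced-right q S m i j)
    (trans (cong (δ q S) (trans (cong (_+_ m) (+-comm i j)) (sym (+-assoc m j i)))) (z i i<n))))

-- The first u difference columns are, read from right to left, multiples of unit vectors once the rows above are
-- removed; the last v difference columns form an anti-triangular block below a zero block.
hankel-edge : ∀ q u v S m e′ e → 1 ≤ q →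
  (∀ j → suc j < q + (u + v) → δ q S (m + u + j) ≡ 0ℤ) →
  (∀ u′ → u ≡ suc u′ → δ q S (m + u′) ≡ e′) →
  (∀ v′ → v ≡ suc v′ → δ q S (m + u + (q + (u + v′))) ≡ e) →
  D (q + (u + v)) (hankel S m) ≡
    stripSign q u *ℤ (e′ ^ℤ u *ℤ (D q (hankel S (m + u)) *ℤ (triSign v *ℤ e ^ℤ v)))
hankel-edge q u v S m e′ e 1≤q hz hl hr = begin
  D n (hankel S m) ≡⟨ D-differenced q (u + v) S m 1≤q ⟩
  D n M ≡⟨ D-strip q u v e′ unit zero-below ⟩
  stripSign q u *ℤ (e′ ^ℤ u *ℤ D (q + v) N) ≡⟨ cong (λ z → stripSign q u *ℤ (e′ ^ℤ u *ℤ z)) (D-block q v {N} block) ⟩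
  stripSign q u *ℤ (e′ ^ℤ u *ℤ (D q N *ℤ D v (λ i j → N (q + i) (q + j))))
    ≡⟨ cong₂ (λ x y → stripSign q u *ℤ (e′ ^ℤ u *ℤ (x *ℤ y))) (D-cong q left) (D-antitriangular v e corner upper) ⟩
  _ ∎
  where
  open ≡-Reasoning
  n = q + (u + v)
  M = differenced q S m
  N = strip q u M
  unit : ∀ i j → i < n → j < u → suc (i + j) ≡ u → M i (q + j) ≡ e′
  unit i j _ _ eq = trans (differenced-right q S m i j) (hl (i + j) (sym eq))
  zero-below : ∀ i j → i < n → j < u → u ≤ i + j → M i (q + j) ≡ 0ℤ
  zero-below i j i<n j<u u≤i+j with o , eq ← m≤n⇒∃[o]m+o≡n u≤i+j =
    trans (differenced-right q S m i j) (trans (cong (δ q S) (trans (cong (_+_ m) (sym eq)) (sym (+-assoc m u o)))) (hz o (≤-<-trans so≤i i<n)))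
    where
    so≤i : suc o ≤ i
    so≤i = +-cancelʳ-≤ j (suc o) i (subst₂ _≤_ (lem j o) eq (+-monoˡ-≤ o j<u))
      where
      lem : ∀ j o → suc j + o ≡ suc o + j
      lem = solveℕ-∀
  N-right : ∀ i j → N i (q + j) ≡ δ q S (m + u + (u + i + j))
  N-right i j = trans (strip-right q u M i j) (trans (differenced-right q S m (u + i) (u + j)) (cong (δ q S) (lem m u i j)))
    where
    lem : ∀ m u i j → m + (u + i + (u + j)) ≡ m + u + (u + i + j)
    lem = solveℕ-∀
  block : ∀ i j → i < q → j < v → N i (q + j) ≡ 0ℤ
  block i j i<q j<v = trans (N-right i j) (hz (u + i + j) (subst₂ _≤_ (lem₁ u i j) (lem₂ u q v) (+-monoʳ-≤ u (+-mono-≤ i<q j<v))))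
    where
    lem₁ : ∀ u i j → u + (suc i + suc j) ≡ suc (suc (u + i + j))
    lem₁ = solveℕ-∀
    lem₂ : ∀ u q v → u + (q + v) ≡ q + (u + v)
    lem₂ = solveℕ-∀
  left : ∀ i j → i < q → j < q → N i j ≡ hankel S (m + u) i j
  left i j _ j<q = trans (strip-left q u M i j<q) (trans (cut-< (hankel S m) (differences q S m) (u + i) j<q) (cong (λ z → S (z + j)) (sym (+-assoc m u i))))
  corner : ∀ i j → i < v → j < v → suc (i + j) ≡ v → N (q + i) (q + j) ≡ e
  corner i j _ _ eq = trans (N-right (q + i) j) (trans (cong (λ z → δ q S (m + u + z)) (lem u q i j)) (hr (i + j) (sym eq)))
    where
    lem : ∀ u q i j → u + (q + i) + j ≡ q + (u + (i + j))
    lem = solveℕ-∀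
  upper : ∀ i j → i < v → j < v → suc (i + j) < v → N (q + i) (q + j) ≡ 0ℤ
  upper i j _ _ lt = trans (N-right (q + i) j) (hz _ (subst (_< n) (lem u q i j) (+-monoʳ-< q (+-monoʳ-< u lt))))
    where
    lem : ∀ u q i j → q + (u + suc (i + j)) ≡ suc (u + (q + i) + j)
    lem = solveℕ-∀

-- Hankel matrices of periodic sequences

-- Each of the columns 1 to n contains one η and one -η, so its sum is 0. Clearing the top entry of
-- column 0 with the last column thus preserves the sum of column 0 and leaves η as the only entry
-- of row 0; the minor has the same shape.
D-bidiagonal : ∀ n η {M} → η *ℤ η ≡ 1ℤ →
  (∀ i j → i ≤ n → j < n → i + suc j ≡ n → M i (suc j) ≡ η) →
  (∀ i j → i ≤ n → j < n → i + suc j ≡ suc n → M i (suc j) ≡ - η) →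
  (∀ i j → i ≤ n → j < n → i + suc j ≢ n → i + suc j ≢ suc n → M i (suc j) ≡ 0ℤ) →
  D (suc n) M ≡ η ^ℤ n *ℤ triSign (suc n) *ℤ ∑ (suc n) (λ i → M i 0)
D-bidiagonal zero η {M} ηη h₁ h₂ h₀ = lem (M 0 0)
  where
  lem : ∀ x → 1ℤ *ℤ (x *ℤ 1ℤ) +ℤ 0ℤ ≡ 1ℤ *ℤ (1ℤ *ℤ 1ℤ) *ℤ (x +ℤ 0ℤ)
  lem = solve-∀
D-bidiagonal (suc n) η {M} ηη h₁ h₂ h₀ = begin
  D (suc (suc n)) M   ≡⟨ sym (D-column-op (suc (suc n)) 0 (suc n) (- (η *ℤ M 0 0)) {M} {M′} z<s ≤-refl (λ ()) off (λ i _ → refl)) ⟩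
  D (suc (suc n)) M′  ≡⟨ D-unit-row (suc n) (suc n) {M′} ≤-refl row ⟩
  sgn (suc n) *ℤ (M 0 (suc n) *ℤ D (suc n) (minor (suc n) M′))
    ≡⟨ cong₂ (λ x y → sgn (suc n) *ℤ (x *ℤ y)) (h₁ 0 n z≤n ≤-refl refl)
       (D-bidiagonal n η {minor (suc n) M′} ηη
         (λ i j i≤n j<n eq → trans (M′-skip i j j<n) (h₁ (suc i) j (s≤s i≤n) (m≤n⇒m≤1+n j<n) (cong suc eq)))
         (λ i j i≤n j<n eq → trans (M′-skip i j j<n) (h₂ (suc i) j (s≤s i≤n) (m≤n⇒m≤1+n j<n) (cong suc eq)))
         (λ i j i≤n j<n p q → trans (M′-skip i j j<n) (h₀ (suc i) j (s≤s i≤n) (m≤n⇒m≤1+n j<n) (p ∘ suc-injective) (q ∘ suc-injective)))) ⟩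
  sgn (suc n) *ℤ (η *ℤ (η ^ℤ n *ℤ triSign (suc n) *ℤ ∑ (suc n) (λ i → M′ (suc i) 0)))
    ≡⟨ cong (λ z → sgn (suc n) *ℤ (η *ℤ (η ^ℤ n *ℤ triSign (suc n) *ℤ z))) total ⟩
  sgn (suc n) *ℤ (η *ℤ (η ^ℤ n *ℤ triSign (suc n) *ℤ ∑ (suc (suc n)) (λ i → M i 0)))
    ≡⟨ lem (sgn (suc n)) η (η ^ℤ n) (triSign (suc n)) _ ⟩
  η *ℤ η ^ℤ n *ℤ (sgn (suc n) *ℤ triSign (suc n)) *ℤ ∑ (suc (suc n)) (λ i → M i 0) ∎
  where
  open ≡-Reasoning
  M′ : Mat
  M′ i zero = M i 0 +ℤ - (η *ℤ M 0 0) *ℤ M i (suc n)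
  M′ i (suc c) = M i (suc c)
  off : Off (suc (suc n)) 0 M′ M
  off i zero _ _ c≢0 = contradiction refl c≢0
  off i (suc c) _ _ _ = refl
  lem₁ : ∀ x η → x +ℤ - (η *ℤ x) *ℤ η ≡ x +ℤ - x *ℤ (η *ℤ η)
  lem₁ = solve-∀
  lem₂ : ∀ x → x +ℤ - x *ℤ 1ℤ ≡ 0ℤ
  lem₂ = solve-∀
  lem₃ : ∀ x y η → y +ℤ - (η *ℤ x) *ℤ - η ≡ y +ℤ x *ℤ (η *ℤ η)
  lem₃ = solve-∀
  row : ∀ j → j ≤ suc n → j ≢ suc n → M′ 0 j ≡ 0ℤ
  row zero _ _ = trans (cong (λ z → M 0 0 +ℤ - (η *ℤ M 0 0) *ℤ z) (h₁ 0 n z≤n ≤-refl refl))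
    (trans (lem₁ (M 0 0) η) (trans (cong (λ z → M 0 0 +ℤ - M 0 0 *ℤ z) ηη) (lem₂ (M 0 0))))
  row (suc j) le ne = h₀ 0 j z≤n le ne (<⇒≢ (s≤s le))
  M′-skip : ∀ i j → j < n → minor (suc n) M′ i (suc j) ≡ M (suc i) (suc j)
  M′-skip i j j<n = cong (M′ (suc i)) (skip-< (s<s j<n))
  M′1 : M′ 1 0 ≡ M 1 0 +ℤ M 0 0
  M′1 = trans (cong (λ z → M 1 0 +ℤ - (η *ℤ M 0 0) *ℤ z) (h₂ 1 n (s≤s z≤n) ≤-refl refl))
    (trans (lem₃ (M 0 0) (M 1 0) η) (cong (M 1 0 +ℤ_) (trans (cong (M 0 0 *ℤ_) ηη) (ℤP.*-identityʳ _))))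
  M′> : ∀ i → i < n → M′ (suc (suc i)) 0 ≡ M (suc (suc i)) 0
  M′> i i<n = trans (cong (λ z → M (suc (suc i)) 0 +ℤ - (η *ℤ M 0 0) *ℤ z)
    (h₀ (suc (suc i)) n (s≤s i<n) ≤-refl (λ e → m≢1+n+m (suc n) {suc i} (sym e)) (λ e → m≢1+n+m (suc n) {i} (sym (suc-injective e)))))
    (trans (cong (M (suc (suc i)) 0 +ℤ_) (ℤP.*-zeroʳ (- (η *ℤ M 0 0)))) (ℤP.+-identityʳ _))
  lem₄ : ∀ x y z → y +ℤ x +ℤ z ≡ x +ℤ (y +ℤ z)
  lem₄ = solve-∀
  total : ∑ (suc n) (λ i → M′ (suc i) 0) ≡ ∑ (suc (suc n)) (λ i → M i 0)
  total = trans (cong₂ _+ℤ_ M′1 (∑-cong n M′>)) (lem₄ (M 0 0) (M 1 0) _)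
  lem : ∀ a e f t s → a *ℤ (e *ℤ (f *ℤ t *ℤ s)) ≡ e *ℤ f *ℤ (a *ℤ t) *ℤ s
  lem = solve-∀

cycle : ℕ → ℕ → ℕ
cycle l j = if does (j <? l) then suc j else if does (j ≟ l) then 0 else j

cycle-< : ∀ {l j} → j < l → cycle l j ≡ suc j
cycle-< {l} {j} j<l rewrite dec-true (j <? l) j<l = refl

cycle-≡ : ∀ l → cycle l l ≡ 0
cycle-≡ l rewrite dec-false (l <? l) (<-irrefl refl) | dec-true (l ≟ l) refl = refl

cycle-> : ∀ {l j} → l < j → cycle l j ≡ j
cycle-> {l} {j} l<j rewrite dec-false (j <? l) (<-asym l<j) | dec-false (j ≟ l) (<⇒≢ l<j ∘ sym) = refl

-- Rotating the columns 0 to l takes l transpositions of neighbours.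
D-cycle : ∀ n M l → l < n → D n (λ i j → M i (cycle l j)) ≡ sgn l *ℤ D n M
D-cycle n M zero _ = trans (D-cong n eq) (sym (ℤP.*-identityˡ _))
  where
  eq : ∀ i j → i < n → j < n → M i (cycle 0 j) ≡ M i j
  eq i zero _ _ = refl
  eq i (suc j) _ _ = refl
D-cycle n M (suc l) sl<n = trans (D-swap n l {λ i j → M i (cycle l j)} sl<n
  (λ i _ → cong (M i) (trans (cycle-< {suc l} {l} ≤-refl) (sym (cycle-> {l} {suc l} ≤-refl))))
  (λ i _ → cong (M i) (trans (cycle-≡ (suc l)) (sym (cycle-≡ l))))
  other) (trans (cong -_ (D-cycle n M l (<⇒≤ sl<n))) (ℤP.neg-distribˡ-* (sgn l) _))
  where
  other : ∀ i c → i < n → c < n → c ≢ l → c ≢ suc l → M i (cycle (suc l) c) ≡ M i (cycle l c)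
  other i c _ _ c≢l c≢sl with <-cmp c l
  ... | tri< c<l _ _ = cong (M i) (trans (cycle-< (m≤n⇒m≤1+n c<l)) (sym (cycle-< c<l)))
  ... | tri≈ _ c≡l _ = contradiction c≡l c≢l
  ... | tri> _ _ l<c = cong (M i) (trans (cycle-> (≤∧≢⇒< l<c (c≢sl ∘ sym))) (sym (cycle-> l<c)))

module Circulant (q′ : ℕ) (c : ℕ → ℤ) (periodic : ∀ n → c (n + suc q′) ≡ c n) where

  q : ℕ
  q = suc q′

  periodic-* : ∀ n k → c (n + k * q) ≡ c n
  periodic-* n zero = cong c (+-identityʳ n)
  periodic-* n (suc k) = trans (cong c (lem n q (k * q))) (trans (periodic (n + k * q)) (periodic-* n k))
    where
    lem : ∀ n q x → n + (q + x) ≡ n + x + q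
    lem = solveℕ-∀

  c-% : ∀ n → c (n % q) ≡ c n
  c-% n = sym (trans (cong c (m≡m%n+[m/n]*n n q)) (periodic-* (n % q) (n / q)))

  -- A shift of the sequence by one place rotates the q columns, a permutation of sign `sgn q′`.
  D-rotate : sgn q′ ≡ 1ℤ → ∀ d → D q (hankel c d) ≡ D q (hankel c 0)
  D-rotate even zero = refl
  D-rotate even (suc d) = trans (D-cong q eq) (trans (D-cycle q (hankel c d) q′ ≤-refl)
    (trans (cong (_*ℤ D q (hankel c d)) even) (trans (ℤP.*-identityˡ _) (D-rotate even d))))
    where
    lem : ∀ d i q → suc (d + i + q) ≡ d + i + 0 + suc q
    lem = solveℕ-∀
    eq : ∀ i j → i < q → j < q → hankel c (suc d) i j ≡ hankel c d i (cycle q′ j)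
    eq i j _ j<q with j ≟ q′
    ... | yes refl = trans (cong c (lem d i q′)) (trans (periodic (d + i + 0)) (cong (λ z → c (d + i + z)) (sym (cycle-≡ q′))))
    ... | no j≢q′ = cong c (trans (sym (+-suc (d + i) j)) (cong (_+_ (d + i)) (sym (cycle-< (≤∧≢⇒< (s≤s⁻¹ j<q) j≢q′)))))

  ∑-rotate : ∀ d → ∑ q (λ i → c (i + d)) ≡ ∑ q c
  ∑-rotate zero = ∑-cong q (λ i _ → cong c (+-identityʳ i))
  ∑-rotate (suc d) = trans (trans (∑-last q′ (λ i → c (i + suc d))) (trans (cong₂ _+ℤ_
      (∑-cong q′ (λ i _ → cong c (+-suc i d))) (trans (cong c (lem q′ d)) (periodic d)))
      (ℤP.+-comm (∑ q′ (λ i → c (suc i + d))) (c d)))) (∑-rotate d)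
    where
    lem : ∀ q d → q + suc d ≡ d + suc q
    lem = solveℕ-∀
    ∑-last : ∀ n g → ∑ (suc n) g ≡ ∑ n g +ℤ g n
    ∑-last zero g = ℤP.+-comm (g 0) 0ℤ
    ∑-last (suc n) g = trans (cong (g 0 +ℤ_) (∑-last n (g ∘ suc))) (sym (ℤP.+-assoc (g 0) _ _))

  -- The column operations C_j ↦ C_j − C_{j+t} are performed along the path t, 2t, 3t, … (mod q), which ends in the
  -- untouched column 0; `rank` is the position of a column on this path.
  module Path (t t′ z : ℕ) (inverse : t * t′ ≡ 1 + z * q) where

    rank : ℕ → ℕ
    rank j = (j * t′) % q

    jump : Mat
    jump i j = c (i + j) -ℤ c (i + j + t)

    modified : ℕ → ℕ → Bool
    modified l j = does (1 ≤? rank j) ∧ does (rank j <? l)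

    stage : ℕ → Mat
    stage l i j = if modified l j then jump i j else c (i + j)

    stage-modified : ∀ l i {j} → 1 ≤ rank j → rank j < l → stage l i j ≡ jump i j
    stage-modified l i {j} p r rewrite dec-true (1 ≤? rank j) p | dec-true (rank j <? l) r = refl

    stage-≥ : ∀ l i {j} → l ≤ rank j → stage l i j ≡ c (i + j)
    stage-≥ l i {j} p rewrite dec-false (rank j <? l) (≤⇒≯ p) with does (1 ≤? rank j)
    ... | true = refl
    ... | false = refl

    stage-0 : ∀ l i {j} → rank j ≡ 0 → stage l i j ≡ c (i + j)
    stage-0 l i {j} p rewrite p = refl

    mul-inverse : ∀ x y → (x * t + y * q) * t′ ≡ x + (x * z + y * t′) * q
    mul-inverse x y = trans (lem₁ x t y q t′) (trans (cong (λ w → x * w + y * t′ * q) inverse) (lem₂ x z q (y * t′)))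
      where
      lem₁ : ∀ x t y q t′ → (x * t + y * q) * t′ ≡ x * (t * t′) + y * t′ * q
      lem₁ = solveℕ-∀
      lem₂ : ∀ x z q w → x * (1 + z * q) + w * q ≡ x + (x * z + w) * q
      lem₂ = solveℕ-∀

    rank-path : ∀ l → rank ((l * t) % q) ≡ l % q
    rank-path l = trans (sym (%-absorb (l * t) t′)) (trans (cong (_% q) (trans (cong (_* t′) (sym (+-identityʳ (l * t)))) (mul-inverse l 0)))
      ([m+kn]%n≡m%n l (l * z + 0 * t′) q))
      where
      %-absorb : ∀ a b → (a * b) % q ≡ ((a % q) * b) % q
      %-absorb a b = trans (%-distribˡ-* a b q) (sym (trans (%-distribˡ-* (a % q) b q) (cong (λ w → (w * (b % q)) % q) (m%n%n≡m%n a q))))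

    path-rank : ∀ j → j < q → (rank j * t) % q ≡ j
    path-rank j j<q = begin
      (rank j * t) % q                        ≡⟨ %-distribˡ-* (rank j) t q ⟩
      ((rank j % q) * (t % q)) % q            ≡⟨ cong (λ w → (w * (t % q)) % q) (m%n%n≡m%n (j * t′) q) ⟩
      (((j * t′) % q) * (t % q)) % q          ≡⟨ sym (%-distribˡ-* (j * t′) t q) ⟩
      (j * t′ * t) % q                        ≡⟨ cong (_% q) (trans (lem₁ j t′ t) (trans (cong (_*_ j) inverse) (lem₂ j z q))) ⟩
      (j + j * z * q) % q                     ≡⟨ [m+kn]%n≡m%n j (j * z) q ⟩
      j % q                                   ≡⟨ m<n⇒m%n≡m j<q ⟩
      j ∎
      where
      open ≡-Reasoning
      lem₁ : ∀ a b c → a * b * c ≡ a * (c * b)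
      lem₁ = solveℕ-∀
      lem₂ : ∀ j z q → j * (1 + z * q) ≡ j + j * z * q
      lem₂ = solveℕ-∀

    stage-step : ∀ l → 1 ≤ l → l < q → D q (stage (suc l)) ≡ D q (stage l)
    stage-step l 1≤l l<q = D-column-op q a b -1ℤ (m%n<n (l * t) q) (m%n<n (suc l * t) q) a≢b off at
      where
      a b : ℕ
      a = (l * t) % q
      b = (suc l * t) % q
      rank-a : rank a ≡ l
      rank-a = trans (rank-path l) (m<n⇒m%n≡m l<q)
      -- Column b has rank l+1, or rank 0 if the path ends there; in either case it has not been
      -- modified yet.
      stage-b : ∀ i → stage l i b ≡ c (i + b)
      stage-b i with suc l ≟ q
      ... | yes sl≡q = stage-0 l i (trans (rank-path (suc l)) (trans (cong (_% q) sl≡q) (n%n≡0 q)))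
      ... | no sl≢q = stage-≥ l i (subst (l ≤_) (sym (trans (rank-path (suc l)) (m<n⇒m%n≡m (≤∧≢⇒< l<q sl≢q)))) (n≤1+n l))
      a≢b : a ≢ b
      a≢b a≡b with suc l ≟ q
      ... | yes sl≡q = <⇒≢ 1≤l (trans (trans (sym (n%n≡0 q)) (cong (_% q) (sym sl≡q))) (trans (sym (rank-path (suc l))) (trans (cong rank (sym a≡b)) rank-a)))
      ... | no sl≢q = <⇒≢ (n<1+n l) (trans (sym rank-a) (trans (cong rank a≡b) (trans (rank-path (suc l)) (m<n⇒m%n≡m (≤∧≢⇒< l<q sl≢q)))))
      off : Off q a (stage (suc l)) (stage l)
      off i j _ j<q j≢a with <-cmp (rank j) l
      ... | tri≈ _ r≡l _ = contradiction (trans (sym (path-rank j j<q)) (cong (λ w → (w * t) % q) r≡l)) j≢a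
      ... | tri> _ _ l<r = trans (stage-≥ (suc l) i l<r) (sym (stage-≥ l i (<⇒≤ l<r)))
      ... | tri< r<l _ _ with rank j ≟ 0
      ...   | yes r≡0 = trans (stage-0 (suc l) i r≡0) (sym (stage-0 l i r≡0))
      ...   | no r≢0 = trans (stage-modified (suc l) i (n≢0⇒n>0 r≢0) (m≤n⇒m≤1+n r<l)) (sym (stage-modified l i (n≢0⇒n>0 r≢0) r<l))
      -- The index a + t may exceed q; periodicity identifies it with b.
      shifted : ∀ i → c (i + a + t) ≡ c (i + b)
      shifted i = trans (sym (c-% (i + a + t))) (trans (cong c (begin
        (i + a + t) % q           ≡⟨ cong (_% q) (lem i a t) ⟩
        (i + t + a) % q           ≡⟨ %-remove i′ (l * t) ⟩
        (i + t + l * t) % q       ≡⟨ cong (_% q) (+-assoc i t (l * t)) ⟩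
        (i + suc l * t) % q       ≡⟨ sym (%-remove i (suc l * t)) ⟩
        (i + b) % q ∎)) (c-% (i + b)))
        where
        open ≡-Reasoning
        i′ = i + t
        lem : ∀ i a t → i + a + t ≡ i + t + a
        lem = solveℕ-∀
        %-remove : ∀ x y → (x + y % q) % q ≡ (x + y) % q
        %-remove x y = trans (%-distribˡ-+ x (y % q) q) (trans (cong (λ w → (x % q + w) % q) (m%n%n≡m%n y q)) (sym (%-distribˡ-+ x y q)))
      at : ∀ i → i < q → stage (suc l) i a ≡ stage l i a +ℤ -1ℤ *ℤ stage l i b
      at i _ = trans (stage-modified (suc l) i (subst (1 ≤_) (sym rank-a) 1≤l) (subst (_< suc l) (sym rank-a) ≤-refl))
        (trans (cong (λ w → c (i + a) -ℤ w) (shifted i)) (trans (lem (c (i + a)) (c (i + b)))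
          (sym (cong₂ (λ v w → v +ℤ -1ℤ *ℤ w) (stage-≥ l i (≤-reflexive (sym rank-a))) (stage-b i)))))
        where
        lem : ∀ x y → x -ℤ y ≡ x +ℤ -1ℤ *ℤ y
        lem = solve-∀

    D-stage : ∀ l → l < q → D q (stage (suc l)) ≡ D q (hankel c 0)
    D-stage zero _ = D-cong q eq
      where
      eq : ∀ i j → i < q → j < q → stage 1 i j ≡ hankel c 0 i j
      eq i j _ _ with rank j ≟ 0
      ... | yes r≡0 = stage-0 1 i r≡0
      ... | no r≢0 = stage-≥ 1 i (n≢0⇒n>0 r≢0)
    D-stage (suc l) sl<q = trans (stage-step (suc l) z<s sl<q) (D-stage l (<⇒≤ sl<q))

    -- Outside column 0 the final matrix is the Hankel matrix of c(n) - c(n+t). Only indices from 1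
    -- to 2q′ occur there, and among them q′ and q carry the nonzero values; these are the two
    -- antidiagonals of `D-bidiagonal`. The untouched column 0 runs through one period.
    D-circulant : ∀ η → η *ℤ η ≡ 1ℤ →
      (∀ j → suc j ≡ q′ → c (suc j) -ℤ c (suc j + t) ≡ η) →
      (c q -ℤ c (q + t) ≡ - η) →
      (∀ j → suc j < q′ + q → suc j ≢ q′ → suc j ≢ q → c (suc j) -ℤ c (suc j + t) ≡ 0ℤ) →
      D q (hankel c 0) ≡ η ^ℤ q′ *ℤ triSign q *ℤ ∑ q c
    D-circulant η ηη h₁ h₂ h₀ = trans (sym (D-stage q′ ≤-refl)) (trans
      (D-bidiagonal q′ η {stage q} ηη
        (λ i j _ j<q′ eq → trans (at i j j<q′) (trans (cong (λ w → c w -ℤ c (w + t)) (+-suc i j)) (h₁ (i + j) (trans (sym (+-suc i j)) eq))))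
        (λ i j _ j<q′ eq → trans (at i j j<q′) (trans (cong (λ w → c w -ℤ c (w + t)) eq) h₂))
        (λ i j i≤q′ j<q′ p r → trans (at i j j<q′) (trans (cong (λ w → c w -ℤ c (w + t)) (+-suc i j))
          (h₀ (i + j) (subst₂ _<_ (+-suc i j) refl (+-mono-≤-< i≤q′ (s<s j<q′))) (p ∘ trans (+-suc i j)) (r ∘ trans (+-suc i j))))))
      (cong (η ^ℤ q′ *ℤ triSign q *ℤ_) (∑-cong q (λ i _ → trans (stage-0 q i refl) (cong c (+-identityʳ i))))))
      where
      at : ∀ i j → j < q′ → stage q i (suc j) ≡ c (i + suc j) -ℤ c (i + suc j + t)
      at i j j<q′ = stage-modified q i rank>0 (m%n<n (suc j * t′) q)
        where
        rank>0 : 1 ≤ rank (suc j)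
        rank>0 with rank (suc j) in eq
        ... | suc _ = z<s
        ... | zero = contradiction (trans (cong (λ w → (w * t) % q) (sym eq)) (path-rank (suc j) (s<s j<q′))) λ ()

-- The words τ^k(1)

τ-++ : ∀ xs ys → τ (xs ++ ys) ≡ τ xs ++ τ ys
τ-++ [] ys = refl
τ-++ (true ∷ xs) ys = cong (λ w → true ∷ false ∷ true ∷ w) (τ-++ xs ys)
τ-++ (false ∷ xs) ys = cong (true ∷_) (τ-++ xs ys)

τ^-++ : ∀ j xs ys → τ^ j (xs ++ ys) ≡ τ^ j xs ++ τ^ j ys
τ^-++ zero xs ys = refl
τ^-++ (suc j) xs ys = trans (cong τ (τ^-++ j xs ys)) (τ-++ (τ^ j xs) (τ^ j ys))

τ^-τ : ∀ j w → τ^ j (τ w) ≡ τ (τ^ j w)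
τ^-τ zero w = refl
τ^-τ (suc j) w = cong τ (τ^-τ j w)

W V : ℕ → List Bool
W j = τ^ j (true ∷ [])
V j = τ^ j (false ∷ [])

V-suc : ∀ j → V (suc j) ≡ W j
V-suc j = sym (τ^-τ j (false ∷ []))

W-suc : ∀ j → W (suc j) ≡ W j ++ (V j ++ W j)
W-suc j = trans (sym (τ^-τ j (true ∷ []))) (trans (τ^-++ j (true ∷ []) _) (cong (W j ++_) (τ^-++ j (false ∷ []) _)))

-- W j V j and V j W j differ only in their two middle letters.
pre suf : ℕ → List Bool
pre zero = []
pre (suc j) = W j ++ pre j
suf zero = []
suf (suc j) = suf j ++ W j

mid : ℕ → Bool
mid zero = true
mid (suc j) = not (mid j)

-- The two equations need each other: W(j+1) V(j+1) is V j W j with W j on both sides, and V(j+1)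
-- W(j+1) is W j V j with W j on both sides. So the middle pair is exchanged at every level, as
-- `mid` records.
WV : ∀ j → W j ++ V j ≡ pre j ++ mid j ∷ not (mid j) ∷ suf j
VW : ∀ j → V j ++ W j ≡ pre j ++ not (mid j) ∷ mid j ∷ suf j
WV zero = refl
WV (suc j) rewrite W-suc j | V-suc j | not-involutive (mid j) = begin
  (W j ++ (V j ++ W j)) ++ W j  ≡⟨ ++-assoc (W j) (V j ++ W j) (W j) ⟩
  W j ++ ((V j ++ W j) ++ W j)  ≡⟨ cong (λ w → W j ++ (w ++ W j)) (VW j) ⟩
  W j ++ ((pre j ++ not (mid j) ∷ mid j ∷ suf j) ++ W j) ≡⟨ cong (W j ++_) (++-assoc (pre j) _ (W j)) ⟩
  W j ++ (pre j ++ not (mid j) ∷ mid j ∷ suf j ++ W j)   ≡⟨ sym (++-assoc (W j) (pre j) _) ⟩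
  (W j ++ pre j) ++ not (mid j) ∷ mid j ∷ suf j ++ W j ∎
  where open ≡-Reasoning
VW zero = refl
VW (suc j) rewrite W-suc j | V-suc j | not-involutive (mid j) = begin
  W j ++ (W j ++ (V j ++ W j))  ≡⟨ cong (W j ++_) (sym (++-assoc (W j) (V j) (W j))) ⟩
  W j ++ ((W j ++ V j) ++ W j)  ≡⟨ cong (λ w → W j ++ (w ++ W j)) (WV j) ⟩
  W j ++ ((pre j ++ mid j ∷ not (mid j) ∷ suf j) ++ W j) ≡⟨ cong (W j ++_) (++-assoc (pre j) _ (W j)) ⟩
  W j ++ (pre j ++ mid j ∷ not (mid j) ∷ suf j ++ W j)   ≡⟨ sym (++-assoc (W j) (pre j) _) ⟩
  (W j ++ pre j) ++ mid j ∷ not (mid j) ∷ suf j ++ W j ∎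
  where open ≡-Reasoning

W-suc-form : ∀ j → W (suc j) ≡ pre j ++ mid j ∷ not (mid j) ∷ suf (suc j)
W-suc-form j = trans (W-suc j) (trans (sym (++-assoc (W j) (V j) (W j))) (trans (cong (_++ W j) (WV j)) (++-assoc (pre j) _ (W j))))

core : ℕ → List Bool
core k = suf k ++ (W k ++ (W k ++ pre k))

W-suc-suc : ∀ k → W (suc (suc k)) ≡ (W k ++ (V k ++ W k)) ++ (W k ++ (W k ++ (V k ++ W k)))
W-suc-suc k = trans (W-suc (suc k)) (cong₂ (λ a b → a ++ (b ++ a)) (W-suc k) (V-suc k))

around-core : ∀ k p q r → (pre k ++ p ∷ q ∷ suf k) ++ (W k ++ (W k ++ (pre k ++ r))) ≡ pre k ++ p ∷ q ∷ (core k ++ r)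
around-core k p q r = trans (++-assoc (pre k) _ _) (cong (λ z → pre k ++ p ∷ q ∷ z)
  (sym (trans (++-assoc (suf k) _ r) (cong (suf k ++_) (trans (++-assoc (W k) _ r) (cong (W k ++_) (++-assoc (W k) (pre k) r)))))))

-- The block is W V W · W · W V W. Bracketing its outer parts as (W V) W gives this form, bracketing
-- them as W (V W) gives `W-core-shifted`. In the latter `core k` stands |W k| places further right
-- and the pairs around it are exchanged.
W-core : ∀ k → W (suc (suc k)) ≡
  pre k ++ mid k ∷ not (mid k) ∷ (core k ++ mid k ∷ not (mid k) ∷ suf k ++ W k)
W-core k = begin
  W (suc (suc k))                                          ≡⟨ W-suc-suc k ⟩
  (W k ++ (V k ++ W k)) ++ (W k ++ (W k ++ (V k ++ W k)))  ≡⟨ cong (λ a → a ++ (W k ++ a)) (sym (++-assoc (W k) (V k) (W k))) ⟩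
  ((W k ++ V k) ++ W k) ++ (W k ++ ((W k ++ V k) ++ W k))  ≡⟨ ++-assoc (W k ++ V k) (W k) _ ⟩
  (W k ++ V k) ++ (W k ++ (W k ++ ((W k ++ V k) ++ W k)))  ≡⟨ cong (λ a → a ++ (W k ++ (W k ++ (a ++ W k)))) (WV k) ⟩
  X ++ (W k ++ (W k ++ (X ++ W k)))                        ≡⟨ cong (λ a → X ++ (W k ++ (W k ++ a))) (++-assoc (pre k) _ (W k)) ⟩
  X ++ (W k ++ (W k ++ (pre k ++ mid k ∷ not (mid k) ∷ suf k ++ W k))) ≡⟨ around-core k _ _ _ ⟩
  _ ∎
  where
  open ≡-Reasoning
  X = pre k ++ mid k ∷ not (mid k) ∷ suf k

W-core-shifted : ∀ k → W (suc (suc k)) ≡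
  W k ++ (pre k ++ not (mid k) ∷ mid k ∷ (core k ++ not (mid k) ∷ mid k ∷ suf k))
W-core-shifted k = begin
  W (suc (suc k))                                          ≡⟨ W-suc-suc k ⟩
  (W k ++ (V k ++ W k)) ++ (W k ++ (W k ++ (V k ++ W k)))  ≡⟨ ++-assoc (W k) (V k ++ W k) _ ⟩
  W k ++ ((V k ++ W k) ++ (W k ++ (W k ++ (V k ++ W k))))  ≡⟨ cong (λ a → W k ++ (a ++ (W k ++ (W k ++ a)))) (VW k) ⟩
  W k ++ (X ++ (W k ++ (W k ++ X)))                        ≡⟨ cong (W k ++_) (around-core k _ _ _) ⟩
  _ ∎
  where
  open ≡-Reasoning
  X = pre k ++ not (mid k) ∷ mid k ∷ suf k

letter-++ʳ : ∀ xs ys i → letter (xs ++ ys) (length xs + i) ≡ letter ys i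
letter-++ʳ [] ys i = refl
letter-++ʳ (x ∷ xs) ys i = letter-++ʳ xs ys i

letter-++ˡ : ∀ xs ys i → i < length xs → letter (xs ++ ys) i ≡ letter xs i
letter-++ˡ (x ∷ xs) ys zero lt = refl
letter-++ˡ (x ∷ xs) ys (suc i) lt = letter-++ˡ xs ys i (s≤s⁻¹ lt)

bit : Bool → ℤ
bit b = if b then 1ℤ else 0ℤ

-- This is f (2k+1) / 2.
p : ℕ → ℕ
p k = suc (length (pre k))

length-pre-suf : ∀ k → length (pre k) ≡ length (suf k)
length-pre-suf zero = refl
length-pre-suf (suc k) = trans (length-++ (W k)) (trans (+-comm (length (W k)) _)
  (trans (cong (_+ length (W k)) (length-pre-suf k)) (sym (length-++ (suf k)))))

length-WV : ∀ k → length (W k) + length (V k) ≡ p k + p k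
length-WV k = begin
  length (W k) + length (V k) ≡⟨ sym (length-++ (W k)) ⟩
  length (W k ++ V k)         ≡⟨ cong length (WV k) ⟩
  length (pre k ++ mid k ∷ not (mid k) ∷ suf k) ≡⟨ length-++ (pre k) ⟩
  length (pre k) + suc (suc (length (suf k)))   ≡⟨ cong (λ z → length (pre k) + suc (suc z)) (sym (length-pre-suf k)) ⟩
  length (pre k) + suc (suc (length (pre k)))   ≡⟨ +-suc _ _ ⟩
  p k + p k ∎
  where open ≡-Reasoning

p-suc : ∀ k → p (suc k) ≡ length (W k) + p k
p-suc k = trans (cong suc (length-++ (W k))) (sym (+-suc _ _))

length-W-suc : ∀ k → length (W (suc k)) ≡ length (W k) + (length (V k) + length (W k))
length-W-suc k = trans (cong length (W-suc k)) (trans (length-++ (W k)) (cong (length (W k) +_) (length-++ (V k))))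

-- This is (f(2k) - 1)/2, with the recursion inherited from the word lengths; it makes the oddness
-- of |W k| explicit.
half : ℕ → ℕ
half zero = 0
half (suc zero) = 1
half (suc (suc k)) = suc (half (suc k) + half (suc k) + half k)

length-W : ∀ k → length (W k) ≡ suc (half k + half k)
length-W zero = refl
length-W (suc zero) = refl
length-W (suc (suc k)) = trans (length-W-suc (suc k)) (trans
  (cong₂ (λ a b → a + (b + a)) (length-W (suc k)) (trans (cong length (V-suc k)) (length-W k))) (lem (half (suc k)) (half k)))
  where
  lem : ∀ a b → suc (a + a) + (suc (b + b) + suc (a + a)) ≡ suc (suc (a + a + b) + suc (a + a + b))
  lem = solveℕ-∀

ones : List Bool → ℕ
ones [] = 0
ones (true ∷ w) = suc (ones w)
ones (false ∷ w) = ones w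

-- Each of τ(1) = 101 and τ(0) = 1 has one letter 1 more than its preimage.
ones-τ : ∀ w → ones (τ w) ≡ length w + ones w
ones-τ [] = refl
ones-τ (true ∷ w) = cong suc (trans (cong suc (ones-τ w)) (sym (+-suc _ _)))
ones-τ (false ∷ w) = cong suc (ones-τ w)

ones-W : ∀ k → ones (W k) ≡ p k
ones-W zero = refl
ones-W (suc k) = trans (ones-τ (W k)) (trans (cong (length (W k) +_) (ones-W k)) (sym (p-suc k)))

∑-bits : ∀ w → ∑ (length w) (λ i → bit (letter w i)) ≡ ℤ.+ ones w
∑-bits [] = refl
∑-bits (true ∷ w) = cong (1ℤ +ℤ_) (∑-bits w)
∑-bits (false ∷ w) = trans (cong (0ℤ +ℤ_) (∑-bits w)) refl

-- A step of Euclid's algorithm: |W(k+1)| = 2|W k| + |V k| and |V(k+1)| = |W k|.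
coprime-WV : ∀ k → Coprime (length (W k)) (length (V k))
coprime-WV zero = 1-coprimeTo 1
coprime-WV (suc k) rewrite length-W-suc k | V-suc k =
  coprime-+ (subst (λ z → Coprime z (length (W k))) (+-comm (length (W k)) (length (V k))) (coprime-+ (coprime-sym (coprime-WV k))))

inverse-mod : ∀ t q′ → Coprime (suc q′) (suc t) → ∃ λ t′ → ∃ λ z → suc t * t′ ≡ 1 + z * suc q′
inverse-mod t zero cop = 1 , t , cong suc (trans (*-identityʳ t) (sym (*-identityʳ t)))
inverse-mod t (suc r) cop with coprime-Bézout cop
... | Bézout.-+ x y eq = y , x , trans (*-comm (suc t) y) (sym eq)
-- Here the Bézout identity makes -y the inverse; the factor `suc r`, which is -1 modulo the
-- modulus, replaces the sign.
... | Bézout.+- (suc x) y eq = suc r * y , x + r * suc x , +-cancelʳ-≡ (suc r) _ _ (begin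
  suc t * (suc r * y) + suc r     ≡⟨ lem₁ t r y ⟩
  suc r * (1 + y * suc t)         ≡⟨ cong (suc r *_) eq ⟩
  suc r * (suc x * suc (suc r))   ≡⟨ lem₂ r x ⟩
  1 + (x + r * suc x) * suc (suc r) + suc r ∎)
  where
  open ≡-Reasoning
  lem₁ : ∀ t r y → suc t * (suc r * y) + suc r ≡ suc r * (1 + y * suc t)
  lem₁ = solveℕ-∀
  lem₂ : ∀ r x → suc r * (suc x * suc (suc r)) ≡ 1 + (x + r * suc x) * suc (suc r) + suc r
  lem₂ = solveℕ-∀

sgn-double : ∀ n → sgn (n + n) ≡ 1ℤ
sgn-double zero = refl
sgn-double (suc n) = trans (cong (-_ ∘ sgn) (+-suc n n)) (trans (ℤP.neg-involutive _) (sgn-double n))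

pow-double : ∀ η n → η *ℤ η ≡ 1ℤ → η ^ℤ (n + n) ≡ 1ℤ
pow-double η zero e = refl
pow-double η (suc n) e rewrite +-suc n n = trans (sym (ℤP.*-assoc η η _)) (trans (cong₂ _*ℤ_ e (pow-double η n e)) refl)

bit-gap : ∀ b → (bit b -ℤ bit (not b)) *ℤ (bit b -ℤ bit (not b)) ≡ 1ℤ
bit-gap true = refl
bit-gap false = refl

-- The periodic sequence with period word τ^k(1)

cyclic : ℕ → ℕ → ℤ
cyclic k n = bit (letter (W k) (n % suc (half k + half k)))

module _ (k : ℕ) where
  private
    q′ = half k + half k
    q = suc q′
    c = cyclic k

  cyclic-periodic : ∀ n → c (n + q) ≡ c n
  cyclic-periodic n = cong (λ z → bit (letter (W k) z)) ([m+n]%n≡m%n n q)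

  cyclic-< : ∀ n → n < q → c n ≡ bit (letter (W k) n)
  cyclic-< n n<q = cong (λ z → bit (letter (W k) z)) (m<n⇒m%n≡m n<q)

  cyclic-extend : ∀ R → (∀ n → n < length R → c n ≡ bit (letter R n)) →
    ∀ n → n < length (W k ++ R) → c n ≡ bit (letter (W k ++ R) n)
  cyclic-extend R e n n<l with n <? length (W k)
  ... | yes n<W = trans (cyclic-< n (subst (n <_) (length-W k) n<W)) (cong bit (sym (letter-++ˡ (W k) R n n<W)))
  ... | no n≮W with o , refl ← m≤n⇒∃[o]m+o≡n (≮⇒≥ n≮W) = trans
    (trans (cong c (trans (+-comm (length (W k)) o) (cong (o +_) (length-W k)))) (cyclic-periodic o))
    (trans (e o (+-cancelˡ-< (length (W k)) o (length R) (subst (length (W k) + o <_) (length-++ (W k)) n<l)))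
      (cong bit (sym (letter-++ʳ (W k) R o))))

  -- Three periods cover all indices of a q × q Hankel matrix together with the shifts applied to
  -- it.
  cube : List Bool
  cube = W k ++ (W k ++ W k)

  cyclic-cube : ∀ P R → cube ≡ P ++ R → ∀ i → i < length R → c (length P + i) ≡ bit (letter R i)
  cyclic-cube P R eq i i<l = trans (cyclic-extend (W k ++ W k) (cyclic-extend (W k) one) _
      (subst (length P + i <_) (sym (trans (cong length eq) (length-++ P))) (+-monoʳ-< (length P) i<l)))
    (cong bit (trans (cong (λ w → letter w (length P + i)) eq) (letter-++ʳ P R i)))
    where
    one : ∀ n → n < length (W k) → c n ≡ bit (letter (W k) n)
    one n n<W = cyclic-< n (subst (n <_) (length-W k) n<W)

  ∑-cyclic : ∑ q c ≡ ℤ.+ p k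
  ∑-cyclic = trans (∑-cong q (λ i i<q → cyclic-< i i<q)) (trans (cong (λ n → ∑ n (bit ∘ letter (W k))) (sym (length-W k)))
    (trans (∑-bits (W k)) (cong ℤ.+_ (ones-W k))))

  open Circulant q′ c cyclic-periodic using (D-rotate; ∑-rotate) public

  cyclic-rotate : ∀ d → D q (hankel c d) ≡ D q (hankel c 0)
  cyclic-rotate = D-rotate (sgn-double (half k))

module _ (j : ℕ) where
  private
    k = suc j
    w = W j
    u = pre j
    v = suf j
    x = mid j
    y = not x
    m = v ++ (w ++ u)

  -- `m` is the word between consecutive middle pairs. By `VW`, starting |W j| places later
  -- (`cube-shifted`) gives the same word `m` with the letters of every middle pair exchanged.
  cube-split : cube k ≡ (u ++ x ∷ []) ++ (y ∷ m ++ (x ∷ y ∷ m ++ (x ∷ y ∷ v ++ w)))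
  cube-split = begin
    cube k                        ≡⟨ cong (λ a → a ++ (a ++ a)) (W-suc-form j) ⟩
    X ++ (X ++ X)                 ≡⟨ assoc X ⟩
    u ++ (x ∷ y ∷ (v ++ w) ++ (u ++ (x ∷ y ∷ (v ++ w) ++ X))) ≡⟨ cong (λ z → u ++ x ∷ y ∷ z) (trans (shuffle _) (cong (λ z → m ++ x ∷ y ∷ z) (shuffle _))) ⟩
    u ++ (x ∷ y ∷ m ++ (x ∷ y ∷ m ++ (x ∷ y ∷ v ++ w)))       ≡⟨ sym (++-assoc u (x ∷ []) _) ⟩
    _ ∎
    where
    open ≡-Reasoning
    X = u ++ x ∷ y ∷ (v ++ w)
    assoc : ∀ Z → X ++ (X ++ Z) ≡ u ++ (x ∷ y ∷ (v ++ w) ++ (u ++ (x ∷ y ∷ (v ++ w) ++ Z)))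
    assoc Z = trans (++-assoc u _ (X ++ Z)) (cong (λ z → u ++ x ∷ y ∷ (v ++ w) ++ z) (++-assoc u _ Z))
    shuffle : ∀ Z → (v ++ w) ++ (u ++ Z) ≡ m ++ Z
    shuffle Z = trans (sym (++-assoc (v ++ w) u Z)) (cong (_++ Z) (++-assoc v w u))

  cube-shifted : cube k ≡ (w ++ (u ++ y ∷ [])) ++ (x ∷ m ++ (y ∷ x ∷ m ++ (y ∷ x ∷ v)))
  cube-shifted = begin
    cube k                        ≡⟨ cong (λ a → a ++ (a ++ a)) (trans (W-suc j) (cong (w ++_) (VW j))) ⟩
    (w ++ X) ++ ((w ++ X) ++ (w ++ X)) ≡⟨ trans (++-assoc w X _) (cong (λ z → w ++ (X ++ z)) (++-assoc w X _)) ⟩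
    w ++ (X ++ (w ++ (X ++ (w ++ X))))  ≡⟨ cong (w ++_) (trans (++-assoc u _ _) (cong (λ z → u ++ y ∷ x ∷ z)
         (trans (cong (λ z → v ++ (w ++ z)) (++-assoc u (y ∷ x ∷ v) (w ++ X))) (trans (shuffle _) (cong (λ z → m ++ y ∷ x ∷ z) (shuffle _)))))) ⟩
    w ++ (u ++ (y ∷ x ∷ m ++ (y ∷ x ∷ m ++ (y ∷ x ∷ v)))) ≡⟨ cong (w ++_) (sym (++-assoc u (y ∷ []) _)) ⟩
    w ++ ((u ++ y ∷ []) ++ (x ∷ m ++ (y ∷ x ∷ m ++ (y ∷ x ∷ v)))) ≡⟨ sym (++-assoc w (u ++ y ∷ []) _) ⟩
    _ ∎
    where
    open ≡-Reasoning
    X = u ++ y ∷ x ∷ v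
    shuffle : ∀ Z → v ++ (w ++ (u ++ Z)) ≡ m ++ Z
    shuffle Z = trans (cong (v ++_) (sym (++-assoc w u Z))) (sym (++-assoc v (w ++ u) Z))

module _ (j : ℕ) where
  private
    k = suc j
    u = pre j
    x = mid j
    y = not x
    m = suf j ++ (W j ++ pre j)
    q′ = half k + half k
    q = suc q′
    c = cyclic k
    t = length (V k)
    -- Starting at the second letter of a middle pair puts the changes under the shift by t at the
    -- indices q′ and q, as `D-circulant` demands.
    d = length u + 1
    η = bit x -ℤ bit y
    L₁ = y ∷ m ++ (x ∷ y ∷ m ++ (x ∷ y ∷ suf j ++ W j))
    L₂ = x ∷ m ++ (y ∷ x ∷ m ++ (y ∷ x ∷ suf j))

    length-m : q′ ≡ suc (length m)
    length-m = suc-injective (trans (sym (length-W k)) (trans (cong length (W-suc-form j)) (trans (length-++ u)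
      (trans (cong (λ z → length u + suc (suc z)) (length-++ (suf j))) (trans (lem (length u) (length (suf j)) (length (W j)))
        (cong (suc ∘ suc) (sym (trans (length-++ (suf j)) (cong (length (suf j) +_) (length-++ (W j)))))))))))
      where
      lem : ∀ u v w → u + suc (suc (v + w)) ≡ suc (suc (v + (w + u)))
      lem = solveℕ-∀

    at₁ : ∀ i → i < length L₁ → c (i + d) ≡ bit (letter L₁ i)
    at₁ i i<l = trans (cong c (trans (+-comm i d) (cong (_+ i) (sym (length-++ u))))) (cyclic-cube k _ L₁ (cube-split j) i i<l)

    at₂ : ∀ i → i < length L₂ → c (i + t + d) ≡ bit (letter L₂ i)
    at₂ i i<l = trans (cong c (trans (lem i t (length u)) (cong (_+ i) (sym (trans (length-++ (W j)) (cong₂ _+_ (cong length (sym (V-suc j))) (length-++ u)))))))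
      (cyclic-cube k _ L₂ (cube-shifted j) i i<l)
      where
      lem : ∀ i t u → i + t + (u + 1) ≡ t + (u + 1) + i
      lem = solveℕ-∀

    length-mm : ∀ (p q r s : Bool) Z → length m + length m + 3 ≤ length (p ∷ m ++ (q ∷ r ∷ m ++ s ∷ Z))
    length-mm p q r s Z rewrite length-++ m {q ∷ r ∷ m ++ s ∷ Z} | length-++ m {s ∷ Z} =
      subst (length m + length m + 3 ≤_) (lem (length m) (length Z)) (m≤m+n _ (suc (length Z)))
      where
      lem : ∀ m z → m + m + 3 + suc z ≡ suc (m + suc (suc (m + suc z)))
      lem = solveℕ-∀

    letter-fst : ∀ (p q r s : Bool) Z i → i < length m → letter (p ∷ m ++ (q ∷ r ∷ m ++ s ∷ Z)) (suc i) ≡ letter m i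
    letter-fst p q r s Z i i<m = letter-++ˡ m _ i i<m

    letter-mid : ∀ (p q r s : Bool) Z i → letter (p ∷ m ++ (q ∷ r ∷ m ++ s ∷ Z)) (suc (length m + i)) ≡ letter (q ∷ r ∷ m ++ s ∷ Z) i
    letter-mid p q r s Z i = letter-++ʳ m _ i

    cc : ℕ → ℤ
    cc i = c (i + d)

    cc-periodic : ∀ n → cc (n + q) ≡ cc n
    cc-periodic n = trans (cong c (lem n q d)) (cyclic-periodic k (n + d))
      where
      lem : ∀ n q d → n + q + d ≡ n + d + q
      lem = solveℕ-∀

    difference : ∀ i → i < length m + length m + 3 → cc i -ℤ cc (i + t) ≡ bit (letter L₁ i) -ℤ bit (letter L₂ i)
    difference i lt = cong₂ _-ℤ_ (at₁ i (≤-trans lt (length-mm y x y x _))) (at₂ i (≤-trans lt (length-mm x y x y _)))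

    small : ∀ {i} e → i ≡ length m + e → e ≤ 2 → i < length m + length m + 3
    small e refl e≤2 = subst (length m + e <_) (sym (+-assoc (length m) (length m) 3)) (+-monoʳ-< (length m) (≤-trans (s≤s e≤2) (m≤n+m 3 (length m))))

    first : ∀ i → suc i ≡ q′ → cc (suc i) -ℤ cc (suc i + t) ≡ η
    first i eq with refl ← trans (suc-injective (trans eq length-m)) (sym (+-identityʳ (length m))) =
      trans (difference (suc (length m + 0)) (small 1 (sym (+-suc (length m) 0)) (s≤s z≤n)))
        (cong₂ (λ a b → bit a -ℤ bit b) (letter-mid y x y x _ 0) (letter-mid x y x y _ 0))

    second : cc q -ℤ cc (q + t) ≡ - η
    second = trans (cong (λ z → cc z -ℤ cc (z + t)) (trans (cong suc length-m) (cong suc (sym (+-comm (length m) 1)))))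
      (trans (difference (suc (length m + 1)) (small 2 (sym (+-suc (length m) 1)) ≤-refl))
        (trans (cong₂ (λ a b → bit a -ℤ bit b) (letter-mid y x y x _ 1) (letter-mid x y x y _ 1)) (sym (lem (bit x) (bit y)))))
      where
      lem : ∀ a b → - (a -ℤ b) ≡ b -ℤ a
      lem = solve-∀

    same : ∀ {a b} → a ≡ b → bit a -ℤ bit b ≡ 0ℤ
    same {a} refl = ℤP.+-inverseʳ (bit a)

    other : ∀ i → suc i < q′ + q → suc i ≢ q′ → suc i ≢ q → cc (suc i) -ℤ cc (suc i + t) ≡ 0ℤ
    other i lt ≢q′ ≢q with <-cmp i (length m)
    ... | tri≈ _ refl _ = contradiction (sym length-m) ≢q′
    ... | tri< i<m _ _ = trans (difference (suc i) (<-≤-trans (s<s i<m) (≤-trans (m≤n+m _ (length m + 2)) (≤-reflexive (lem (length m))))))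
          (same (trans (letter-fst y x y x _ i i<m) (sym (letter-fst x y x y _ i i<m))))
      where
      lem : ∀ m → m + 2 + suc m ≡ m + m + 3
      lem = solveℕ-∀
    ... | tri> _ _ m<i with m<n⇒n≡m+1+o m<i
    ...   | zero , refl = contradiction (trans (cong suc (+-comm (length m) 1)) (cong suc (sym length-m))) ≢q
    ...   | suc o , refl = trans (difference (suc (length m + suc (suc o))) (subst (suc (length m + suc (suc o)) <_) (trans (cong (λ z → z + suc z) length-m) (lem (length m))) lt))
          (same (trans (trans (letter-mid y x y x _ (suc (suc o))) (letter-++ˡ m _ o o<m)) (sym (trans (letter-mid x y x y _ (suc (suc o))) (letter-++ˡ m _ o o<m)))))
      where
      lem : ∀ m → suc m + suc (suc m) ≡ m + m + 3
      lem = solveℕ-∀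
      lem₂ : ∀ m o → suc (m + suc (suc o)) ≡ m + 3 + o
      lem₂ = solveℕ-∀
      lem₃ : ∀ m → suc m + suc (suc m) ≡ m + 3 + m
      lem₃ = solveℕ-∀
      o<m : o < length m
      o<m = +-cancelˡ-< (length m + 3) o (length m) (subst₂ _<_ (lem₂ (length m) o) (trans (cong (λ z → z + suc z) length-m) (lem₃ (length m))) lt)

    inverse : ∃ λ t′ → ∃ λ z → t * t′ ≡ 1 + z * q
    inverse = subst (λ n → ∃ λ t′ → ∃ λ z → n * t′ ≡ 1 + z * q) (sym t≡) (inverse-mod (half j + half j) q′
      (subst₂ Coprime (length-W k) t≡ (coprime-WV k)))
      where
      t≡ : t ≡ suc (half j + half j)
      t≡ = trans (cong length (V-suc j)) (length-W j)

  D-cyclic-suc : D q (hankel c 0) ≡ triSign q *ℤ ℤ.+ p k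
  D-cyclic-suc with t′ , z , eq ← inverse = begin
    D q (hankel c 0)                   ≡⟨ sym (cyclic-rotate k d) ⟩
    D q (hankel c d)                   ≡⟨ D-cong q (λ i i′ _ _ → cong c (lem d i i′)) ⟩
    D q (hankel cc 0)                  ≡⟨ Circulant.Path.D-circulant q′ cc cc-periodic t t′ z eq η (bit-gap x) first second other ⟩
    η ^ℤ q′ *ℤ triSign q *ℤ ∑ q cc     ≡⟨ cong₂ (λ a b → a *ℤ triSign q *ℤ b) (pow-double η (half k) (bit-gap x)) (trans (∑-rotate k d) (∑-cyclic k)) ⟩
    1ℤ *ℤ triSign q *ℤ ℤ.+ p k         ≡⟨ cong (_*ℤ ℤ.+ p k) (ℤP.*-identityˡ (triSign q)) ⟩
    triSign q *ℤ ℤ.+ p k ∎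
    where
    open ≡-Reasoning
    lem : ∀ d i j → d + i + j ≡ i + j + d
    lem = solveℕ-∀

D-cyclic : ∀ k d → D (length (W k)) (hankel (cyclic k) d) ≡ triSign (length (W k)) *ℤ ℤ.+ p k
D-cyclic k d rewrite length-W k = trans (cyclic-rotate k d) (base k)
  where
  base : ∀ k → D (suc (half k + half k)) (hankel (cyclic k) 0) ≡ triSign (suc (half k + half k)) *ℤ ℤ.+ p k
  -- The period is 1 here and the matrix has the single entry 1; there is no level k - 1 to supply a
  -- middle pair.
  base zero = refl
  base (suc j) = D-cyclic-suc j

-- Prefixes of the fixed point

-- Prefixes of the fixed point, expressed without the infinite word.
Prefix : List Bool → Set
Prefix w = ∃ λ M → ∃ λ z → W M ≡ w ++ z

W-prefix : ∀ d M → ∃ λ z → W (d + M) ≡ W M ++ z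
W-prefix zero M = [] , sym (++-identityʳ (W M))
W-prefix (suc d) M with z , eq ← W-prefix d M = z ++ _ ,
  trans (W-suc (d + M)) (trans (cong (_++ (V (d + M) ++ W (d + M))) eq) (++-assoc (W M) z _))

Prefix-τ : ∀ {w} → Prefix w → Prefix (τ w)
Prefix-τ {w} (M , z , eq) = suc M , τ z , trans (cong τ eq) (τ-++ w z)

Prefix-τ^ : ∀ K {w} → Prefix w → Prefix (τ^ K w)
Prefix-τ^ zero P = P
Prefix-τ^ (suc K) P = Prefix-τ (Prefix-τ^ K P)

Prefix-++ : ∀ w {v} → Prefix (w ++ v) → Prefix w
Prefix-++ w {v} (M , z , eq) = M , v ++ z , trans eq (++-assoc w v z)

shorter-prefix : ∀ (xs ys : List Bool) {v w} → xs ++ v ≡ ys ++ w → length xs ≤ length ys → ∃ λ z → ys ≡ xs ++ z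
shorter-prefix [] ys eq le = ys , refl
shorter-prefix (x ∷ xs) (y ∷ ys) eq le with refl ← cong (λ { [] → x ; (h ∷ _) → h }) eq
  with z , e ← shorter-prefix xs ys (cong (λ { [] → [] ; (_ ∷ r) → r }) eq) (s≤s⁻¹ le) = z , cong (x ∷_) e

-- Both words are prefixes of τ^(M+M′)(1).
Prefix-compare : ∀ {w w′} → Prefix w → Prefix w′ → length w ≤ length w′ → ∃ λ z → w′ ≡ w ++ z
Prefix-compare {w} {w′} (M , z , eq) (M′ , z′ , eq′) le with a , ea ← W-prefix M′ M | b , eb ← W-prefix M M′ =
  shorter-prefix w w′ (trans (sym (trans (cong (_++ a) eq) (++-assoc w z a)))
    (trans (sym ea) (trans (cong W (+-comm M′ M)) (trans eb (trans (cong (_++ b) eq′) (++-assoc w′ z′ b)))))) le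

n<length-W : ∀ n → n < length (W n)
n<length-W zero = z<s
n<length-W (suc n) = subst (suc n <_) (sym (length-W-suc n)) (lem (length (W n)) (length (V n)) (n<length-W n))
  where
  lem : ∀ a b → n < a → suc n < a + (b + a)
  lem a b n<a = ≤-trans (s≤s n<a) (subst (_≤ a + (b + a)) (+-comm a 1) (+-monoʳ-≤ a (≤-trans (≤-<-trans z≤n n<a) (m≤n+m a b))))

s-prefix : ∀ {w} → Prefix w → ∀ j → j < length w → ℤ.+ s j ≡ bit (letter w j)
s-prefix {w} P j j<w = trans (lem (letter (W (suc j)) j)) (cong bit same)
  where
  lem : ∀ b → ℤ.+ (if b then 1 else 0) ≡ bit b
  lem true = refl
  lem false = refl
  PW : Prefix (W (suc j))
  PW = suc j , [] , sym (++-identityʳ _)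
  j<W : j < length (W (suc j))
  j<W = <-trans (n<1+n j) (n<length-W (suc j))
  same : letter (W (suc j)) j ≡ letter w j
  same with ≤-total (length w) (length (W (suc j)))
  ... | inj₁ le with z , eq ← Prefix-compare P PW le = trans (cong (λ l → letter l j) eq) (letter-++ˡ w z j j<w)
  ... | inj₂ le with z , eq ← Prefix-compare PW P le = sym (trans (cong (λ l → letter l j) eq) (letter-++ˡ (W (suc j)) z j j<W))

f-even : ∀ k → f (2 * k) ≡ length (W k)
f-odd : ∀ k → f (2 * k + 1) ≡ p k + p k
private
  double/2 : ∀ k → 2 * k / 2 ≡ k
  double/2 k = trans (cong (_/ 2) (*-comm 2 k)) (m*n/n≡m k 2)
  double%2 : ∀ k → 2 * k % 2 ≡ 0
  double%2 k = trans (cong (_% 2) (*-comm 2 k)) (m*n%n≡0 k 2)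
  suc-double%2 : ∀ k → (2 * k + 1) % 2 ≡ 1
  suc-double%2 k = trans (cong (_% 2) (trans (+-comm (2 * k) 1) (cong suc (*-comm 2 k)))) ([m+kn]%n≡m%n 1 k 2)
  suc-double/2 : ∀ k → (2 * k + 1) / 2 ≡ k
  suc-double/2 k = trans (+-distrib-/ (2 * k) 1 (subst (λ r → r + 1 < 2) (sym (double%2 k)) ≤-refl)) (trans (+-identityʳ _) (double/2 k))
f-even k = cong₂ fAux (double/2 k) (double%2 k)
f-odd k = trans (cong₂ fAux (suc-double/2 k) (suc-double%2 k)) (trans (cong length (τ^-++ k (true ∷ []) (false ∷ []))) (trans (length-++ (W k)) (length-WV k)))

f-odd/2 : ∀ k → f (2 * k + 1) / 2 ≡ p k
f-odd/2 k = trans (cong (_/ 2) (trans (f-odd k) (trans (cong (p k +_) (sym (+-identityʳ (p k)))) (*-comm 2 (p k))))) (m*n/n≡m (p k) 2)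

-- The numeration system

Digits : Set
Digits = ℕ → Bool

total : ℕ → (ℕ → ℕ) → ℕ
total zero g = 0
total (suc n) g = g 0 + total n (g ∘ suc)

total-cong : ∀ n {g h} → (∀ i → g i ≡ h i) → total n g ≡ total n h
total-cong zero e = refl
total-cong (suc n) e = cong₂ _+_ (e 0) (total-cong n (e ∘ suc))

total-+ : ∀ a b g → total (a + b) g ≡ total a g + total b (λ i → g (a + i))
total-+ zero b g = refl
total-+ (suc a) b g = trans (cong (g 0 +_) (total-+ a b (g ∘ suc))) (sym (+-assoc (g 0) _ _))

total-0 : ∀ n {g} → (∀ i → g i ≡ 0) → total n g ≡ 0
total-0 zero e = refl
total-0 (suc n) e = cong₂ _+_ (e 0) (total-0 n (e ∘ suc))

sum-upTo : ∀ n g → sum (map g (upTo n)) ≡ total n g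
sum-upTo n g = trans (cong sum (map-upTo g n)) (go n g)
  where
  go : ∀ n g → sum (applyUpTo g n) ≡ total n g
  go zero g = refl
  go (suc n) g = cong (g 0 +_) (go n (g ∘ suc))

Sparse : Digits → Set
Sparse A = (∀ i → A i ≡ true → A (suc i) ≡ false) × (∀ j → A (2 * j) ≡ true → A (2 + 2 * j) ≡ false)

tail₂ : Digits → Digits
tail₂ A i = A (2 + i)

Sparse-tail₂ : ∀ {A} → Sparse A → Sparse (tail₂ A)
Sparse-tail₂ {A} (adj , even) = (λ i → adj (2 + i)) , λ j a → subst (λ i → A (2 + i) ≡ false) (lem j) (even (suc j) (subst (λ i → A i ≡ true) (sym (lem j)) a))
  where
  lem : ∀ j → 2 * suc j ≡ 2 + 2 * j
  lem = solveℕ-∀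

-- The digits 0 and 1 stand for the words 1 and 10, of lengths `f 0` and `f 1`; admissible digits
-- never use both.
low : Bool → Bool → List Bool
low _ true = true ∷ false ∷ []
low true false = true ∷ []
low false false = []

-- The prefix of the fixed point whose length has the digits A (of which the first 2n count).
word : ℕ → Digits → List Bool
word zero A = []
word (suc n) A = τ (word n (tail₂ A)) ++ low (A 0) (A 1)

val : Bool → ℕ
val b = if b then 1 else 0

τ^-[] : ∀ j → τ^ j [] ≡ []
τ^-[] zero = refl
τ^-[] (suc j) = cong τ (τ^-[] j)

-- Every τ raises the index of a digit by two, since |τ^i(1)| = f(2i) and |τ^i(10)| = f(2i+1). The
-- exponent j is general so that the induction can pass to `tail₂ A`.
length-word : ∀ n j A → Sparse A → length (τ^ j (word n A)) ≡ total (2 * n) (λ i → val (A i) * f (2 * j + i))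
length-word zero j A S rewrite τ^-[] j = refl
length-word (suc n) j A S = begin
  length (τ^ j (τ (word n (tail₂ A)) ++ low (A 0) (A 1)))     ≡⟨ cong length (τ^-++ j (τ (word n (tail₂ A))) _) ⟩
  length (τ^ j (τ (word n (tail₂ A))) ++ τ^ j (low (A 0) (A 1))) ≡⟨ length-++ (τ^ j (τ (word n (tail₂ A)))) ⟩
  length (τ^ j (τ (word n (tail₂ A)))) + length (τ^ j (low (A 0) (A 1)))
    ≡⟨ cong₂ _+_ (trans (cong length (τ^-τ j (word n (tail₂ A)))) (length-word n (suc j) (tail₂ A) (Sparse-tail₂ {A} S))) (low-length (A 0) (A 1) (proj₁ S 0)) ⟩
  total (2 * n) (λ i → val (A (2 + i)) * f (2 * suc j + i)) + (val (A 0) * f (2 * j + 0) + val (A 1) * f (2 * j + 1))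
    ≡⟨ +-comm (total (2 * n) _) _ ⟩
  (val (A 0) * f (2 * j + 0) + val (A 1) * f (2 * j + 1)) + total (2 * n) (λ i → val (A (2 + i)) * f (2 * suc j + i))
    ≡⟨ cong ((val (A 0) * f (2 * j + 0) + val (A 1) * f (2 * j + 1)) +_) (total-cong (2 * n) (λ i → cong (λ z → val (A (2 + i)) * f z) (lem j i))) ⟩
  (val (A 0) * f (2 * j + 0) + val (A 1) * f (2 * j + 1)) + total (2 * n) (λ i → val (A (2 + i)) * f (2 * j + (2 + i)))
    ≡⟨ +-assoc (val (A 0) * f (2 * j + 0)) _ _ ⟩
  total (2 + 2 * n) (λ i → val (A i) * f (2 * j + i))
    ≡⟨ cong (λ z → total z (λ i → val (A i) * f (2 * j + i))) (sym (lem₂ n)) ⟩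
  total (2 * suc n) (λ i → val (A i) * f (2 * j + i)) ∎
  where
  open ≡-Reasoning
  lem : ∀ j i → 2 * suc j + i ≡ 2 * j + (2 + i)
  lem = solveℕ-∀
  lem₂ : ∀ n → 2 * suc n ≡ 2 + 2 * n
  lem₂ = solveℕ-∀
  low-length : ∀ a b → (a ≡ true → b ≡ false) → length (τ^ j (low a b)) ≡ val a * f (2 * j + 0) + val b * f (2 * j + 1)
  low-length true true h = case h refl of λ ()
  low-length false true h = trans (trans (cong length (τ^-++ j (true ∷ []) (false ∷ []))) (trans (length-++ (W j)) (trans (length-WV j) (sym (f-odd j))))) (sym (+-identityʳ _))
  low-length true false h = trans (sym (trans (cong f (+-identityʳ (2 * j))) (f-even j))) (sym (trans (+-identityʳ _) (+-identityʳ _)))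
  low-length false false h rewrite τ^-[] j = refl

-- After word n A the fixed point continues with the letter 1 precisely when the digit A 0 is 0.
next : ℕ → Digits → List Bool
next n A = word n A ++ not (A 0) ∷ []

-- If A 2 is 1, the next letter is 0 and τ(0) = 1 leaves no room for A 0 or A 1. Otherwise it is 1,
-- and the choices of A 0 and A 1 are the proper prefixes of 101 other than those excluded by
-- sparseness: the empty word, 1 and 10.
next-step : ∀ n A → Sparse A → ∃ λ z → τ (next n (tail₂ A)) ≡ next (suc n) A ++ z
next-step n A (adj , even) = step (A 0) (A 1) (A 2) (adj 0) (even 0) (adj 1)
  where
  X = word n (tail₂ A)
  split : ∀ l a c {z} → τ (c ∷ []) ≡ (l ++ not a ∷ []) ++ z → τ (X ++ c ∷ []) ≡ ((τ X ++ l) ++ not a ∷ []) ++ z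
  split l a c {z} e = trans (τ-++ X (c ∷ [])) (trans (cong (τ X ++_) e)
    (sym (trans (cong (_++ z) (++-assoc (τ X) l _)) (++-assoc (τ X) _ z))))
  step : ∀ a b c → (a ≡ true → b ≡ false) → (a ≡ true → c ≡ false) → (b ≡ true → c ≡ false) →
    ∃ λ z → τ (X ++ not c ∷ []) ≡ ((τ X ++ low a b) ++ not a ∷ []) ++ z
  step true true c ab ac bc = case ab refl of λ ()
  step true false true ab ac bc = case ac refl of λ ()
  step false true true ab ac bc = case bc refl of λ ()
  step true false false ab ac bc = true ∷ [] , split _ true true refl
  step false true false ab ac bc = [] , split _ false true refl
  step false false true ab ac bc = [] , split _ false false refl
  step false false false ab ac bc = false ∷ true ∷ [] , split _ false true refl

Prefix-next : ∀ n A → Sparse A → (∀ i → 2 * n ≤ i → A i ≡ false) → Prefix (next n A)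
Prefix-next zero A S fin rewrite fin 0 z≤n = 0 , [] , refl
Prefix-next (suc n) A S fin with z , eq ← next-step n A S =
  Prefix-++ (next (suc n) A) (subst Prefix eq (Prefix-τ (Prefix-next n (tail₂ A) (Sparse-tail₂ {A} S)
    (λ i le → fin (2 + i) (subst (_≤ 2 + i) (sym (lem n)) (s≤s (s≤s le)))))))
  where
  lem : ∀ n → 2 * suc n ≡ 2 + 2 * n
  lem = solveℕ-∀

tail₂^ : ℕ → Digits → Digits
tail₂^ zero A = A
tail₂^ (suc K) A = tail₂^ K (tail₂ A)

tail₂^-at : ∀ K A i → tail₂^ K A i ≡ A (2 * K + i)
tail₂^-at zero A i = refl
tail₂^-at (suc K) A i = trans (tail₂^-at K (tail₂ A) i) (cong A (lem K i))
  where
  lem : ∀ K i → 2 + (2 * K + i) ≡ 2 * suc K + i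
  lem = solveℕ-∀

Sparse-tail₂^ : ∀ K {A} → Sparse A → Sparse (tail₂^ K A)
Sparse-tail₂^ zero S = S
Sparse-tail₂^ (suc K) {A} S = Sparse-tail₂^ K (Sparse-tail₂ {A} S)

next-τ^ : ∀ K n A → Sparse A → ∃ λ z → τ^ K (next n (tail₂^ K A)) ≡ next (K + n) A ++ z
next-τ^ zero n A S = [] , sym (++-identityʳ _)
next-τ^ (suc K) n A S with z , eq ← next-τ^ K n (tail₂ A) (Sparse-tail₂ {A} S) | z′ , eq′ ← next-step (K + n) A S =
  z′ ++ τ z , trans (cong τ eq) (trans (τ-++ (next (K + n) (tail₂ A)) z) (trans (cong (_++ τ z) eq′) (++-assoc (next (suc K + n) A) z′ (τ z))))

letter-beyond : ∀ w i → length w ≤ i → letter w i ≡ false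
letter-beyond [] i le = refl
letter-beyond (b ∷ w) (suc i) le = letter-beyond w i (s≤s⁻¹ le)

-- A number whose K lowest pairs of digits are split off lies in a block τ^K(1), or τ^K(10) if the next digit is 1.
locate : ∀ K a → Admissible a → ∃ λ Y → Prefix (Y ++ true ∷ []) ×
  value a ≡ total (2 * K + 1) (λ i → digit a i * f i) + length (τ^ K Y) ×
  (value a < length (τ^ K (Y ++ true ∷ [])) ⊎
    (Prefix (Y ++ true ∷ false ∷ []) × value a < length (τ^ K (Y ++ true ∷ false ∷ []))))
locate K a S = Y , Prefix-next (suc n) B° S° fin° , split , bound
  where
  n = length a
  A B B° : Digits
  A = letter a
  B = tail₂^ K A
  -- Digit 2K belongs to the truncated sum and is therefore removed from the address `Y` of the
  -- block; the letter after `Y` is then 1.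
  B° zero = false
  B° (suc i) = B (suc i)
  SB : Sparse B
  SB = Sparse-tail₂^ K {A} S
  S° : Sparse B°
  S° = adj , even
    where
    adj : ∀ i → B° i ≡ true → B° (suc i) ≡ false
    adj (suc i) e = proj₁ SB (suc i) e
    even : ∀ j → B° (2 * j) ≡ true → B° (2 + 2 * j) ≡ false
    even (suc j) e = proj₂ SB (suc j) e
  fin : ∀ i → 2 * suc n ≤ i → B i ≡ false
  fin i le = trans (tail₂^-at K A i) (letter-beyond a _ (≤-trans (≤-trans (n≤1+n n) (m≤m+n (suc n) _)) (≤-trans le (m≤n+m i (2 * K)))))
  fin° : ∀ i → 2 * suc n ≤ i → B° i ≡ false
  fin° zero le = refl
  fin° (suc i) le = fin (suc i) le
  Y = word (suc n) B°
  g : ℕ → ℕ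
  g i = digit a i * f i
  value-total : ∀ e → total (length a + e) g ≡ value a
  value-total e = trans (total-+ (length a) e g) (trans (cong (total (length a) g +_)
    (total-0 e (λ i → cong (λ b → val b * f (length a + i)) (letter-beyond a (length a + i) (m≤m+n _ i)))))
    (trans (+-identityʳ _) (sym (sum-upTo (length a) g))))
  split : value a ≡ total (2 * K + 1) g + length (τ^ K Y)
  split = begin
    value a                                                         ≡⟨ sym (value-total (2 * K + suc (suc n))) ⟩
    total (n + (2 * K + suc (suc n))) g                             ≡⟨ cong (λ z → total z g) (lem K n) ⟩
    total ((2 * K + 1) + r) g                                       ≡⟨ total-+ (2 * K + 1) r g ⟩
    total (2 * K + 1) g + total r (λ i → g (2 * K + 1 + i))          ≡⟨ cong (total (2 * K + 1) g +_) (trans (total-cong r digits) (sym (length-word (suc n) K B° S°))) ⟩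
    total (2 * K + 1) g + length (τ^ K Y) ∎
    where
    open ≡-Reasoning
    -- One less than `2 * suc n`, in the form to which that reduces: digit 0 of `B°` contributes 0.
    r = n + (suc n + 0)
    lem : ∀ K n → n + (2 * K + suc (suc n)) ≡ (2 * K + 1) + (n + (suc n + 0))
    lem = solveℕ-∀
    digits : ∀ i → g (2 * K + 1 + i) ≡ val (B (suc i)) * f (2 * K + suc i)
    digits i = trans (cong g (+-assoc (2 * K) 1 i)) (cong (λ b → val b * f (2 * K + suc i)) (sym (tail₂^-at K A (suc i))))
  below : value a < length (τ^ K (next (suc n) B))
  below with z , eq ← next-τ^ K (suc n) A S = begin-strict
    value a                                ≡⟨ sym (value-total (2 * K + suc (suc n))) ⟩
    total (n + (2 * K + suc (suc n))) g    ≡⟨ cong (λ z → total z g) (lem K n) ⟩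
    total (2 * (K + suc n)) g              ≡⟨ sym (length-word (K + suc n) 0 A S) ⟩
    length (word (K + suc n) A)            <⟨ m<m+n _ z<s ⟩
    length (word (K + suc n) A) + length (not (A 0) ∷ [])  ≡⟨ sym (length-++ (word (K + suc n) A)) ⟩
    length (next (K + suc n) A)            ≤⟨ m≤m+n _ (length z) ⟩
    length (next (K + suc n) A) + length z ≡⟨ sym (length-++ (next (K + suc n) A)) ⟩
    length (next (K + suc n) A ++ z)       ≡⟨ cong length (sym eq) ⟩
    length (τ^ K (next (suc n) B)) ∎
    where
    open ≤-Reasoning
    lem : ∀ K n → n + (2 * K + suc (suc n)) ≡ 2 * (K + suc n)
    lem = solveℕ-∀
  bound : value a < length (τ^ K (Y ++ true ∷ [])) ⊎
    (Prefix (Y ++ true ∷ false ∷ []) × value a < length (τ^ K (Y ++ true ∷ false ∷ [])))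
  bound with B 0 in B0
  ... | false = inj₁ (subst (λ w → value a < length (τ^ K w)) eq below)
    where
    eq : next (suc n) B ≡ Y ++ true ∷ []
    eq rewrite B0 = refl
  -- Digit 2K accounts for the block τ^K(1) after `Y`, so the number lies in the τ^K(0) that follows
  -- it.
  ... | true = inj₂ (subst Prefix eq (Prefix-next (suc n) B SB fin) , subst (λ w → value a < length (τ^ K w)) eq below)
    where
    eq : next (suc n) B ≡ Y ++ true ∷ false ∷ []
    eq rewrite B0 | proj₁ SB 0 B0 = trans (++-assoc (τ (word n (tail₂ B))) _ _) (sym (++-assoc (τ (word n (tail₂ B))) [] _))

-- If the starts differ, one range ends before the other begins, unless the block after `Y` starts
-- at the 0 of the factor 10 after `Z`. The letter after `Y` is 1, which rules this out (`clash`).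
block-unique : ∀ K {Y Z} v → Prefix (Y ++ true ∷ []) → length (τ^ K Y) ≤ v → v < length (τ^ K (Y ++ true ∷ [])) →
  Prefix (Z ++ true ∷ []) → length (τ^ K Z) ≤ v →
  (v < length (τ^ K (Z ++ true ∷ [])) ⊎ (Prefix (Z ++ true ∷ false ∷ []) × v < length (τ^ K (Z ++ true ∷ false ∷ [])))) →
  Y ≡ Z
block-unique K {Y} {Z} v PY Y≤v v<Y PZ Z≤v v<Z = unique
  where
  PY′ : Prefix Y
  PY′ = Prefix-++ Y PY
  PZ′ : Prefix Z
  PZ′ = Prefix-++ Z PZ
  length-∷ʳ : ∀ w (c : List Bool) → length (w ++ c) ≡ length c + length w
  length-∷ʳ w c = trans (length-++ w) (+-comm (length w) (length c))
  beyond : ∀ {w w′} → Prefix w → Prefix w′ → length w ≤ length w′ → length (τ^ K w) ≤ length (τ^ K w′)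
  beyond {w} P P′ le with z , refl ← Prefix-compare P P′ le = subst (length (τ^ K w) ≤_)
    (trans (sym (length-++ (τ^ K w))) (cong length (sym (τ^-++ K w z)))) (m≤m+n _ _)
  equal : length Y ≡ length Z → Y ≡ Z
  equal eq with Prefix-compare PY′ PZ′ (≤-reflexive eq)
  ... | [] , e = sym (trans e (++-identityʳ Y))
  ... | c ∷ z , refl = contradiction (trans eq (length-++ Y)) (<⇒≢ (m<m+n (length Y) z<s))
  clash : Prefix (Z ++ true ∷ false ∷ []) → length Y ≡ suc (length Z) → ⊥
  clash PZ₂ eq with Prefix-compare PY PZ₂ (≤-reflexive (trans (length-∷ʳ Y (true ∷ [])) (trans (cong suc eq) (sym (length-∷ʳ Z (true ∷ false ∷ []))))))
  ... | z , e = case trans (sym at-Z) at-Y of λ ()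
    where
    at-Z : letter (Z ++ true ∷ false ∷ []) (length Y) ≡ false
    at-Z = trans (cong (letter (Z ++ true ∷ false ∷ [])) (trans eq (+-comm 1 (length Z)))) (letter-++ʳ Z _ 1)
    at-Y : letter (Z ++ true ∷ false ∷ []) (length Y) ≡ true
    at-Y = trans (cong (λ w → letter w (length Y)) (trans e (++-assoc Y (true ∷ []) z))) (trans (cong (letter (Y ++ true ∷ z)) (sym (+-identityʳ (length Y)))) (letter-++ʳ Y _ 0))
  unique : Y ≡ Z
  unique with <-cmp (length Y) (length Z)
  ... | tri≈ _ eq _ = equal eq
  ... | tri< Y<Z _ _ = contradiction (≤-trans (beyond PY PZ′ (subst (_≤ length Z) (sym (length-∷ʳ Y (true ∷ []))) Y<Z)) Z≤v) (<⇒≱ v<Y)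
  ... | tri> _ _ Z<Y = contradiction v<Z λ
    { (inj₁ lt) → contradiction (≤-trans (beyond PZ PY′ (subst (_≤ length Y) (sym (length-∷ʳ Z (true ∷ []))) Z<Y)) Y≤v) (<⇒≱ lt)
    ; (inj₂ (PZ₂ , lt)) → case 2 + length Z ≤? length Y of λ
      { (yes le) → contradiction (≤-trans (beyond PZ₂ PY′ (subst (_≤ length Y) (sym (length-∷ʳ Z (true ∷ false ∷ []))) le)) Y≤v) (<⇒≱ lt)
      ; (no ≰) → clash PZ₂ (≤-antisym (s≤s⁻¹ (≰⇒> ≰)) Z<Y) } }

-- Hankel determinants of s near the centre of a block τ^(k+2)(1)

length-core : ∀ k → suc (suc (length (core k))) ≡ length (W k) + length (W (suc k))
length-core k = begin
  suc (suc (length (core k)))                         ≡⟨ cong (suc ∘ suc) (trans (length-++ (suf k)) (cong₂ _+_ (sym (length-pre-suf k)) (trans (length-++ (W k)) (cong (length (W k) +_) (length-++ (W k)))))) ⟩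
  suc (suc (length (pre k) + (length (W k) + (length (W k) + length (pre k))))) ≡⟨ lem₁ (length (pre k)) (length (W k)) ⟩
  length (W k) + (length (W k) + (p k + p k))         ≡⟨ cong (λ z → length (W k) + (length (W k) + z)) (trans (sym (length-WV k)) (+-comm (length (W k)) _)) ⟩
  length (W k) + (length (W k) + (length (V k) + length (W k))) ≡⟨ cong (length (W k) +_) (sym (length-W-suc k)) ⟩
  length (W k) + length (W (suc k)) ∎
  where
  open ≡-Reasoning
  lem₁ : ∀ u w → suc (suc (u + (w + (w + u)))) ≡ w + (w + (suc u + suc u))
  lem₁ = solveℕ-∀

-- `suf k` is a suffix of the period word, so the word occurs in the cube; d is the length of the
-- rest of the first period.
cyclic-core : ∀ k → ∃ λ d → ∀ i → i < length (suf k ++ (W k ++ W k)) → cyclic k (d + i) ≡ bit (letter (suf k ++ (W k ++ W k)) i)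
cyclic-core zero = 1 , cyclic-cube 0 (W 0) (suf 0 ++ (W 0 ++ W 0)) refl
cyclic-core (suc j) = length P , cyclic-cube (suc j) P _ (trans (cong (_++ (W (suc j) ++ W (suc j)))
   (trans (W-suc-form j) (sym (++-assoc (pre j) _ (suf (suc j)))))) (++-assoc P (suf (suc j)) _))
  where
  P = pre j ++ mid j ∷ not (mid j) ∷ []

gap-sgn : ∀ k → bit (mid k) -ℤ bit (not (mid k)) ≡ sgn k
gap-sgn zero = refl
gap-sgn (suc k) rewrite not-involutive (mid k) = trans (lem (bit (mid k)) (bit (not (mid k)))) (cong -_ (gap-sgn k))
  where
  lem : ∀ a b → b -ℤ a ≡ - (a -ℤ b)
  lem = solve-∀

-- The signs of `hankel-edge` for the mismatches `sgn k` on the left and `- sgn k` on the right,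
-- times the sign of the periodic determinant.
edgeSign : ℕ → ℕ → ℕ → ℤ
edgeSign k u v = stripSign (length (W k)) u *ℤ (sgn k ^ℤ u *ℤ (triSign (length (W k)) *ℤ (triSign v *ℤ (- sgn k) ^ℤ v)))

module Block (k : ℕ) (Y : List Bool) (P : Prefix (Y ++ true ∷ [])) where

  K q cl a₀ : ℕ
  K = suc (suc k)
  q = length (W k)
  cl = length (core k)
  -- The position of the left mismatch, the last letter before the first occurrence of `core k`.
  a₀ = length (τ^ K Y) + p k

  S : ℕ → ℤ
  S j = ℤ.+ s j

  private
    x y : Bool
    x = mid k
    y = not x
    Q₁ Q₂ : List Bool
    Q₁ = x ∷ y ∷ (core k ++ x ∷ y ∷ suf k ++ W k)
    Q₂ = y ∷ x ∷ (core k ++ y ∷ x ∷ suf k)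

    s-block : ∀ X Q → W K ≡ X ++ Q → ∀ i → i < length Q → S (length (τ^ K Y) + (length X + i)) ≡ bit (letter Q i)
    s-block X Q eq i i<Q = trans (s-prefix whole _ (subst₂ _<_ (trans (cong (_+ i) (length-++ (τ^ K Y))) (+-assoc (length (τ^ K Y)) (length X) i))
        (sym (length-++ (τ^ K Y ++ X))) (+-monoʳ-< (length (τ^ K Y ++ X)) i<Q)))
      (cong bit (trans (cong (letter ((τ^ K Y ++ X) ++ Q)) (trans (sym (+-assoc (length (τ^ K Y)) (length X) i)) (cong (_+ i) (sym (length-++ (τ^ K Y))))))
        (letter-++ʳ (τ^ K Y ++ X) Q i)))
      where
      whole : Prefix ((τ^ K Y ++ X) ++ Q)
      whole = subst Prefix (trans (τ^-++ K Y (true ∷ [])) (trans (cong (τ^ K Y ++_) eq) (sym (++-assoc (τ^ K Y) X Q)))) (Prefix-τ^ K P)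

    at₁ : ∀ i → suc i < length Q₁ → S (a₀ + i) ≡ bit (letter Q₁ (suc i))
    at₁ i lt = trans (cong S (lem (length (τ^ K Y)) (length (pre k)) i)) (s-block (pre k) Q₁ (W-core k) (suc i) lt)
      where
      lem : ∀ b u i → b + suc u + i ≡ b + (u + suc i)
      lem = solveℕ-∀

    at₂ : ∀ i → suc i < length Q₂ → S (a₀ + i + q) ≡ bit (letter Q₂ (suc i))
    at₂ i lt = trans (cong S (trans (lem (length (τ^ K Y)) (length (pre k)) i q) (cong (λ z → length (τ^ K Y) + (z + suc i)) (sym (length-++ (W k))))))
      (s-block (W k ++ pre k) Q₂ (trans (W-core-shifted k) (sym (++-assoc (W k) (pre k) Q₂))) (suc i) lt)
      where
      lem : ∀ b u i q → b + suc u + i + q ≡ b + (q + u + suc i)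
      lem = solveℕ-∀

    length-Q : ∀ a b c d Z → 4 + cl ≤ length (a ∷ b ∷ (core k ++ c ∷ d ∷ Z))
    length-Q a b c d Z = s≤s (s≤s (subst (2 + cl ≤_) (trans (lem cl (length Z)) (sym (length-++ (core k)))) (m≤m+n (2 + cl) (length Z))))
      where
      lem : ∀ c z → 2 + c + z ≡ c + suc (suc z)
      lem = solveℕ-∀

    δ-at : ∀ i → i < 3 + cl → δ q S (a₀ + i) ≡ bit (letter Q₂ (suc i)) -ℤ bit (letter Q₁ (suc i))
    δ-at i lt = cong₂ _-ℤ_ (at₂ i (<-≤-trans (s<s lt) (length-Q y x y x _))) (at₁ i (<-≤-trans (s<s lt) (length-Q x y x y _)))

  δ-first : δ q S a₀ ≡ sgn k
  δ-first = trans (cong (δ q S) (sym (+-identityʳ a₀))) (trans (δ-at 0 z<s) (gap-sgn k))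

  δ-zero : ∀ i → i < cl → δ q S (suc a₀ + i) ≡ 0ℤ
  δ-zero i i<cl = trans (cong (δ q S) (sym (+-suc a₀ i))) (trans (δ-at (suc i) (s<s (m≤n⇒m≤1+n (m≤n⇒m≤1+n i<cl))))
    (trans (cong₂ (λ a b → bit a -ℤ bit b) (letter-++ˡ (core k) _ i i<cl) (letter-++ˡ (core k) _ i i<cl)) (ℤP.+-inverseʳ (bit (letter (core k) i)))))

  δ-last : δ q S (suc a₀ + cl) ≡ - sgn k
  δ-last = trans (cong (δ q S) (trans (sym (+-suc a₀ cl)) (cong (λ z → a₀ + suc z) (sym (+-identityʳ cl))))) (trans
    (δ-at (suc (cl + 0)) (s≤s (s≤s (≤-trans (≤-reflexive (+-identityʳ cl)) (n≤1+n cl))))) (trans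
    (cong₂ (λ a b → bit a -ℤ bit b) (letter-++ʳ (core k) _ 0) (letter-++ʳ (core k) _ 0)) (trans (lem (bit x) (bit y)) (cong -_ (gap-sgn k)))))
    where
    lem : ∀ a b → b -ℤ a ≡ - (a -ℤ b)
    lem = solve-∀

  -- Only the first q letters are compared with the periodic sequence; the vanishing differences
  -- carry the agreement on in steps of q.
  run : ∃ λ d → ∀ i → i < cl + q → S (suc a₀ + i) ≡ cyclic k (d + i)
  run with d , e ← cyclic-core k = d , λ i → go (suc i) i ≤-refl
    where
    base : ∀ i → i < q → S (suc a₀ + i) ≡ cyclic k (d + i)
    base i i<q = trans (cong S (sym (+-suc a₀ i))) (trans (at₁ (suc i) (<-≤-trans (s<s (s<s (m≤n⇒m≤1+n (m≤n⇒m≤1+n i<cl)))) (length-Q x y x y _)))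
      (trans (cong bit (trans (letter-++ˡ (core k) _ i i<cl) (trans (cong (λ w → letter w i) regroup) (letter-++ˡ (suf k ++ (W k ++ W k)) (pre k) i i<l)))) (sym (e i i<l))))
      where
      regroup : core k ≡ (suf k ++ (W k ++ W k)) ++ pre k
      regroup = trans (cong (suf k ++_) (sym (++-assoc (W k) (W k) (pre k)))) (sym (++-assoc (suf k) _ (pre k)))
      i<l : i < length (suf k ++ (W k ++ W k))
      i<l = <-≤-trans i<q (≤-trans (m≤m+n q q) (≤-trans (m≤n+m (q + q) (length (suf k))) (≤-reflexive (sym (trans (length-++ (suf k)) (cong (length (suf k) +_) (length-++ (W k))))))))
      i<cl : i < cl
      i<cl = <-≤-trans i<l (subst (length (suf k ++ (W k ++ W k)) ≤_) (sym (trans (cong length regroup) (length-++ (suf k ++ (W k ++ W k))))) (m≤m+n _ _))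
    go : ∀ n i → i < n → i < cl + q → S (suc a₀ + i) ≡ cyclic k (d + i)
    go (suc n) i i<n lt with i <? q
    ... | yes i<q = base i i<q
    ... | no i≮q with o , eq ← m≤n⇒∃[o]m+o≡n (≮⇒≥ i≮q) = begin
      S (suc a₀ + i)                ≡⟨ cong S (trans (cong (suc a₀ +_) (trans (sym eq) (+-comm q o))) (sym (+-assoc (suc a₀) o q))) ⟩
      S (suc a₀ + o + q)            ≡⟨ ℤP.i-j≡0⇒i≡j _ _ (δ-zero o o<cl) ⟩
      S (suc a₀ + o)                ≡⟨ go n o (<-≤-trans o<i (s≤s⁻¹ i<n)) (<-trans o<i lt) ⟩
      cyclic k (d + o)              ≡⟨ sym (cyclic-periodic k (d + o)) ⟩
      cyclic k (d + o + suc (half k + half k)) ≡⟨ cong (cyclic k) (trans (+-assoc d o _) (cong (d +_) (trans (cong (o +_) (sym (length-W k))) (trans (+-comm o q) eq)))) ⟩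
      cyclic k (d + i) ∎
      where
      open ≡-Reasoning
      o<cl : o < cl
      o<cl = +-cancelˡ-< q o cl (subst₂ _<_ (sym eq) (+-comm cl q) lt)
      o<i : o < i
      o<i = subst (o <_) eq (m<n+m o (≤-trans z<s (≤-reflexive (sym (length-W k)))))

  1≤q : 1 ≤ q
  1≤q = subst (1 ≤_) (sym (length-W k)) z<s

  inner : ∀ o → o + q ≤ suc cl → D q (hankel S (suc a₀ + o)) ≡ triSign q *ℤ ℤ.+ p k
  inner o le with d , e ← run = trans (D-cong q eq) (D-cyclic k (d + o))
    where
    eq : ∀ i j → i < q → j < q → hankel S (suc a₀ + o) i j ≡ hankel (cyclic k) (d + o) i j
    eq i j i<q j<q = trans (cong S (lem (suc a₀) o i j)) (trans (e (o + i + j) bound) (cong (cyclic k) (sym (lem d o i j))))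
      where
      lem : ∀ a o i j → a + o + i + j ≡ a + (o + i + j)
      lem = solveℕ-∀
      lem₂ : ∀ o i j → o + suc i + suc j ≡ suc (suc (o + i + j))
      lem₂ = solveℕ-∀
      bound : o + i + j < cl + q
      bound = s≤s⁻¹ (subst (_≤ suc (cl + q)) (lem₂ o i j) (+-mono-≤ (≤-trans (+-monoʳ-≤ o i<q) le) j<q))

  -- o is the distance from the first zero difference to index m+u. The last two hypotheses require
  -- a window with u > 0 to meet the left mismatch and one with v > 0 to meet the right one. All
  -- four sides of the tile are instances.
  edge : ∀ m u v o → m + u ≡ suc a₀ + o → o + (q + (u + v)) ≤ suc cl →
    (∀ u′ → u ≡ suc u′ → o ≡ 0) → (∀ v′ → v ≡ suc v′ → o + (q + (u + v)) ≡ suc cl) →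
    D (q + (u + v)) (hankel S m) ≡ edgeSign k u v *ℤ ℤ.+ p k
  edge m u v o eq le left right = trans (hankel-edge q u v S m (sgn k) (- sgn k) 1≤q hz hl hr)
    (trans (cong (λ z → stripSign q u *ℤ (sgn k ^ℤ u *ℤ (z *ℤ (triSign v *ℤ (- sgn k) ^ℤ v)))) (trans (cong (λ z → D q (hankel S z)) eq) (inner o o+q≤)))
      (lem (stripSign q u) (sgn k ^ℤ u) (triSign q) (ℤ.+ p k) (triSign v) ((- sgn k) ^ℤ v)))
    where
    lem : ∀ a b c d e f → a *ℤ (b *ℤ (c *ℤ d *ℤ (e *ℤ f))) ≡ a *ℤ (b *ℤ (c *ℤ (e *ℤ f))) *ℤ d
    lem = solve-∀
    o+q≤ : o + q ≤ suc cl
    o+q≤ = ≤-trans (+-monoʳ-≤ o (m≤m+n q (u + v))) le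
    hz : ∀ j → suc j < q + (u + v) → δ q S (m + u + j) ≡ 0ℤ
    hz j lt = trans (cong (δ q S) (trans (cong (_+ j) eq) (+-assoc (suc a₀) o j))) (δ-zero (o + j)
      (s≤s⁻¹ (≤-trans (subst (_≤ o + (q + (u + v))) (trans (+-suc o (suc j)) (cong suc (+-suc o j))) (+-monoʳ-≤ o lt)) le)))
    hl : ∀ u′ → u ≡ suc u′ → δ q S (m + u′) ≡ sgn k
    hl u′ refl with refl ← left u′ refl = trans (cong (δ q S) (suc-injective (trans (sym (+-suc m u′)) (trans eq (+-identityʳ (suc a₀)))))) δ-first
    hr : ∀ v′ → v ≡ suc v′ → δ q S (m + u + (q + (u + v′))) ≡ - sgn k
    hr v′ refl = trans (cong (δ q S) (trans (cong (_+ (q + (u + v′))) eq) (trans (+-assoc (suc a₀) o _) (cong (suc a₀ +_)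
      (suc-injective (trans (lem₂ o q u v′) (right v′ refl))))))) δ-last
      where
      lem₂ : ∀ o q u v → suc (o + (q + (u + v))) ≡ o + (q + (u + suc v))
      lem₂ = solveℕ-∀

  -- If m is inside the run, column q is zero. Otherwise the column that starts with the first zero
  -- difference is; the lower bound on m + n ensures that it is one of the r difference columns.
  vanish : ∀ m r → 0 < r → suc a₀ + q < m + (q + r) → m + (q + r) < suc (suc a₀ + cl) → q + r < suc cl → D (q + r) (hankel S m) ≡ 0ℤ
  vanish m r 0<r lower upper small with suc a₀ ≤? m
  ... | yes le with o , refl ← m≤n⇒∃[o]m+o≡n le = hankel-vanishes q r S m 0 1≤q 0<r (λ i i<n →
        trans (cong (δ q S) (lem a₀ o i)) (δ-zero (o + i) (<-≤-trans (+-monoʳ-< o i<n)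
          (+-cancelˡ-≤ (suc a₀) _ _ (s≤s⁻¹ (subst (_< suc (suc a₀ + cl)) (+-assoc (suc a₀) o (q + r)) upper))))))
    where
    lem : ∀ a o i → suc a + o + 0 + i ≡ suc a + (o + i)
    lem = solveℕ-∀
  ... | no ≰ with o , eq ← m≤n⇒∃[o]m+o≡n (<⇒≤ (≰⇒> ≰)) = hankel-vanishes q r S m o 1≤q
        (+-cancelˡ-< (m + q) o r (subst₂ _<_ (trans (cong (_+ q) (sym eq)) (lem m o q)) (sym (+-assoc m q r)) lower))
        (λ i i<n → trans (cong (λ z → δ q S (z + i)) eq) (δ-zero i (<-≤-trans i<n (s≤s⁻¹ small))))
    where
    lem : ∀ m o q → m + o + q ≡ m + q + o
    lem = solveℕ-∀

-- Signs

sgn-+ : ∀ a b → sgn (a + b) ≡ sgn a *ℤ sgn b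
sgn-+ zero b = sym (ℤP.*-identityˡ _)
sgn-+ (suc a) b = trans (cong -_ (sgn-+ a b)) (ℤP.neg-distribˡ-* (sgn a) (sgn b))

sgn-² : ∀ a → sgn a *ℤ sgn a ≡ 1ℤ
sgn-² a = trans (sym (sgn-+ a a)) (sgn-double a)

sgn-^ : ∀ a n → sgn a ^ℤ n ≡ sgn (a * n)
sgn-^ a zero = cong sgn (sym (*-zeroʳ a))
sgn-^ a (suc n) = trans (cong (sgn a *ℤ_) (sgn-^ a n)) (trans (sym (sgn-+ a (a * n))) (cong sgn (sym (*-suc a n))))

sgn-*-self : ∀ a → sgn (a * a) ≡ sgn a
sgn-*-self zero = refl
sgn-*-self (suc a) = trans (cong sgn (lem a)) (trans (cong -_ (sgn-+ (a * a) (a + a)))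
  (cong -_ (trans (cong₂ _*ℤ_ (sgn-*-self a) (sgn-double a)) (ℤP.*-identityʳ (sgn a)))))
  where
  lem : ∀ a → suc a * suc a ≡ suc (a * a + (a + a))
  lem = solveℕ-∀

-- a and b have the same parity, hence ab has the parity of a².
sgn-*-even : ∀ a b G → a + b ≡ G + G → sgn (a * b) ≡ sgn a
sgn-*-even a b G eq = begin
  sgn (a * b)                                ≡⟨ sym (ℤP.*-identityʳ _) ⟩
  sgn (a * b) *ℤ 1ℤ                          ≡⟨ cong (sgn (a * b) *ℤ_) (sym (sgn-² (a * a))) ⟩
  sgn (a * b) *ℤ (sgn (a * a) *ℤ sgn (a * a)) ≡⟨ sym (ℤP.*-assoc (sgn (a * b)) _ _) ⟩
  sgn (a * b) *ℤ sgn (a * a) *ℤ sgn (a * a)  ≡⟨ cong₂ _*ℤ_ (trans (sym (sgn-+ (a * b) (a * a))) (trans (cong sgn (trans (lem a b) (trans (cong (a *_) eq) (*-distribˡ-+ a G G)))) (sgn-double (a * G)))) (sgn-*-self a) ⟩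
  1ℤ *ℤ sgn a                                ≡⟨ ℤP.*-identityˡ (sgn a) ⟩
  sgn a ∎
  where
  open ≡-Reasoning
  lem : ∀ a b → a * b + a * a ≡ a * (a + b)
  lem = solveℕ-∀

-- A reversal of a + b places reverses both parts and exchanges them, which costs ab transpositions.
triSign-+ : ∀ a b → triSign (a + b) ≡ triSign a *ℤ triSign b *ℤ sgn (a * b)
triSign-+ zero b = lem (triSign b)
  where
  lem : ∀ t → t ≡ 1ℤ *ℤ t *ℤ 1ℤ
  lem = solve-∀
triSign-+ (suc a) b = trans (cong₂ _*ℤ_ (sgn-+ a b) (triSign-+ a b)) (trans (lem (sgn a) (sgn b) (triSign a) (triSign b) (sgn (a * b)))
  (cong (sgn a *ℤ triSign a *ℤ triSign b *ℤ_) (sym (sgn-+ b (a * b)))))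
  where
  lem : ∀ a b t r s → a *ℤ b *ℤ (t *ℤ r *ℤ s) ≡ a *ℤ t *ℤ r *ℤ (b *ℤ s)
  lem = solve-∀

triSign-² : ∀ a → triSign a *ℤ triSign a ≡ 1ℤ
triSign-² zero = refl
triSign-² (suc a) = trans (lem (sgn a) (triSign a)) (trans (cong₂ _*ℤ_ (sgn-² a) (triSign-² a)) refl)
  where
  lem : ∀ a t → a *ℤ t *ℤ (a *ℤ t) ≡ a *ℤ a *ℤ (t *ℤ t)
  lem = solve-∀

triSign-double : ∀ a → triSign (a + a) ≡ sgn a
triSign-double a = trans (triSign-+ a a) (trans (cong₂ _*ℤ_ (triSign-² a) (sgn-*-self a)) (ℤP.*-identityˡ _))

triSign-complement : ∀ a b G → a + b ≡ G + G → triSign a ≡ sgn G *ℤ sgn a *ℤ triSign b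
triSign-complement a b G eq = begin
  triSign a                                                       ≡⟨ lem₁ (triSign a) ⟩
  triSign a *ℤ 1ℤ *ℤ 1ℤ                                            ≡⟨ cong₂ (λ x y → triSign a *ℤ x *ℤ y) (sym (triSign-² b)) (sym (sgn-² (a * b))) ⟩
  triSign a *ℤ (triSign b *ℤ triSign b) *ℤ (sgn (a * b) *ℤ sgn (a * b)) ≡⟨ lem₂ (triSign a) (triSign b) (sgn (a * b)) ⟩
  triSign a *ℤ triSign b *ℤ sgn (a * b) *ℤ sgn (a * b) *ℤ triSign b    ≡⟨ cong₂ (λ x y → x *ℤ y *ℤ triSign b) (trans (sym (triSign-+ a b)) (trans (cong triSign eq) (triSign-double G))) (sgn-*-even a b G eq) ⟩
  sgn G *ℤ sgn a *ℤ triSign b ∎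
  where
  open ≡-Reasoning
  lem₁ : ∀ x → x ≡ x *ℤ 1ℤ *ℤ 1ℤ
  lem₁ = solve-∀
  lem₂ : ∀ a b s → a *ℤ (b *ℤ b) *ℤ (s *ℤ s) ≡ a *ℤ b *ℤ s *ℤ s *ℤ b
  lem₂ = solve-∀

stripSign-odd : ∀ h u → stripSign (suc (h + h)) u ≡ sgn u *ℤ triSign u
stripSign-odd h zero = refl
stripSign-odd h (suc u) = cong₂ _*ℤ_ (cong -_ (trans (sgn-+ (h + h) u) (trans (cong (_*ℤ sgn u) (sgn-double h)) (ℤP.*-identityˡ _)))) (stripSign-odd h u)

-- `p` grows by the odd number |W k|, so its parity alternates.
sgn-p : ∀ k → sgn (p k) ≡ - sgn k
sgn-p zero = refl
sgn-p (suc k) = begin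
  sgn (p (suc k))                    ≡⟨ cong sgn (p-suc k) ⟩
  sgn (length (W k) + p k)           ≡⟨ sgn-+ (length (W k)) (p k) ⟩
  sgn (length (W k)) *ℤ sgn (p k)    ≡⟨ cong₂ _*ℤ_ (trans (cong sgn (length-W k)) (cong -_ (sgn-double (half k)))) (sgn-p k) ⟩
  - 1ℤ *ℤ - sgn k                    ≡⟨ ℤP.-1*i≡-i (- sgn k) ⟩
  - - sgn k ∎
  where open ≡-Reasoning

p-half : ∀ k → p (suc k) ≡ suc (half k + half (suc k))
p-half k = *-cancelʳ-≡ (p (suc k)) _ 2 (begin
  p (suc k) * 2                              ≡⟨ lem₁ (p (suc k)) ⟩
  p (suc k) + p (suc k)                      ≡⟨ sym (length-WV (suc k)) ⟩
  length (W (suc k)) + length (V (suc k))    ≡⟨ cong₂ _+_ (length-W (suc k)) (trans (cong length (V-suc k)) (length-W k)) ⟩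
  suc (half (suc k) + half (suc k)) + suc (half k + half k) ≡⟨ lem₂ (half (suc k)) (half k) ⟩
  suc (half k + half (suc k)) * 2 ∎)
  where
  open ≡-Reasoning
  lem₁ : ∀ a → a * 2 ≡ a + a
  lem₁ = solveℕ-∀
  lem₂ : ∀ a b → suc (a + a) + suc (b + b) ≡ suc (b + a) * 2
  lem₂ = solveℕ-∀

-- The periodic determinant yields the parity of (f(2k) - 1)/2, the theorem asks for that of
-- (f(2k+2) - 1)/2. Their sum is one less than `p (suc k)`, whose parity is known.
sgn-half : ∀ k → sgn (half k) ≡ - (sgn k *ℤ sgn (half (suc k)))
sgn-half k = begin
  sgn h                          ≡⟨ sym (ℤP.*-identityʳ _) ⟩
  sgn h *ℤ 1ℤ                    ≡⟨ cong (sgn h *ℤ_) (sym (sgn-² G)) ⟩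
  sgn h *ℤ (sgn G *ℤ sgn G)      ≡⟨ lem₁ (sgn h) (sgn G) ⟩
  - (- (sgn h *ℤ sgn G) *ℤ sgn G) ≡⟨ cong (λ z → - (z *ℤ sgn G)) (trans (cong -_ (sym (sgn-+ h G))) (trans (cong sgn (sym (p-half k))) (trans (sgn-p (suc k)) (ℤP.neg-involutive _)))) ⟩
  - (sgn k *ℤ sgn G) ∎
  where
  open ≡-Reasoning
  h = half k
  G = half (suc k)
  lem₁ : ∀ a b → a *ℤ (b *ℤ b) ≡ - (- (a *ℤ b) *ℤ b)
  lem₁ = solve-∀

-- Since q is odd, u and v enter symmetrically; hence both slanted sides carry the same sign.
edgeSign-form : ∀ k u v → edgeSign k u v ≡ sgn u *ℤ triSign u *ℤ (sgn (k * (u + v)) *ℤ (sgn (half k) *ℤ (triSign v *ℤ sgn v)))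
edgeSign-form k u v = begin
  edgeSign k u v
    ≡⟨ cong₂ (λ a b → a *ℤ (sgn k ^ℤ u *ℤ (b *ℤ (triSign v *ℤ (- sgn k) ^ℤ v)))) (trans (cong (λ q → stripSign q u) (length-W k)) (stripSign-odd (half k) u)) tri-q ⟩
  sgn u *ℤ triSign u *ℤ (sgn k ^ℤ u *ℤ (sgn (half k) *ℤ (triSign v *ℤ (- sgn k) ^ℤ v)))
    ≡⟨ cong₂ (λ a b → sgn u *ℤ triSign u *ℤ (a *ℤ (sgn (half k) *ℤ (triSign v *ℤ b)))) (sgn-^ k u) (trans (sgn-^ (suc k) v) (sgn-+ v (k * v))) ⟩
  sgn u *ℤ triSign u *ℤ (sgn (k * u) *ℤ (sgn (half k) *ℤ (triSign v *ℤ (sgn v *ℤ sgn (k * v)))))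
    ≡⟨ lem (sgn u *ℤ triSign u) (sgn (k * u)) (sgn (half k)) (triSign v) (sgn v) (sgn (k * v)) ⟩
  sgn u *ℤ triSign u *ℤ (sgn (k * u) *ℤ sgn (k * v) *ℤ (sgn (half k) *ℤ (triSign v *ℤ sgn v)))
    ≡⟨ cong (λ z → sgn u *ℤ triSign u *ℤ (z *ℤ (sgn (half k) *ℤ (triSign v *ℤ sgn v)))) (trans (sym (sgn-+ (k * u) (k * v))) (cong sgn (sym (*-distribˡ-+ k u v)))) ⟩
  _ ∎
  where
  open ≡-Reasoning
  lem : ∀ a b c d e f → a *ℤ (b *ℤ (c *ℤ (d *ℤ (e *ℤ f)))) ≡ a *ℤ (b *ℤ f *ℤ (c *ℤ (d *ℤ e)))
  lem = solve-∀
  tri-q : triSign (length (W k)) ≡ sgn (half k)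
  tri-q = trans (cong triSign (length-W k)) (trans (cong₂ _*ℤ_ (sgn-double (half k)) (triSign-double (half k))) (ℤP.*-identityˡ _))

edgeSign-bottom : ∀ k → edgeSign k 0 0 ≡ sgn (suc k) *ℤ sgn (half (suc k))
edgeSign-bottom k = begin
  edgeSign k 0 0                                      ≡⟨ edgeSign-form k 0 0 ⟩
  1ℤ *ℤ (sgn (k * 0) *ℤ (sgn (half k) *ℤ 1ℤ))         ≡⟨ cong₂ (λ a b → 1ℤ *ℤ (a *ℤ (b *ℤ 1ℤ))) (cong sgn (*-zeroʳ k)) (sgn-half k) ⟩
  1ℤ *ℤ (1ℤ *ℤ (- (sgn k *ℤ sgn G) *ℤ 1ℤ))            ≡⟨ lem (sgn k) (sgn G) ⟩
  - sgn k *ℤ sgn G ∎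
  where
  open ≡-Reasoning
  G = half (suc k)
  lem : ∀ a b → 1ℤ *ℤ (1ℤ *ℤ (- (a *ℤ b) *ℤ 1ℤ)) ≡ - a *ℤ b
  lem = solve-∀

edgeSign-top : ∀ k u v → u + v ≡ half (suc k) + half (suc k) → edgeSign k u v ≡ sgn (suc k) *ℤ sgn u
edgeSign-top k u v eq = begin
  edgeSign k u v ≡⟨ edgeSign-form k u v ⟩
  sgn u *ℤ triSign u *ℤ (sgn (k * (u + v)) *ℤ (sgn (half k) *ℤ (triSign v *ℤ sgn v)))
    ≡⟨ cong₂ (λ a b → sgn u *ℤ a *ℤ (b *ℤ (sgn (half k) *ℤ (triSign v *ℤ sgn v)))) (triSign-complement u v G eq)
        (trans (cong (λ z → sgn (k * z)) eq) (trans (cong sgn (*-distribˡ-+ k G G)) (sgn-double (k * G)))) ⟩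
  sgn u *ℤ (sgn G *ℤ sgn u *ℤ triSign v) *ℤ (1ℤ *ℤ (sgn (half k) *ℤ (triSign v *ℤ sgn v)))
    ≡⟨ cong₂ (λ a b → sgn u *ℤ (sgn G *ℤ sgn u *ℤ triSign v) *ℤ (1ℤ *ℤ (a *ℤ (triSign v *ℤ b)))) (sgn-half k) sgn-v ⟩
  sgn u *ℤ (sgn G *ℤ sgn u *ℤ triSign v) *ℤ (1ℤ *ℤ (- (sgn k *ℤ sgn G) *ℤ (triSign v *ℤ sgn u)))
    ≡⟨ lem (sgn u) (sgn G) (triSign v) (sgn k) ⟩
  - sgn k *ℤ sgn u *ℤ ((sgn u *ℤ sgn u) *ℤ (sgn G *ℤ sgn G) *ℤ (triSign v *ℤ triSign v))
    ≡⟨ cong₂ (λ a b → - sgn k *ℤ sgn u *ℤ (a *ℤ b)) (cong₂ _*ℤ_ (sgn-² u) (sgn-² G)) (triSign-² v) ⟩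
  - sgn k *ℤ sgn u *ℤ 1ℤ ≡⟨ ℤP.*-identityʳ _ ⟩
  - sgn k *ℤ sgn u ∎
  where
  open ≡-Reasoning
  G = half (suc k)
  lem : ∀ u g t k → u *ℤ (g *ℤ u *ℤ t) *ℤ (1ℤ *ℤ (- (k *ℤ g) *ℤ (t *ℤ u))) ≡ - k *ℤ u *ℤ ((u *ℤ u) *ℤ (g *ℤ g) *ℤ (t *ℤ t))
  lem = solve-∀
  sgn-v : sgn v ≡ sgn u
  sgn-v = begin
    sgn v                     ≡⟨ sym (ℤP.*-identityˡ _) ⟩
    1ℤ *ℤ sgn v               ≡⟨ cong (_*ℤ sgn v) (sym (sgn-² u)) ⟩
    sgn u *ℤ sgn u *ℤ sgn v   ≡⟨ ℤP.*-assoc (sgn u) (sgn u) (sgn v) ⟩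
    sgn u *ℤ (sgn u *ℤ sgn v) ≡⟨ cong (sgn u *ℤ_) (trans (sym (sgn-+ u v)) (trans (cong sgn eq) (sgn-double G))) ⟩
    sgn u *ℤ 1ℤ               ≡⟨ ℤP.*-identityʳ _ ⟩
    sgn u ∎

-- The determinant depends on r = n - q, the claimed exponents on the distance w to the top row. As
-- r + w is even, `triSign-complement` converts one into the other.
edgeSign-side : ∀ k r w → r + w ≡ half (suc k) + half (suc k) →
  sgn r *ℤ triSign r *ℤ (sgn (k * r) *ℤ sgn (half k)) ≡ - (sgn (suc w * k) *ℤ triSign w)
edgeSign-side k r w eq = begin
  sgn r *ℤ triSign r *ℤ (sgn (k * r) *ℤ sgn (half k))
    ≡⟨ cong₂ (λ a b → sgn r *ℤ a *ℤ (sgn (k * r) *ℤ b)) (triSign-complement r w G eq) (sgn-half k) ⟩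
  sgn r *ℤ (sgn G *ℤ sgn r *ℤ triSign w) *ℤ (sgn (k * r) *ℤ - (sgn k *ℤ sgn G))
    ≡⟨ lem (sgn r) (sgn G) (triSign w) (sgn (k * r)) (sgn k) ⟩
  - (sgn k *ℤ sgn (k * r) *ℤ triSign w) *ℤ ((sgn r *ℤ sgn r) *ℤ (sgn G *ℤ sgn G))
    ≡⟨ cong₂ (λ a b → - (sgn k *ℤ a *ℤ triSign w) *ℤ b) same (cong₂ _*ℤ_ (sgn-² r) (sgn-² G)) ⟩
  - (sgn k *ℤ sgn (w * k) *ℤ triSign w) *ℤ 1ℤ ≡⟨ ℤP.*-identityʳ _ ⟩
  - (sgn k *ℤ sgn (w * k) *ℤ triSign w) ≡⟨ cong (λ z → - (z *ℤ triSign w)) (sym (sgn-+ k (w * k))) ⟩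
  - (sgn (suc w * k) *ℤ triSign w) ∎
  where
  open ≡-Reasoning
  G = half (suc k)
  lem : ∀ r g t x k → r *ℤ (g *ℤ r *ℤ t) *ℤ (x *ℤ - (k *ℤ g)) ≡ - (k *ℤ x *ℤ t) *ℤ ((r *ℤ r) *ℤ (g *ℤ g))
  lem = solve-∀
  lem₂ : ∀ k r w → k * r + w * k ≡ k * (r + w)
  lem₂ = solveℕ-∀
  same : sgn (k * r) ≡ sgn (w * k)
  same = begin
    sgn (k * r)                                  ≡⟨ sym (ℤP.*-identityʳ _) ⟩
    sgn (k * r) *ℤ 1ℤ                            ≡⟨ cong (sgn (k * r) *ℤ_) (sym (sgn-² (w * k))) ⟩
    sgn (k * r) *ℤ (sgn (w * k) *ℤ sgn (w * k))  ≡⟨ sym (ℤP.*-assoc (sgn (k * r)) _ _) ⟩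
    sgn (k * r) *ℤ sgn (w * k) *ℤ sgn (w * k)    ≡⟨ cong (_*ℤ sgn (w * k)) (trans (sym (sgn-+ (k * r) (w * k))) (trans (cong sgn (trans (lem₂ k r w) (trans (cong (k *_) eq) (*-distribˡ-+ k G G)))) (sgn-double (k * G)))) ⟩
    1ℤ *ℤ sgn (w * k)                            ≡⟨ ℤP.*-identityˡ _ ⟩
    sgn (w * k) ∎

edgeSign-left : ∀ k r w → r + w ≡ half (suc k) + half (suc k) → edgeSign k r 0 ≡ - (sgn (suc w * k) *ℤ triSign w)
edgeSign-left k r w eq = trans (edgeSign-form k r 0) (trans
  (cong₂ (λ a b → sgn r *ℤ triSign r *ℤ (sgn (k * a) *ℤ b)) (+-identityʳ r) (ℤP.*-identityʳ _)) (edgeSign-side k r w eq))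

edgeSign-right : ∀ k r w → r + w ≡ half (suc k) + half (suc k) → edgeSign k 0 r ≡ - (sgn (suc w * k) *ℤ triSign w)
edgeSign-right k r w eq = trans (edgeSign-form k 0 r) (trans (lem (sgn (k * r)) (sgn (half k)) (triSign r) (sgn r)) (edgeSign-side k r w eq))
  where
  lem : ∀ a b t r → 1ℤ *ℤ (a *ℤ (b *ℤ (t *ℤ r))) ≡ r *ℤ t *ℤ (a *ℤ b)
  lem = solve-∀

triangle : ℕ → ℕ
triangle zero = 0
triangle (suc n) = n + triangle n

sgn-triangle : ∀ n → sgn (n * (n ∸ 1) / 2) ≡ triSign n
sgn-triangle n = trans (cong sgn (trans (cong (_/ 2) (twice n)) (m*n/n≡m (triangle n) 2))) (go n)
  where
  twice : ∀ n → n * (n ∸ 1) ≡ triangle n * 2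
  twice zero = refl
  twice (suc zero) = refl
  twice (suc (suc n)) = trans (lem₁ n) (trans (cong (λ z → z + (n + 1) * 2) (twice (suc n))) (lem₂ n (triangle (suc n))))
    where
    lem₁ : ∀ n → suc (suc n) * suc n ≡ suc n * n + (n + 1) * 2
    lem₁ = solveℕ-∀
    lem₂ : ∀ n t → t * 2 + (n + 1) * 2 ≡ (suc n + t) * 2
    lem₂ = solveℕ-∀
  go : ∀ n → sgn (triangle n) ≡ triSign n
  go zero = refl
  go (suc n) = trans (sgn-+ n (triangle n)) (cong (sgn n *ℤ_) (go n))


-- Tiles in terms of positions in a block

p≤W : ∀ k → p k ≤ length (W k)
1≤W : ∀ k → 1 ≤ length (W k)
p-suc<W : ∀ k → p (suc k) < length (W (suc k))
1≤W k = subst (1 ≤_) (sym (length-W k)) z<s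
1≤V : ∀ k → 1 ≤ length (V k)
1≤V zero = z<s
1≤V (suc k) = subst (1 ≤_) (sym (cong length (V-suc k))) (1≤W k)
p≤W zero = ≤-refl
p≤W (suc k) = <⇒≤ (p-suc<W k)
p-suc<W k = begin-strict
  p (suc k)                                    ≡⟨ p-suc k ⟩
  length (W k) + p k                           ≤⟨ +-monoʳ-≤ (length (W k)) (p≤W k) ⟩
  length (W k) + length (W k)                  <⟨ +-monoʳ-< (length (W k)) (+-monoˡ-≤ (length (W k)) (1≤V k)) ⟩
  length (W k) + (length (V k) + length (W k)) ≡⟨ sym (length-W-suc k) ⟩
  length (W (suc k)) ∎
  where open ≤-Reasoning

p-suc-suc : ∀ k → p (suc (suc k)) ≡ length (W (suc k)) + (length (W k) + p k)
p-suc-suc k = trans (p-suc (suc k)) (cong (length (W (suc k)) +_) (p-suc k))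

truncVal-total : ∀ k a → truncVal (suc k) a ≡ total (2 * suc (suc k) + 1) (λ i → digit a i * f i)
truncVal-total k a = trans (sum-upTo (2 * suc k + 3) _) (cong (λ n → total n (λ i → digit a i * f i)) (lem k))
  where
  lem : ∀ k → 2 * suc k + 3 ≡ 2 * suc (suc k) + 1
  lem = solveℕ-∀

position : ∀ K {t α} a → Admissible a → value a ≡ α → total (2 * K + 1) (λ i → digit a i * f i) ≡ t →
  ∃ λ Y → Prefix (Y ++ true ∷ []) × α ≡ t + length (τ^ K Y)
position K a adm v tr = case locate K a adm of λ
  { (Y , P , split , _) → Y , P , trans (sym v) (trans split (cong (_+ length (τ^ K Y)) tr)) }

-- By uniqueness of the block, the address found by `locate` for such a number is `Y` itself.
trunc-position : ∀ K {Y} → Prefix (Y ++ true ∷ []) → ∀ b → Admissible b →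
  length (τ^ K Y) ≤ value b → value b < length (τ^ K (Y ++ true ∷ [])) →
  value b ≡ total (2 * K + 1) (λ i → digit b i * f i) + length (τ^ K Y)
trunc-position K {Y} P b adm low high = case locate K b adm of λ { (Z , PZ , split , bound) →
  trans split (cong (λ w → total (2 * K + 1) (λ i → digit b i * f i) + length (τ^ K w))
    (sym (block-unique K {Y} {Z} (value b) P low high PZ (subst (length (τ^ K Z) ≤_) (sym split) (m≤n+m _ _)) bound))) }

E′-position : ∀ k α → E' (suc k) α → ∃ λ Y → Prefix (Y ++ true ∷ []) × α ≡ p (suc (suc k)) + length (τ^ (suc (suc k)) Y)
E′-position k α (a , (adm , v) , tr) = position (suc (suc k)) a adm v (trans (sym (truncVal-total k a)) (trans tr f-value))
  where
  lem : ∀ k → 2 * suc k + 3 ≡ 2 * suc (suc k) + 1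
  lem = solveℕ-∀
  f-value : f (2 * suc k + 3) / 2 ≡ p (suc (suc k))
  f-value = trans (cong (λ n → f n / 2) (lem k)) (f-odd/2 (suc (suc k)))

H≡D : ∀ m n → H m n ≡ D n (hankel (λ j → ℤ.+ s j) m)
H≡D m n = det≡D n _ (hankel (λ j → ℤ.+ s j) m) (λ _ _ → refl)

module Tile (k α : ℕ) (Y : List Bool) (P : Prefix (Y ++ true ∷ []))
  (α-position : α ≡ p (suc (suc k)) + length (τ^ (suc (suc k)) Y)) where

  open Block k Y P
  private
    g : ℕ
    g = length (W (suc k))

  -- The right mismatch is at α - 1: on the line m + n = α it fills the antidiagonal of the
  -- difference block, whose index is m + n - 1.
  α≡ : α ≡ suc (suc a₀ + cl)
  α≡ = trans α-position (trans (cong (_+ length (τ^ K Y)) (p-suc-suc k)) (trans (lem g q (p k) (length (τ^ K Y)))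
    (trans (cong (a₀ +_) (sym (length-core k))) (trans (+-suc a₀ (suc cl)) (cong suc (+-suc a₀ cl))))))
    where
    lem : ∀ g q p b → g + (q + p) + b ≡ b + p + (q + g)
    lem = solveℕ-∀

  α≡′ : α ≡ a₀ + (q + g)
  α≡′ = trans α≡ (trans (sym (trans (+-suc a₀ (suc cl)) (cong suc (+-suc a₀ cl)))) (cong (a₀ +_) (length-core k)))

  bottom : ∀ m → m + q ≤ α → α < m + q + g → H m q ≡ edgeSign k 0 0 *ℤ ℤ.+ p k
  bottom m upper lower with o , eq ← m≤n⇒∃[o]m+o≡n {suc a₀} {m} (+-cancelʳ-< (q + g) a₀ m (subst₂ _<_ α≡′ (+-assoc m q g) lower)) =
    trans (H≡D m q) (trans (cong (λ n → D n (hankel S m)) (sym (+-identityʳ q))) (edge m 0 0 o (trans (+-identityʳ m) (sym eq)) o+q≤ (λ _ ()) (λ _ ())))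
    where
    o+q≤ : o + (q + 0) ≤ suc cl
    o+q≤ = +-cancelˡ-≤ (suc a₀) _ _ (subst₂ _≤_ (trans (cong (_+ q) (sym eq)) (trans (+-assoc (suc a₀) o q) (cong (λ z → suc a₀ + (o + z)) (sym (+-identityʳ q)))))
      (trans α≡ (sym (+-suc (suc a₀) cl))) upper)

  right : ∀ m r → q + r ≤ suc cl → m + (q + r) ≡ α → H m (q + r) ≡ edgeSign k 0 r *ℤ ℤ.+ p k
  right m r small eq with o , eq′ ← m≤n⇒∃[o]m+o≡n {suc a₀} {m} (+-cancelʳ-≤ (suc cl) (suc a₀) m
      (≤-trans (≤-reflexive (trans (+-suc (suc a₀) cl) (trans (sym α≡) (sym eq)))) (+-monoʳ-≤ m small))) =
    trans (H≡D m (q + r)) (edge m 0 r o (trans (+-identityʳ m) (sym eq′)) (≤-reflexive total≡) (λ _ ()) (λ _ _ → total≡))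
    where
    total≡ : o + (q + r) ≡ suc cl
    total≡ = +-cancelˡ-≡ (suc a₀) _ _ (trans (sym (+-assoc (suc a₀) o (q + r))) (trans (cong (_+ (q + r)) eq′)
      (trans eq (trans α≡ (sym (+-suc (suc a₀) cl))))))

  left : ∀ m r → q + r ≤ suc cl → m + (q + r) + g ≡ α + 1 → H m (q + r) ≡ edgeSign k r 0 *ℤ ℤ.+ p k
  left m r small eq = trans (H≡D m (q + r)) (trans (cong (λ n → D n (hankel S m)) (cong (q +_) (sym (+-identityʳ r))))
    (edge m r 0 0 (trans start (sym (+-identityʳ (suc a₀)))) (subst (_≤ suc cl) (cong (q +_) (sym (+-identityʳ r))) small) (λ _ _ → refl) (λ _ ())))
    where
    lem₁ : ∀ m r q g → m + r + (q + g) ≡ m + (q + r) + g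
    lem₁ = solveℕ-∀
    lem₂ : ∀ a q → a + q + 1 ≡ suc a + q
    lem₂ = solveℕ-∀
    start : m + r ≡ suc a₀
    start = +-cancelʳ-≡ (q + g) _ _ (trans (lem₁ m r q g) (trans eq (trans (cong (_+ 1) α≡′) (lem₂ a₀ (q + g)))))

  top : ∀ m u v → q + (u + v) ≡ suc cl → m + (q + (u + v)) + u ≡ α → H m (q + (u + v)) ≡ edgeSign k u v *ℤ ℤ.+ p k
  top m u v size eq = trans (H≡D m (q + (u + v))) (edge m u v 0 start (≤-reflexive size) (λ _ _ → refl) (λ _ _ → size))
    where
    lem : ∀ m n u → m + u + n ≡ m + n + u
    lem = solveℕ-∀
    start : m + u ≡ suc a₀ + 0
    start = trans (+-cancelʳ-≡ (suc cl) _ _ (trans (cong (m + u +_) (sym size)) (trans (lem m _ u) (trans eq (trans α≡ (sym (+-suc (suc a₀) cl))))))) (sym (+-identityʳ _))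

  inside : ∀ m r → 0 < r → α + 1 < m + (q + r) + g → m + (q + r) < α → q + r < suc cl → H m (q + r) ≡ ℤ.+ 0
  inside m r 0<r lower upper small = trans (H≡D m (q + r)) (vanish m r 0<r
    (+-cancelʳ-< g _ _ (subst (_< m + (q + r) + g) (trans (cong (_+ 1) α≡′) (lem a₀ q g)) lower)) (subst (m + (q + r) <_) α≡ upper) small)
    where
    lem : ∀ a q g → a + (q + g) + 1 ≡ suc a + q + g
    lem = solveℕ-∀

  -- m + n is less than g below α, and α is at least g beyond the start of its block; so both lie in
  -- the same block and their truncated sums differ by u.
  offset : ∀ m n u → m + n + u ≡ α → α < m + n + g → ∀ b → IsRep b (m + n) → truncVal (suc k) b + u ≡ p K
  offset m n u eq lower b (adm , v) = +-cancelʳ-≡ B _ _ (trans (lem (truncVal (suc k) b) u B) (trans (cong (_+ u) (trans (sym split′) v)) (trans eq α-position)))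
    where
    B = length (τ^ K Y)
    lem : ∀ t u b → t + u + b ≡ t + b + u
    lem = solveℕ-∀
    lower′ : B ≤ value b
    lower′ = +-cancelʳ-≤ g _ _ (begin
      B + g              ≡⟨ +-comm B g ⟩
      g + B              ≤⟨ +-monoˡ-≤ B (≤-trans (m≤m+n g _) (≤-reflexive (sym (p-suc-suc k)))) ⟩
      p K + B            ≡⟨ sym α-position ⟩
      α                  ≤⟨ <⇒≤ lower ⟩
      m + n + g          ≡⟨ cong (_+ g) (sym v) ⟩
      value b + g ∎)
      where open ≤-Reasoning
    upper′ : value b < length (τ^ K (Y ++ true ∷ []))
    upper′ = begin-strict
      value b            ≡⟨ v ⟩
      m + n              ≤⟨ m≤m+n (m + n) u ⟩
      m + n + u          ≡⟨ trans eq (trans α-position (+-comm (p K) B)) ⟩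
      B + p K            <⟨ +-monoʳ-< B (p-suc<W (suc k)) ⟩
      B + length (W K)   ≡⟨ sym (trans (cong length (τ^-++ K Y (true ∷ []))) (length-++ (τ^ K Y))) ⟩
      length (τ^ K (Y ++ true ∷ [])) ∎
      where open ≤-Reasoning
    split′ : value b ≡ truncVal (suc k) b + B
    split′ = trans (trunc-position K P b adm lower′ upper′) (cong (_+ B) (sym (truncVal-total k b)))

-- The formulas of the theorem in terms of word lengths

f-even-suc : ∀ k → f (2 * k + 2) ≡ length (W (suc k))
f-even-suc k = trans (cong f (lem k)) (f-even (suc k))
  where
  lem : ∀ k → 2 * k + 2 ≡ 2 * suc k
  lem = solveℕ-∀

f-odd-suc : ∀ k → f (2 * k + 3) ≡ length (W k) + length (W (suc k))
f-odd-suc k = trans (cong f (lem k)) (trans (f-odd (suc k)) (trans (sym (length-WV (suc k)))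
  (trans (+-comm (length (W (suc k))) _) (cong (λ w → length w + length (W (suc k))) (V-suc k)))))
  where
  lem : ∀ k → 2 * k + 3 ≡ 2 * suc k + 1
  lem = solveℕ-∀

f-odd-suc²/2 : ∀ k → f (2 * k + 5) / 2 ≡ p (suc (suc k))
f-odd-suc²/2 k = trans (cong (λ n → f n / 2) (lem k)) (f-odd/2 (suc (suc k)))
  where
  lem : ∀ k → 2 * k + 5 ≡ 2 * suc (suc k) + 1
  lem = solveℕ-∀

f-even-suc-half : ∀ k → (f (2 * k + 2) ∸ 1) / 2 ≡ half (suc k)
f-even-suc-half k = trans (cong (λ n → (n ∸ 1) / 2) (trans (f-even-suc k) (length-W (suc k)))) (trans (cong (_/ 2) (lem (half (suc k)))) (m*n/n≡m (half (suc k)) 2))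
  where
  lem : ∀ h → h + h ≡ h * 2
  lem = solveℕ-∀

∸-slack : ∀ n w F → F ≡ suc (n + w) → (F ∸ n ≡ suc w) × (F ∸ 1 ∸ n ≡ w) × (F ∸ 2 ∸ n ≡ w ∸ 1)
∸-slack n w F refl = trans (cong (_∸ n) (sym (+-suc n w))) (m+n∸m≡n n (suc w)) , m+n∸m≡n n w ,
  trans (∸-+-assoc (n + w) 1 n) (trans (cong (n + w ∸_) (+-comm 1 n)) (trans (sym (∸-+-assoc (n + w) n 1)) (cong (_∸ 1) (m+n∸m≡n n w))))

minus-offset : ∀ t u → ℤ.+ (t + u) -ℤ ℤ.+ t ≡ ℤ.+ u
minus-offset t u = trans (cong (_-ℤ ℤ.+ t) (ℤP.pos-+ t u)) (lem (ℤ.+ t) (ℤ.+ u))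
  where
  lem : ∀ t u → t +ℤ u -ℤ t ≡ u
  lem = solve-∀

module Values (k m n : ℕ) where
  private
    q = length (W k)
    g = length (W (suc k))
    G = half (suc k)
    F = f (2 * k + 3)
    c = f (2 * k + 1) / 2

  side : ∀ w → F ≡ suc (n + w) → ∀ z → z ≡ - (sgn (suc w * k) *ℤ triSign w) → H m n ≡ z *ℤ ℤ.+ p k →
    H m n ≡ - (negOnePow (ℤ.+ ((F ∸ n) * k)) *ℤ (negOnePow (ℤ.+ ((F ∸ 1 ∸ n) * (F ∸ 2 ∸ n) / 2)) *ℤ ℤ.+ c))
  side w eqF z ez e with e₀ , e₁ , e₂ ← ∸-slack n w F eqF = begin
    H m n                                                ≡⟨ e ⟩
    z *ℤ ℤ.+ p k                                         ≡⟨ cong (_*ℤ ℤ.+ p k) ez ⟩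
    - (sgn (suc w * k) *ℤ triSign w) *ℤ ℤ.+ p k          ≡⟨ lem (sgn (suc w * k)) (triSign w) (ℤ.+ p k) ⟩
    - (sgn (suc w * k) *ℤ (triSign w *ℤ ℤ.+ p k))        ≡⟨ cong -_ (cong₂ _*ℤ_
       (sym (trans (sign-of-% ((F ∸ n) * k)) (cong (λ x → sgn (x * k)) e₀)))
       (cong₂ _*ℤ_ (sym (trans (sign-of-% ((F ∸ 1 ∸ n) * (F ∸ 2 ∸ n) / 2)) (trans (cong₂ (λ x y → sgn (x * y / 2)) e₁ e₂) (sgn-triangle w)))) (cong ℤ.+_ (sym (f-odd/2 k))))) ⟩
    _ ∎
    where
    open ≡-Reasoning
    lem : ∀ a b c → - (a *ℤ b) *ℤ c ≡ - (a *ℤ (b *ℤ c))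
    lem = solve-∀

  complement : ∀ r w → q + r ≡ n → F ≡ suc (n + w) → r + w ≡ G + G
  complement r w eqn eqF = suc-injective (+-cancelˡ-≡ q _ _ (begin
    q + suc (r + w)     ≡⟨ lem q r w ⟩
    suc (q + r + w)     ≡⟨ cong (λ z → suc (z + w)) eqn ⟩
    suc (n + w)         ≡⟨ sym eqF ⟩
    F                   ≡⟨ f-odd-suc k ⟩
    q + g               ≡⟨ cong (q +_) (length-W (suc k)) ⟩
    q + suc (G + G) ∎))
    where
    open ≡-Reasoning
    lem : ∀ q r w → q + suc (r + w) ≡ suc (q + r + w)
    lem = solveℕ-∀

module Conclusions (k m n α : ℕ) (q≤n : f (2 * k) ≤ n) (n<F : n < f (2 * k + 3)) (Y : List Bool)
  (P : Prefix (Y ++ true ∷ [])) (α-position : α ≡ p (suc (suc k)) + length (τ^ (suc (suc k)) Y))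
  (lower : α < n + m + f (2 * k + 2)) (upper : n + m ≤ α) where
  open Tile k α Y P α-position
  open Values k m n
  private
    q g G F c : ℕ
    q = length (W k)
    g = length (W (suc k))
    G = half (suc k)
    F = f (2 * k + 3)
    c = f (2 * k + 1) / 2
    open Block k Y P using (cl)

    split-n : ∃ λ r → q + r ≡ n
    split-n = m≤n⇒∃[o]m+o≡n (subst (_≤ n) (f-even k) q≤n)
    r = proj₁ split-n
    n≡ : q + r ≡ n
    n≡ = proj₂ split-n

    F≡cl : F ≡ suc (suc cl)
    F≡cl = trans (f-odd-suc k) (sym (length-core k))

    lower′ : α < m + n + g
    lower′ = subst₂ (λ x y → α < x + y) (+-comm n m) (f-even-suc k) lower

    upper′ : m + n ≤ α
    upper′ = subst (_≤ α) (+-comm n m) upper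

    slack : ∃ λ w → F ≡ suc (n + w)
    slack with w , e ← m≤n⇒∃[o]m+o≡n n<F = w , sym e

    small : q + r ≤ suc cl
    small = s≤s⁻¹ (subst₂ _<_ (sym n≡) F≡cl n<F)

  at-top : n ≡ F ∸ 1 → (b : List Bool) → IsRep b (m + n) →
    H m n ≡ negOnePow (ℤ.+ (k + 1)) *ℤ (negOnePow (ℤ.+ (f (2 * k + 5) / 2) -ℤ ℤ.+ truncVal (suc k) b) *ℤ ℤ.+ c)
  at-top n≡F b rep with u , eu ← m≤n⇒∃[o]m+o≡n upper′ = begin
    H m n                                            ≡⟨ cong (H m) n≡quv ⟩
    H m (q + (u + v))                                ≡⟨ top m u v (trans (sym n≡quv) n≡cl) (trans (cong (λ z → m + z + u) (sym n≡quv)) eu) ⟩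
    edgeSign k u v *ℤ ℤ.+ p k                        ≡⟨ cong (_*ℤ ℤ.+ p k) (edgeSign-top k u v (trans eq-r r≡GG)) ⟩
    sgn (suc k) *ℤ sgn u *ℤ ℤ.+ p k                  ≡⟨ ℤP.*-assoc (sgn (suc k)) (sgn u) (ℤ.+ p k) ⟩
    sgn (suc k) *ℤ (sgn u *ℤ ℤ.+ p k)                ≡⟨ cong₂ _*ℤ_ (trans (cong sgn (+-comm 1 k)) (sym (sign-of-% (k + 1))))
       (cong₂ _*ℤ_ (trans (sym (sign-of-% u)) (cong negOnePow (sym exponent))) (cong ℤ.+_ (sym (f-odd/2 k)))) ⟩
    _ ∎
    where
    open ≡-Reasoning
    n≡cl : n ≡ suc cl
    n≡cl = trans n≡F (cong (_∸ 1) F≡cl)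
    r≡GG : r ≡ G + G
    r≡GG = trans (sym (+-identityʳ r)) (complement r 0 n≡ (trans F≡cl (cong suc (trans (sym n≡cl) (sym (+-identityʳ n))))))
    -- The tile has the odd width g = 2G + 1, and r = 2G in its top row.
    u≤r : u ≤ r
    u≤r = subst (u ≤_) (sym r≡GG) (s≤s⁻¹ (subst (u <_) (length-W (suc k)) (+-cancelˡ-< (m + n) u g (subst (_< m + n + g) (sym eu) lower′))))
    v = proj₁ (m≤n⇒∃[o]m+o≡n u≤r)
    eq-r : u + v ≡ r
    eq-r = proj₂ (m≤n⇒∃[o]m+o≡n u≤r)
    n≡quv : n ≡ q + (u + v)
    n≡quv = trans (sym n≡) (cong (q +_) (sym eq-r))
    exponent : ℤ.+ (f (2 * k + 5) / 2) -ℤ ℤ.+ truncVal (suc k) b ≡ ℤ.+ u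
    exponent = trans (cong (λ z → ℤ.+ z -ℤ ℤ.+ truncVal (suc k) b) (trans (f-odd-suc²/2 k) (sym (offset m n u eu lower′ b rep))))
      (minus-offset (truncVal (suc k) b) u)

  at-bottom : n ≡ f (2 * k) → H m n ≡ negOnePow (ℤ.+ (k + 1)) *ℤ (negOnePow (ℤ.+ ((f (2 * k + 2) ∸ 1) / 2)) *ℤ ℤ.+ c)
  at-bottom n≡f = begin
    H m n                                  ≡⟨ cong (H m) n≡q ⟩
    H m q                                  ≡⟨ bottom m (subst (λ z → m + z ≤ α) n≡q upper′) (subst (λ z → α < m + z + g) n≡q lower′) ⟩
    edgeSign k 0 0 *ℤ ℤ.+ p k              ≡⟨ cong (_*ℤ ℤ.+ p k) (edgeSign-bottom k) ⟩
    sgn (suc k) *ℤ sgn G *ℤ ℤ.+ p k        ≡⟨ ℤP.*-assoc (sgn (suc k)) (sgn G) (ℤ.+ p k) ⟩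
    sgn (suc k) *ℤ (sgn G *ℤ ℤ.+ p k)      ≡⟨ cong₂ _*ℤ_ (trans (cong sgn (+-comm 1 k)) (sym (sign-of-% (k + 1))))
      (cong₂ _*ℤ_ (trans (cong sgn (sym (f-even-suc-half k))) (sym (sign-of-% ((f (2 * k + 2) ∸ 1) / 2)))) (cong ℤ.+_ (sym (f-odd/2 k)))) ⟩
    _ ∎
    where
    open ≡-Reasoning
    n≡q : n ≡ q
    n≡q = trans n≡f (f-even k)

  on-side : (m + n + f (2 * k + 2) ≡ α + 1) ⊎ (m + n ≡ α) →
    H m n ≡ - (negOnePow (ℤ.+ ((F ∸ n) * k)) *ℤ (negOnePow (ℤ.+ ((F ∸ 1 ∸ n) * (F ∸ 2 ∸ n) / 2)) *ℤ ℤ.+ c))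
  on-side (inj₁ eq) with w , eF ← slack = side w eF (edgeSign k r 0) (edgeSign-left k r w (complement r w n≡ eF))
    (trans (cong (H m) (sym n≡)) (left m r small (trans (cong₂ (λ x y → m + x + y) n≡ (sym (f-even-suc k))) eq)))
  on-side (inj₂ eq) with w , eF ← slack = side w eF (edgeSign k 0 r) (edgeSign-right k r w (complement r w n≡ eF))
    (trans (cong (H m) (sym n≡)) (right m r small (trans (cong (m +_) n≡) eq)))

  in-interior : f (2 * k) < n → n < F ∸ 1 → m + n + f (2 * k + 2) ≢ α + 1 → m + n ≢ α → H m n ≡ ℤ.+ 0
  in-interior q<n n<F-1 ≢left ≢right = trans (cong (H m) (sym n≡)) (inside m r
    (+-cancelˡ-< q 0 r (subst₂ _<_ (trans (f-even k) (sym (+-identityʳ q))) (sym n≡) q<n))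
    (subst (λ z → α + 1 < m + z + g) (sym n≡) (≤∧≢⇒< (subst (_≤ m + n + g) (+-comm 1 α) lower′) (≢left ∘ λ e → trans (cong (_+_ (m + n)) (f-even-suc k)) (sym e))))
    (subst (λ z → m + z < α) (sym n≡) (≤∧≢⇒< upper′ ≢right))
    (subst₂ _<_ (sym n≡) (cong (_∸ 1) F≡cl) n<F-1))
open import Data.Integer using (+_)

theorem1 : (k m n : ℕ) → InU k m n →
    ((n ≡ f (2 * k + 3) ∸ 1) →
    (a : List Bool) → IsRep a (m + n) →
    H m n ≡ negOnePow (+ (k + 1)) *ℤ (negOnePow (+ (f (2 * k + 5) / 2) -ℤ + truncVal (suc k) a) *ℤ + (f (2 * k + 1) / 2)))
    × ((n ≡ f (2 * k)) →
    H m n ≡ negOnePow (+ (k + 1)) *ℤ (negOnePow (+ ((f (2 * k + 2) ∸ 1) / 2)) *ℤ + (f (2 * k + 1) / 2)))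
    × (f (2 * k) < n → n < f (2 * k + 3) ∸ 1 →
    ((Σ ℕ (λ α → E' (suc k) α × ((m + n + f (2 * k + 2) ≡ α + 1) ⊎ (m + n ≡ α))) →
    H m n ≡ - (negOnePow (+ ((f (2 * k + 3) ∸ n) * k)) *ℤ (negOnePow (+ (((f (2 * k + 3) ∸ 1 ∸ n) * (f (2 * k + 3) ∸ 2 ∸ n)) / 2)) *ℤ + (f (2 * k + 1) / 2))))
    × (¬ (Σ ℕ (λ α → E' (suc k) α × ((m + n + f (2 * k + 2) ≡ α + 1) ⊎ (m + n ≡ α)))) →
    H m n ≡ + 0)))
theorem1 k m n (q≤n , n<F , α , α∈E′ , lower , upper) = main (E′-position k α α∈E′)
  where
  g = f (2 * k + 2)
  1≤g : 1 ≤ g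
  1≤g = subst (1 ≤_) (sym (f-even-suc k)) (1≤W (suc k))
  -- Either equation places (m , n) in the tile of β, so the formula is derived from β alone,
  -- without comparing it with α.
  around : ∀ β → (m + n + g ≡ β + 1) ⊎ (m + n ≡ β) → β < n + m + g × n + m ≤ β
  around β (inj₁ eq) = ≤-reflexive (trans (+-comm 1 β) (trans (sym eq) (cong (_+ g) (+-comm m n)))) ,
    +-cancelʳ-≤ 1 (n + m) β (subst₂ _≤_ (cong (_+ 1) (+-comm m n)) eq (+-monoʳ-≤ (m + n) 1≤g))
  around β (inj₂ eq) = subst (_< n + m + g) (trans (+-comm n m) eq) (m<m+n (n + m) 1≤g) , ≤-reflexive (trans (+-comm n m) eq)
  side : (Σ ℕ λ β → E' (suc k) β × ((m + n + g ≡ β + 1) ⊎ (m + n ≡ β))) → _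
  side (β , β∈E′ , eq) = at (E′-position k β β∈E′) (around β eq)
    where
    at : (∃ λ Y → Prefix (Y ++ true ∷ []) × β ≡ p (suc (suc k)) + length (τ^ (suc (suc k)) Y)) → β < n + m + g × n + m ≤ β → _
    at (Y , P , pos) (l , u) = Conclusions.on-side k m n β q≤n n<F Y P pos l u eq
  main : (∃ λ Y → Prefix (Y ++ true ∷ []) × α ≡ p (suc (suc k)) + length (τ^ (suc (suc k)) Y)) → _
  main (Y , P , pos) = at-top , at-bottom , λ q<n n<F-1 → side ,
    λ none → in-interior q<n n<F-1 (λ eq → none (α , α∈E′ , inj₁ eq)) (λ eq → none (α , α∈E′ , inj₂ eq))
    where
    open Conclusions k m n α q≤n n<F Y P pos lower upper
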